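{- Let $t\ge1$, let $n_1,\ldots,n_t\ge2$, and let $M_i=U(n_i-1,n_i)$ for $1\le i\le t$ be uniform matroids such that $E(M_i)\cap E(M_{i+1})=\{p_{i+1}\}$ for $1\le i\le t-1$, the elements $p_2,\ldots,p_t$ are pairwise distinct, and $E(M_i)\cap E(M_j)=\emptyset$ for $|i-j|\ge2$. Then for any field $k$ the parallel connection $M=P(M_1,\ldots,M_t;p_2,\ldots,p_t)$ has an NBC basis.
   Context: $U(r,n)$ is the uniform matroid of rank $r$ on an $n$-element set (bases: all $r$-subsets). For matroids $M,N$ with $E(M)\cap E(N)=\{p\}$, the parallel connection $P(M,N;p)$ is the matroid on $E(M)\cup E(N)$ with circuits $\mathcal{C}(M)\cup\mathcal{C}(N)\cup\{(C_1\cup C_2)\setminus\{p\}\mid C_1\in\mathcal{C}(M),C_2\in\mathcal{C}(N),p\in C_1\cap C_2\}$. Here $P_1=M_1$, $P_i=P(P_{i-1},M_i;p_i)$ for $2\le i\le t$, and $P(M_1,\ldots,M_t;p_2,\ldots,p_t)=P_t$. $M$ is a regular matroid. NBC basis: a regular matroid $M$ of rank $r$ on $n$ elements has an NBC basis if there is a linear ordering $e_1<\cdots<e_n$ of $E(M)$ with $B=\{e_{n-r+1},\ldots,e_n\}$ a basis such that $L(M)$ is a basis of $k(\Delta_{\mathrm{BC}}(M))$, defined as follows. $\Delta_{\mathrm{BC}}(M)$ is the broken circuit complex (subsets of $E$ containing no $\overline{C}=C\setminus\{\min C\}$ for a circuit $C$), $k[\Delta]$ its Stanley–Reisner ring. For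 $b\in B$, $\mathrm{coc}(B,b)$ is the unique cocircuit in $(E\setminus B)\cup\{b\}$; for $e\notin B$, $\mathrm{ci}(B,e)$ is the unique circuit in $B\cup\{e\}$. With an admissibly signed fundamental cocircuit incidence matrix $(a^*_{ji})$ w.r.t. $B$ (entries in $\{ -1,0,1\}$, nonzero exactly when $e_i\in\mathrm{coc}(B,e_j)$, such that some signed circuit incidence matrix is orthogonal to the signed cocircuit matrix over $k$), $\theta_{e_j}=\sum_{e_i\in\mathrm{coc}(B,e_j)}a^*_{ji}x_i$, $\Theta^B=\{\theta_e\mid e\in B\}$, $k(\Delta_{\mathrm{BC}}(M))=k[\Delta_{\mathrm{BC}}(M)]/(\Theta^B)$. Set $d_j=j$ for $j\le n-r$, $d_j=\min\{i\mid e_i\in\mathrm{coc}(B,e_j)\}$ for $j>n-r$; $m_C=x_i^{|\overline{C}|}$ if $C=\mathrm{ci}(B,e_i)$, and $m_C=\prod_{e_j\in\overline{C}}x_{d_j}$ otherwise. $L(M)$ is the set of monomials in $x_1,\ldots,x_{n-r}$ divisible by no $m_C$; it is a basis if the images of its elements form a $k$-basis. -}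

module Defs where

open import Level using (Level; _⊔_) renaming (suc to lsuc)
open import Algebra.Bundles using (CommutativeRing)
open import Data.Bool using (Bool; true; false; if_then_else_; _∧_)
import Data.Bool.Properties as BoolP
open import Data.Nat as ℕ using (ℕ; zero; suc; _≤_; _∸_; _≤ᵇ_; _<ᵇ_)
open import Data.Fin using (Fin; zero; suc; toℕ; inject₁; fromℕ)
import Data.Fin.Properties as FinP
open import Data.Fin.Subset using (Subset; _∈_; _∉_; _⊆_; _⊂_; _∪_; ⁅_⁆; ∣_∣; ∁)
open import Data.Fin.Subset.Properties using (_∈?_)
open import Data.Fin.Subset using () renaming (_-_ to _∖_)
open import Data.Vec using (Vec; tabulate; lookup; zipWith)
open import Data.Vec.Properties using (≡-dec)
open import Data.List using (List; []; _∷_; _++_; map; foldr; concatMap; allFin)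
open import Data.List.Relation.Unary.All using (All)
open import Data.List.Relation.Unary.Unique.Propositional using (Unique)
open import Data.Maybe using (Maybe; just; nothing; fromMaybe)
import Data.Maybe as Maybe
open import Data.Product using (Σ; ∃; _×_; _,_; proj₁; proj₂)
open import Data.Sum using (_⊎_)
open import Function using (_∘_; _⇔_; _↔_; Inverse)
open import Relation.Nullary using (¬_; does; yes; no)
open import Relation.Binary.PropositionalEquality using (_≡_; _≢_)

record Field (c ℓ : Level) : Set (lsuc (c ⊔ ℓ)) where
  field
    commutativeRing : CommutativeRing c ℓ
  open CommutativeRing commutativeRing public
  field
    1≉0     : ¬ (1# ≈ 0#)
    inverse : ∀ x → ¬ (x ≈ 0#) → ∃ λ y → (x * y) ≈ 1#

-- Matroids on (subsets of) Fin N, given by their family of circuits.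

CircFam : ℕ → Set₁
CircFam N = Subset N → Set

module _ {N : ℕ} where

  UBasis : Subset N → ℕ → Subset N → Set
  UBasis E r B = B ⊆ E × ∣ B ∣ ≡ r

  UIndep : Subset N → ℕ → Subset N → Set
  UIndep E r I = ∃ λ B → UBasis E r B × I ⊆ B

  UCirc : Subset N → ℕ → CircFam N
  UCirc E r C = C ⊆ E × ¬ UIndep E r C × (∀ D → D ⊂ C → UIndep E r D)

  data ParCirc (CM CN : CircFam N) (p : Fin N) : CircFam N where
    inM  : ∀ {C} → CM C → ParCirc CM CN p C
    inN  : ∀ {C} → CN C → ParCirc CM CN p C
    glue : ∀ {C} C₁ C₂ → CM C₁ → CN C₂ → p ∈ C₁ → p ∈ C₂ →
           C ≡ (C₁ ∪ C₂) ∖ p → ParCirc CM CN p C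

-- P(M_1,…,M_t; p_2,…,p_t) with 0-based indices: M i for i : Fin (suc t),
-- p k (k : Fin t) plays the role of p_{k+2}.
-- P_1 = M_1, P_i = P(P_{i-1}, M_i; p_i).
parChain : ∀ {N t} → (Fin (suc t) → CircFam N) → (Fin t → Fin N) → CircFam N
parChain {t = zero}  Ms p = Ms zero
parChain {t = suc t} Ms p =
  ParCirc (parChain (Ms ∘ inject₁) (p ∘ inject₁)) (Ms (fromℕ (suc t))) (p (fromℕ t))

module _ {N : ℕ} (Circ : CircFam N) where

  Indep : Subset N → Set
  Indep I = ∀ C → Circ C → ¬ (C ⊆ I)

  IsBasis : Subset N → Set
  IsBasis B = Indep B × (∀ x → x ∉ B → ¬ Indep (B ∪ ⁅ x ⁆))

  MeetsAllBases : Subset N → Set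
  MeetsAllBases D = ∀ B → IsBasis B → ∃ λ x → x ∈ D × x ∈ B

  IsCocircuit : Subset N → Set
  IsCocircuit D = MeetsAllBases D × (∀ D′ → D′ ⊂ D → ¬ MeetsAllBases D′)

firstPos : ∀ {n} → (Fin n → Bool) → Maybe (Fin n)
firstPos {zero}  f = nothing
firstPos {suc n} f = if f zero then just zero else Maybe.map suc (firstPos (f ∘ suc))

countFin : ∀ {n} → (Fin n → Bool) → ℕ
countFin {n} f = foldr ℕ._+_ 0 (map (λ i → if f i then 1 else 0) (allFin n))

_≟S_ : ∀ {n} (A B : Subset n) → Relation.Nullary.Dec (A ≡ B)
_≟S_ = ≡-dec BoolP._≟_

data Sign : Set where
  neg zer pos : Sign

module Poly {c ℓ} (K : Field c ℓ) (N : ℕ) where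
  open Field K

  ⟦_⟧ : Sign → Carrier
  ⟦ neg ⟧ = - 1#
  ⟦ zer ⟧ = 0#
  ⟦ pos ⟧ = 1#

  Mon : Set
  Mon = Vec ℕ N

  Pol : Set c
  Pol = List (Carrier × Mon)

  coeff : Pol → Mon → Carrier
  coeff [] m = 0#
  coeff ((a , u) ∷ q) m with ≡-dec ℕ._≟_ u m
  ... | yes _ = a + coeff q m
  ... | no  _ = coeff q m

  _≈P_ : Pol → Pol → Set ℓ
  p ≈P q = ∀ m → coeff p m ≈ coeff q m

  _+P_ : Pol → Pol → Pol
  _+P_ = _++_

  -P_ : Pol → Pol
  -P_ = map (λ t → (- proj₁ t , proj₂ t))

  _*P_ : Pol → Pol → Pol
  p *P q = concatMap (λ s → map (λ t → (proj₁ s * proj₁ t , zipWith ℕ._+_ (proj₂ s) (proj₂ t))) q) p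

  sumP : List Pol → Pol
  sumP = foldr _+P_ []

  sumK : List Carrier → Carrier
  sumK = foldr _+_ 0#

  InIdeal : (Pol → Set c) → Pol → Set (c ⊔ ℓ)
  InIdeal G p = ∃ λ (hs : List (Pol × Pol)) →
    All (λ hg → G (proj₂ hg)) hs × (p ≈P sumP (map (λ hg → proj₁ hg *P proj₂ hg) hs))

  unitMon : Fin N → ℕ → Mon
  unitMon i k = tabulate (λ v → if does (FinP._≟_ v i) then k else 0)

BsetOf : ∀ {N} → (Fin N ↔ Fin N) → ℕ → Subset N
BsetOf {N} π r = tabulate (λ x → N ∸ r ≤ᵇ toℕ (Inverse.from π x))

-- The NBC data.  Elements are Fin N (the ground set of M); the linear
-- ordering e_0 < … < e_{N-1} is e i = to π i; the variable x_i
-- corresponds to e_i.  Indices are 0-based: the paper's x_1..x_{n-r} are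
-- x_0..x_{N-r-1}, and B = {e_i | N-r ≤ i}.

module NBC {c ℓ} (K : Field c ℓ) {N : ℕ} (Circ : CircFam N) (π : Fin N ↔ Fin N) (r : ℕ)
           (cocF : Fin N → Subset N)
           (ciF  : Fin N → Subset N)
           (A    : Fin N → Fin N → Sign)
           where
  open Field K
  open Poly K N

  e : Fin N → Fin N
  e = Inverse.to π

  InB : Fin N → Set
  InB j = N ∸ r ≤ toℕ j

  Bset : Subset N
  Bset = BsetOf π r

  CocSpec : Set
  CocSpec = ∀ j → InB j → IsCocircuit Circ (cocF (e j)) × cocF (e j) ⊆ (∁ Bset ∪ ⁅ e j ⁆)

  CiSpec : Set
  CiSpec = ∀ i → ¬ InB i → Circ (ciF (e i)) × ciF (e i) ⊆ (Bset ∪ ⁅ e i ⁆)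

  CocSigned : Set
  CocSigned = ∀ j → InB j → ∀ i → (A j i ≢ zer) ⇔ (e i ∈ cocF (e j))

  Admissible : Set ℓ
  Admissible = ∃ λ (σ : Subset N → Fin N → Sign) →
    (∀ C → Circ C → ∀ i → (σ C i ≢ zer) ⇔ (e i ∈ C)) ×
    (∀ C → Circ C → ∀ j → InB j →
       sumK (map (λ i → ⟦ A j i ⟧ * ⟦ σ C i ⟧) (allFin N)) ≈ 0#)

  bar : Subset N → Subset N
  bar C with firstPos (λ i → does (e i ∈? C))
  ... | just i  = C ∖ e i
  ... | nothing = C

  Face : Subset N → Set
  Face F = ∀ C → Circ C → ¬ (bar C ⊆ F)

  monoOf : Subset N → Mon
  monoOf F = tabulate (λ i → if does (e i ∈? F) then 1 else 0)

  θ : Fin N → Pol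
  θ j = map (λ i → (⟦ A j i ⟧ , unitMon i 1)) (allFin N)

  -- generators of I_Δ + (Θ^B)
  Gen : Pol → Set c
  Gen g = (∃ λ F → ¬ Face F × g ≡ ((1# , monoOf F) ∷ []))
        ⊎ (∃ λ j → InB j × g ≡ θ j)

  d : Fin N → Fin N
  d j = if toℕ j <ᵇ N ∸ r then j
        else fromMaybe j (firstPos (λ i → does (e i ∈? cocF (e j))))

  mC : Subset N → Mon
  mC C with firstPos (λ i → (toℕ i <ᵇ N ∸ r) ∧ does (C ≟S ciF (e i)))
  ... | just i  = unitMon i ∣ bar C ∣
  ... | nothing = tabulate (λ v → countFin (λ j → does (e j ∈? bar C) ∧ does (FinP._≟_ (d j) v)))

  Divides : Mon → Mon → Set
  Divides u v = ∀ i → lookup u i ≤ lookup v i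

  InL : Mon → Set
  InL m = (∀ i → InB i → lookup m i ≡ 0) × (∀ C → Circ C → ¬ Divides (mC C) m)

  -- images of L(M) span k[Δ]/(Θ)
  Spanning : Set (c ⊔ ℓ)
  Spanning = ∀ p → ∃ λ (q : Pol) → All (λ t → InL (proj₂ t)) q × InIdeal Gen (p +P (-P q))

  -- images of L(M) are linearly independent in k[Δ]/(Θ)
  LinIndep : Set (c ⊔ ℓ)
  LinIndep = ∀ (q : Pol) → All (λ t → InL (proj₂ t)) q → Unique (map proj₂ q) →
             InIdeal Gen q → All (λ t → proj₁ t ≈ 0#) q

HasNBCBasis : ∀ {c ℓ} → Field c ℓ → ∀ {N} → CircFam N → Set (c ⊔ ℓ)
HasNBCBasis K {N} Circ =
  ∃ λ (π : Fin N ↔ Fin N) → ∃ λ (r : ℕ) →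
    r ≤ N × IsBasis Circ (BsetOf π r) ×
    (∃ λ cocF → ∃ λ ciF → ∃ λ A →
       let open NBC K Circ π r cocF ciF A in
       CocSpec × CiSpec × CocSigned × Admissible × Spanning × LinIndep)

module Submission where

-- Order the ground set so that the chords x_0 < … < x_t come first, where x_i is the element shared by
-- E_i and E_{i+1} (and x_t is any remaining element of E_t).  The circuits are the symmetric differences
-- of consecutive polygons E_a, …, E_c, and the minimal broken circuits are the pairwise disjoint sets
-- E_i minus its least element.  The linear forms identify every other element of E_i with
-- y_i = x_i + … + x_t, so the quotient ring is k[x_0,…,x_t] modulo y_0^{k_0} and
-- x_i y_i^{k_i} for i ≥ 1, where k_i counts the non-chords of E_i.  The i-th relation is monic in x_i
-- over the variables x_{i+1},…,x_t: this tower of monic extensions makes the box of monomials L(M) span.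
-- For independence, the ring acts on functions of the exponents of y_0,…,y_t by shifts; normal forms in
-- the y_i give functionals that are unitriangular on L(M) for the lexicographic order.

open import Defs
open import Level using (_⊔_) renaming (suc to lsuc)
open import Algebra.Bundles using (AbelianGroup; CommutativeMonoid)
import Algebra.Construct.Pointwise as Pointwise
import Algebra.Properties.AbelianGroup as AbelianGroupProperties
import Algebra.Properties.CommutativeMonoid.Sum as CommutativeMonoidSum
import Algebra.Properties.CommutativeSemigroup as CommutativeSemigroupProperties
import Algebra.Properties.Ring as RingProperties
open import Data.Bool using (Bool; true; false; if_then_else_; _∧_)
import Data.Bool.Properties as BoolP
import Data.Empty as Empty
open import Data.Fin using (Fin; zero; suc; toℕ; inject₁; fromℕ; fromℕ<; _↑ˡ_; _↑ʳ_; splitAt; join)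
import Data.Fin.Properties as FinP
import Data.Fin.Permutation as Perm
import Data.Fin.Permutation.Components as PermC
open import Data.Fin.Relation.Unary.Top using (view; ‵fromℕ; ‵inject₁; view-inject₁)
open import Data.Fin.Subset using (Subset; _∈_; _∉_; _⊆_; _⊂_; _∪_; _∩_; ⁅_⁆; ∣_∣; ∁; inside; outside; _─_; Nonempty)
open import Data.Fin.Subset using () renaming (_-_ to _∖_; ⊥ to ∅)
open import Data.Fin.Subset.Properties as SubsetP using (_∈?_)
open import Data.List as List using (List; []; _∷_; length; map; foldr; allFin)
import Data.List.Properties as ListP
open import Data.List.Relation.Unary.All as All using (All; []; _∷_)
import Data.List.Relation.Unary.All.Properties as AllP
open import Data.List.Relation.Unary.AllPairs using ([]; _∷_)
open import Data.List.Relation.Unary.Unique.Propositional using (Unique)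
open import Data.Maybe as Maybe using (Maybe; just; nothing)
open import Data.Nat as ℕ using (ℕ; zero; suc; _≤_; _<_; _∸_; _<ᵇ_; z≤n; s≤s)
import Data.Nat.Properties as ℕP
open import Data.Product using (∃; ∃₂; _×_; _,_; proj₁; proj₂)
open import Data.Sum as Sum using (_⊎_; inj₁; inj₂)
open import Data.Sum.Properties using (inj₁-injective)
open import Data.Vec as Vec using (Vec; []; _∷_; _++_; tabulate; here; there; lookup; zipWith; replicate; updateAt)
import Data.Vec.Properties as VecP
open import Function using (_∘_; _⇔_; mk⇔; Equivalence; _↔_; Inverse)
open import Function.Definitions using (Injective)
open import Relation.Nullary using (Dec; does; yes; no; contradiction; ¬_)
open import Relation.Nullary.Decidable using (_⊎-dec_; _×-dec_; dec-true; dec-false; does-⇔)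
open import Relation.Binary.Definitions using (tri<; tri≈; tri>)
open import Relation.Binary.PropositionalEquality as ≡ using (_≡_; _≢_)

open Equivalence using () renaming (to to ⇒; from to ⇐)

-- `E_0` is special because of the ordering. For `i ≥ 1` the least element of `E_i` is `x_{i-1}`, so
-- its broken circuit keeps `x_i`. The only chord in `E_0` is `x_0`, its own minimum, and non-chords
-- alone remain. Hence the relations `x_i y_i^{k_i}` against `y_0^{k_0}`, and exponent bounds `k_i`
-- against `k_0 - 1`. Every other broken circuit contains one of these. Rewriting shows that the box
-- spans, but does not exclude that some nonzero combination of box monomials lies in the ideal.
-- Substituting `x_i = y_i - y_{i+1}` turns the relations into `y_i^{k_i+1} = y_{i+1} y_i^{k_i}`, a
-- carry rule on exponents that ends at `y_{t+1} = 0`. Digits are normalised in one pass towards the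
-- later ones, and confluence never has to be discussed: it is enough that "the coefficient of `y^m`
-- in the normal form" is annihilated by each generator, for then commuting operators annihilate it
-- along the whole ideal.

module Sums {a ℓ} (M : CommutativeMonoid a ℓ) where
  open CommutativeMonoid M
  open CommutativeMonoidSum M public

  sum-↑ : ∀ m {n} (f : Fin (m ℕ.+ n) → Carrier) →
          sum f ≈ sum (λ i → f (i ↑ˡ n)) ∙ sum (λ j → f (m ↑ʳ j))
  sum-↑ zero    f = sym (identityˡ _)
  sum-↑ (suc m) f = trans (∙-congˡ (sum-↑ m (f ∘ suc))) (sym (assoc _ _ _))

  sum-zero : ∀ {n} {f : Fin n → Carrier} → (∀ i → f i ≈ ε) → sum f ≈ ε
  sum-zero {zero}  z = refl
  sum-zero {suc n} z = trans (∙-cong (z zero) (sum-zero (z ∘ suc))) (identityˡ ε)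

  sum-single : ∀ {n} {f : Fin n → Carrier} i → (∀ j → j ≢ i → f j ≈ ε) → sum f ≈ f i
  sum-single {suc n} zero    z = trans (∙-congˡ (sum-zero (λ j → z (suc j) λ ()))) (identityʳ _)
  sum-single {suc n} (suc i) z = trans
    (∙-cong (z zero λ ()) (sum-single i (λ j j≢i → z (suc j) (j≢i ∘ FinP.suc-injective)))) (identityˡ _)

module ℕSums = Sums ℕP.+-0-commutativeMonoid

-- Towers of monic extensions

pow : ∀ {a} {A : Set a} → (A → A) → ℕ → A → A
pow f zero    w = w
pow f (suc n) w = f (pow f n w)

module Endomorphisms {a ℓ} (G : AbelianGroup a ℓ) where
  open AbelianGroup G
    renaming (_∙_ to _+_; ε to 0#; _⁻¹ to -_; ∙-cong to +-cong; ∙-congˡ to +-congˡ; ∙-congʳ to +-congʳ;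
              identityˡ to +-identityˡ; identityʳ to +-identityʳ; inverseˡ to -‿inverseˡ;
              inverseʳ to -‿inverseʳ; ⁻¹-cong to -‿cong; assoc to +-assoc; comm to +-comm)
  open AbelianGroupProperties G
  open CommutativeSemigroupProperties commutativeSemigroup using (interchange)
  open import Relation.Binary.Reasoning.Setoid setoid

  record IsEndo (f : Carrier → Carrier) : Set (a ⊔ ℓ) where
    field
      cong   : ∀ {v w} → v ≈ w → f v ≈ f w
      homo : ∀ v w → f (v + w) ≈ f v + f w

    0-homo : f 0# ≈ 0#
    0-homo = identityˡ-unique (f 0#) (f 0#) (trans (sym (homo 0# 0#)) (cong (+-identityˡ 0#)))

    -‿homo : ∀ w → f (- w) ≈ - f w
    -‿homo w = inverseˡ-unique (f (- w)) (f w)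
      (trans (sym (homo (- w) w)) (trans (cong (-‿inverseˡ w)) 0-homo))

  open IsEndo

  _⊞_ : (Carrier → Carrier) → (Carrier → Carrier) → Carrier → Carrier
  (f ⊞ g) w = f w + g w

  0-endo : IsEndo (λ _ → 0#)
  0-endo = record { cong = λ _ → refl ; homo = λ _ _ → sym (+-identityˡ 0#) }

  ⊞-endo : ∀ {f g} → IsEndo f → IsEndo g → IsEndo (f ⊞ g)
  ⊞-endo f g = record
    { cong = λ e → +-cong (cong f e) (cong g e)
    ; homo = λ v w → trans (+-cong (homo f v w) (homo g v w)) (interchange _ _ _ _) }

  Commute : (Carrier → Carrier) → (Carrier → Carrier) → Set (a ⊔ ℓ)
  Commute f g = ∀ w → f (g w) ≈ g (f w)

  pow-comm : ∀ {f g} → IsEndo f → Commute g f → ∀ n → Commute g (pow f n)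
  pow-comm f c zero    w = refl
  pow-comm f c (suc n) w = trans (c _) (cong f (pow-comm f c n w))

  record IsSubgroup {p} (S : Carrier → Set p) : Set (a ⊔ ℓ ⊔ p) where
    field
      resp : ∀ {v w} → v ≈ w → S v → S w
      zero-closed : S 0#
      +-closed : ∀ {v w} → S v → S w → S (v + w)
      neg-closed : ∀ {w} → S w → S (- w)

  open IsSubgroup

  -- Adjoin S x a = S + x S + … + x^(a-1) S
  data Adjoin {p} (S : Carrier → Set p) (x : Carrier → Carrier) : ℕ → Carrier → Set (a ⊔ ℓ ⊔ p) where
    none : ∀ {w} → w ≈ 0# → Adjoin S x zero w
    more : ∀ {n w f s} → Adjoin S x n f → S s → w ≈ f + pow x n s → Adjoin S x (suc n) w

  module _ {p} {S : Carrier → Set p} (isS : IsSubgroup S) {x : Carrier → Carrier} (isX : IsEndo x) where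

    private
      F : ℕ → Carrier → Set (a ⊔ ℓ ⊔ p)
      F = Adjoin S x

    pow-zero : ∀ n → pow x n 0# ≈ 0#
    pow-zero zero    = refl
    pow-zero (suc n) = trans (cong isX (pow-zero n)) (0-homo isX)

    pow-+ : ∀ n v w → pow x n (v + w) ≈ pow x n v + pow x n w
    pow-+ zero    v w = refl
    pow-+ (suc n) v w = trans (cong isX (pow-+ n v w)) (homo isX _ _)

    Adjoin-resp : ∀ {n v w} → v ≈ w → F n v → F n w
    Adjoin-resp e (none z)     = none (trans (sym e) z)
    Adjoin-resp e (more f s q) = more f s (trans (sym e) q)

    Adjoin-zero : ∀ n → F n 0#
    Adjoin-zero zero    = none refl
    Adjoin-zero (suc n) = more (Adjoin-zero n) (zero-closed isS)
      (sym (trans (+-congˡ (pow-zero n)) (+-identityˡ 0#)))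

    Adjoin-+ : ∀ {n v w} → F n v → F n w → F n (v + w)
    Adjoin-+ (none e) (none e′) = none (trans (+-cong e e′) (+-identityˡ 0#))
    Adjoin-+ {suc n} (more f s e) (more f′ s′ e′) = more (Adjoin-+ f f′) (+-closed isS s s′)
      (trans (+-cong e e′) (trans (interchange _ _ _ _) (+-congˡ (sym (pow-+ n _ _)))))

    Adjoin-neg : ∀ {n w} → F n w → F n (- w)
    Adjoin-neg (none e) = none (trans (-‿cong e) ε⁻¹≈ε)
    Adjoin-neg {suc n} (more Ff Ss e) = more (Adjoin-neg Ff) (neg-closed isS Ss)
      (trans (-‿cong e) (trans (sym (⁻¹-∙-comm _ _)) (+-congˡ (sym (pow-neg n _)))))
      where
      pow-neg : ∀ n w → pow x n (- w) ≈ - pow x n w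
      pow-neg zero    w = refl
      pow-neg (suc n) w = trans (cong isX (pow-neg n w)) (-‿homo isX _)

    Adjoin-isSubgroup : ∀ n → IsSubgroup (F n)
    Adjoin-isSubgroup n = record
      { resp = Adjoin-resp ; zero-closed = Adjoin-zero n ; +-closed = Adjoin-+ ; neg-closed = Adjoin-neg }

    Adjoin-shift : ∀ {n w} → F n w → F (suc n) (x w)
    Adjoin-shift (none e) = more (none refl) (zero-closed isS)
      (trans (cong isX e) (trans (0-homo isX) (sym (+-identityˡ 0#))))
    Adjoin-shift (more f s e) = more (Adjoin-shift f) s (trans (cong isX e) (homo isX _ _))

    Adjoin-weaken : ∀ {n w} → F n w → F (suc n) w
    Adjoin-weaken {n} f = more f (zero-closed isS) (sym (trans (+-congˡ (pow-zero n)) (+-identityʳ _)))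

    Adjoin-pow : ∀ n {s} → S s → F (suc n) (pow x n s)
    Adjoin-pow n s = more (Adjoin-zero n) s (sym (+-identityˡ _))

    Adjoin-comm : ∀ {y} → IsEndo y → Commute y x → (∀ {s} → S s → S (y s)) →
                  ∀ {n w} → F n w → F n (y w)
    Adjoin-comm isY c yS (none e)     = none (trans (cong isY e) (0-homo isY))
    Adjoin-comm isY c yS {suc n} (more f s e) = more (Adjoin-comm isY c yS f) (yS s)
      (trans (cong isY e) (trans (homo isY _ _) (+-congˡ (pow-comm isX c n _))))

    module _ {y : Carrier → Carrier} (isY : IsEndo y) (c : Commute y x) (yS : ∀ {s} → S s → S (y s)) where

      -- `(x + y)^n` is monic in `x`: the induction multiplies by `x + y` and collects all lower
      -- powers of `x` in `f`, so that no binomial coefficients occur.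
      Adjoin-monic : ∀ n {s} → S s → ∃ λ f → F n f × pow (x ⊞ y) n s ≈ f + pow x n s
      Adjoin-monic zero    {s} Ss = 0# , none refl , sym (+-identityˡ s)
      Adjoin-monic (suc n) {s} Ss with Adjoin-monic n Ss
      ... | f , Ff , e = x f + (y f + y (pow x n s))
        , Adjoin-+ (Adjoin-shift Ff)
            (Adjoin-+ (Adjoin-weaken (Adjoin-comm isY c yS Ff))
              (Adjoin-resp (sym (pow-comm isX c n s)) (Adjoin-pow n (yS Ss))))
        , (begin
            x (pow (x ⊞ y) n s) + y (pow (x ⊞ y) n s)
              ≈⟨ +-cong (trans (cong isX e) (homo isX _ _)) (trans (cong isY e) (homo isY _ _)) ⟩
            (x f + pow x (suc n) s) + (y f + y (pow x n s))
              ≈⟨ +-assoc _ _ _ ⟩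
            x f + (pow x (suc n) s + (y f + y (pow x n s)))
              ≈⟨ +-congˡ (+-comm _ _) ⟩
            x f + ((y f + y (pow x n s)) + pow x (suc n) s)
              ≈⟨ +-assoc _ _ _ ⟨
            (x f + (y f + y (pow x n s))) + pow x (suc n) s ∎)

      module _ (n : ℕ)
               (rel : (∀ w → x (pow (x ⊞ y) n w) ≈ 0#) ⊎ (∀ w → (x ⊞ y) (pow (x ⊞ y) n w) ≈ 0#)) where

        private
          zero-sum : ∀ {f v} → F (suc n) f → f + v ≈ 0# → F (suc n) v
          zero-sum Ff e = Adjoin-resp (sym (inverseʳ-unique _ _ e)) (Adjoin-neg Ff)

          -- Both forms of the relation are monic of degree `n + 1` in `x`. Solving for the leading
          -- power brings back the only term that leaves the range when `x` is applied.
          top : (∀ w → x (pow (x ⊞ y) n w) ≈ 0#) ⊎ (∀ w → (x ⊞ y) (pow (x ⊞ y) n w) ≈ 0#) →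
                ∀ {s} → S s → F (suc n) (pow x (suc n) s)
          top (inj₁ r) {s} Ss with Adjoin-monic n Ss
          ... | f , Ff , e = zero-sum (Adjoin-shift Ff)
                  (trans (sym (homo isX _ _)) (trans (cong isX (sym e)) (r s)))
          top (inj₂ r) {s} Ss with Adjoin-monic (suc n) Ss
          ... | f , Ff , e = zero-sum Ff (trans (sym e) (r s))

        Adjoin-closed : ∀ {w} → F (suc n) w → F (suc n) (x w)
        Adjoin-closed (more f s e) =
          Adjoin-resp (sym (trans (cong isX e) (homo isX _ _))) (Adjoin-+ (Adjoin-shift f) (top rel s))

  tailSum : ∀ {s} → (Fin s → Carrier → Carrier) → Carrier → Carrier
  tailSum {zero}  X w = 0#
  tailSum {suc s} X = X zero ⊞ tailSum (X ∘ suc)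

  tailSum-endo : ∀ {s} {X : Fin s → Carrier → Carrier} → (∀ i → IsEndo (X i)) → IsEndo (tailSum X)
  tailSum-endo {zero}  e = 0-endo
  tailSum-endo {suc s} e = ⊞-endo (e zero) (tailSum-endo (e ∘ suc))

  tailSum-comm : ∀ {s} {X : Fin s → Carrier → Carrier} {f} → IsEndo f → (∀ i → Commute (X i) f) →
                 Commute (tailSum X) f
  tailSum-comm {zero}  isf c w = sym (0-homo isf)
  tailSum-comm {suc s} isf c w = trans (+-cong (c zero w) (tailSum-comm isf (c ∘ suc) w)) (sym (homo isf _ _))

  -- The operator of `y_i = x_i + … + x_{s-1}` when `X i` is that of `x_i`.
  tailFrom : ∀ {s} → (Fin s → Carrier → Carrier) → Fin s → Carrier → Carrier
  tailFrom X zero    = tailSum X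
  tailFrom X (suc i) = tailFrom (X ∘ suc) i

  tailFrom-endo : ∀ {s} {X : Fin s → Carrier → Carrier} → (∀ i → IsEndo (X i)) → ∀ i → IsEndo (tailFrom X i)
  tailFrom-endo e zero    = tailSum-endo e
  tailFrom-endo e (suc i) = tailFrom-endo (e ∘ suc) i

  -- The left alternative is `x_i y_i^(κ_i) = 0`, the right one `y_i^(κ_i + 1) = 0`. As `y_i` is
  -- `x_i` plus later variables, both are monic of degree `κ i + 1` in `x_i`.
  Relations : ∀ {s} → (Fin s → Carrier → Carrier) → (Fin s → ℕ) → Set (a ⊔ ℓ)
  Relations X κ = ∀ i → (∀ w → X i (pow (tailFrom X i) (κ i) w) ≈ 0#) ⊎
                        (∀ w → tailFrom X i (pow (tailFrom X i) (κ i) w) ≈ 0#)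

  module _ {p} (S₀ : Carrier → Set p) where

    -- Generated from `S₀` by the monomials with exponents at most `κ`. The nesting keeps later
    -- variables in the coefficients, as suits relations that are monic in `X i` over the variables
    -- after it.
    BoxSpan : ∀ {s} → (Fin s → Carrier → Carrier) → (Fin s → ℕ) → Carrier → Set (a ⊔ ℓ ⊔ p)
    BoxSpan {zero}  X κ w = ∃ λ v → S₀ v × w ≈ v
    BoxSpan {suc s} X κ = Adjoin (BoxSpan (X ∘ suc) (κ ∘ suc)) (X zero) (suc (κ zero))

    module _ (isS₀ : IsSubgroup S₀) where

      BoxSpan-isSubgroup : ∀ {s X κ} → (∀ i → IsEndo (X i)) → IsSubgroup (BoxSpan {s} X κ)
      BoxSpan-isSubgroup {zero} eX = record
        { resp = λ e (v , Sv , q) → v , Sv , trans (sym e) q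
        ; zero-closed = 0# , zero-closed isS₀ , refl
        ; +-closed = λ (v , Sv , q) (v′ , Sv′ , q′) → v + v′ , +-closed isS₀ Sv Sv′ , +-cong q q′
        ; neg-closed = λ (v , Sv , q) → - v , neg-closed isS₀ Sv , -‿cong q }
      BoxSpan-isSubgroup {suc s} eX = Adjoin-isSubgroup (BoxSpan-isSubgroup (eX ∘ suc)) (eX zero) _

      -- Induction from the last variable. The coefficient group is already closed under the later
      -- variables, hence under their sum, the `y` in the monic relation for `X zero`. A later
      -- operator passes through powers of `X zero` by commutativity.
      BoxSpan-closed : ∀ {s X κ} → (∀ i → IsEndo (X i)) → (∀ i j → Commute (X i) (X j)) →
                       Relations X κ → ∀ i {w} → BoxSpan {s} X κ w → BoxSpan X κ (X i w)
      BoxSpan-closed {suc s} {X} {κ} eX cX r = go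
        where
        S : Carrier → Set (a ⊔ ℓ ⊔ p)
        S = BoxSpan (X ∘ suc) (κ ∘ suc)
        isS : IsSubgroup S
        isS = BoxSpan-isSubgroup (eX ∘ suc)
        X-closed : ∀ i {w} → S w → S (X (suc i) w)
        X-closed = BoxSpan-closed (eX ∘ suc) (λ i j → cX (suc i) (suc j)) (r ∘ suc)
        -- The index map `f` lets the recursion shorten the sum while `X` and `S` stay fixed.
        tailSum-closed : ∀ {n} (f : Fin n → Fin s) {w} → S w → S (tailSum (X ∘ suc ∘ f) w)
        tailSum-closed {zero}  f w = zero-closed isS
        tailSum-closed {suc n} f w = +-closed isS (X-closed (f zero) w) (tailSum-closed (f ∘ suc) w)
        go : ∀ i {w} → BoxSpan X κ w → BoxSpan X κ (X i w)
        go zero = Adjoin-closed isS (eX zero) (tailSum-endo (eX ∘ suc))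
          (tailSum-comm (eX zero) (λ i → cX (suc i) zero)) (tailSum-closed (λ i → i)) (κ zero) (r zero)
        go (suc i) = Adjoin-comm isS (eX zero) (eX (suc i)) (cX (suc i) zero) (X-closed i)

-- Polynomials acting on modules

monAct : ∀ {a} {A : Set a} {n} → (Fin n → A → A) → Vec ℕ n → A → A
monAct X []      w = w
monAct X (a ∷ u) w = pow (X zero) a (monAct (X ∘ suc) u w)

monAct-++ : ∀ {a} {A : Set a} {s r} (X : Fin (s ℕ.+ r) → A → A) (u : Vec ℕ s) (v : Vec ℕ r) w →
            monAct X (u ++ v) w ≡ monAct (λ i → X (i ↑ˡ r)) u (monAct (λ j → X (s ↑ʳ j)) v w)
monAct-++ X []      v w = ≡.refl
monAct-++ X (a ∷ u) v w = ≡.cong (pow (X zero) a) (monAct-++ (X ∘ suc) u v w)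

monAct-zero : ∀ {a} {A : Set a} {n} (X : Fin n → A → A) w → monAct X (replicate n 0) w ≡ w
monAct-zero {n = zero}  X w = ≡.refl
monAct-zero {n = suc n} X w = monAct-zero (X ∘ suc) w

indicator : ∀ {n} → (Fin n → Bool) → Vec ℕ n
indicator f = tabulate (λ v → if f v then 1 else 0)

count : ∀ {n} → (Fin n → Bool) → ℕ
count f = ℕSums.sum (λ v → if f v then 1 else 0)

module MonomialAction {a ℓ} (G : AbelianGroup a ℓ) where
  open AbelianGroup G
  open Endomorphisms G public
  open IsEndo

  pow-add : ∀ (f : Carrier → Carrier) m n w → pow f (m ℕ.+ n) w ≡ pow f m (pow f n w)
  pow-add f zero    n w = ≡.refl
  pow-add f (suc m) n w = ≡.cong f (pow-add f m n w)

  pow-endo : ∀ {f} → IsEndo f → ∀ n → IsEndo (pow f n)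
  pow-endo f zero    = record { cong = λ e → e ; homo = λ _ _ → refl }
  pow-endo f (suc n) = record
    { cong = λ e → cong f (cong (pow-endo f n) e)
    ; homo = λ v w → trans (cong f (homo (pow-endo f n) v w)) (homo f _ _) }

  monAct-endo : ∀ {n} {X : Fin n → Carrier → Carrier} → (∀ i → IsEndo (X i)) →
                ∀ u → IsEndo (monAct X u)
  monAct-endo e []      = record { cong = λ q → q ; homo = λ _ _ → refl }
  monAct-endo e (a ∷ u) = record
    { cong = λ q → cong (pow-endo (e zero) a) (cong (monAct-endo (e ∘ suc) u) q)
    ; homo = λ v w → trans (cong (pow-endo (e zero) a) (homo (monAct-endo (e ∘ suc) u) v w))
                           (homo (pow-endo (e zero) a) _ _) }

  monAct-comm : ∀ {n} {X : Fin n → Carrier → Carrier} {f} → (∀ i → IsEndo (X i)) →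
                (∀ i → Commute f (X i)) → ∀ u → Commute f (monAct X u)
  monAct-comm e c []      w = refl
  monAct-comm e c (a ∷ u) w = trans (pow-comm (e zero) (c zero) a _)
    (cong (pow-endo (e zero) a) (monAct-comm (e ∘ suc) (c ∘ suc) u w))

  monAct-zipWith : ∀ {n} {X : Fin n → Carrier → Carrier} → (∀ i → IsEndo (X i)) →
                   (∀ i j → Commute (X i) (X j)) → ∀ u v w →
                   monAct X (zipWith ℕ._+_ u v) w ≈ monAct X u (monAct X v w)
  monAct-zipWith e c []      []      w = refl
  monAct-zipWith {X = X} e c (a ∷ u) (b ∷ v) w = begin
    pow (X zero) (a ℕ.+ b) (monAct X′ (zipWith ℕ._+_ u v) w)
      ≡⟨ pow-add (X zero) a b _ ⟩
    pow (X zero) a (pow (X zero) b (monAct X′ (zipWith ℕ._+_ u v) w))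
      ≈⟨ cong (pow-endo (e zero) a) (cong (pow-endo (e zero) b)
           (monAct-zipWith (e ∘ suc) (λ i j → c (suc i) (suc j)) u v w)) ⟩
    pow (X zero) a (pow (X zero) b (monAct X′ u (monAct X′ v w)))
      ≈⟨ cong (pow-endo (e zero) a) (monAct-comm (e ∘ suc) pow-X u _) ⟩
    pow (X zero) a (monAct X′ u (pow (X zero) b (monAct X′ v w))) ∎
    where
    open import Relation.Binary.Reasoning.Setoid setoid
    X′ : Fin _ → Carrier → Carrier
    X′ = X ∘ suc
    pow-X : ∀ i → Commute (pow (X zero) b) (X (suc i))
    pow-X i w = sym (pow-comm (e zero) (c (suc i) zero) b w)

  monAct-cong-ops : ∀ {n} {X Y : Fin n → Carrier → Carrier} → (∀ i → IsEndo (X i)) →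
                    (∀ i w → X i w ≈ Y i w) → ∀ u w → monAct X u w ≈ monAct Y u w
  monAct-cong-ops e q []      w = refl
  monAct-cong-ops {X = X} {Y} e q (a ∷ u) w = trans
    (cong (pow-endo (e zero) a) (monAct-cong-ops (e ∘ suc) (q ∘ suc) u w)) (go a _)
    where
    go : ∀ n w → pow (X zero) n w ≈ pow (Y zero) n w
    go zero    w = refl
    go (suc n) w = trans (cong (e zero) (go n w)) (q zero _)

  -- Used with `Z` the operator of `y_i`: the non-chords of one polygon all act alike, so their
  -- product acts as a power of `y_i`.
  monAct-indicator : ∀ {n} {X : Fin n → Carrier → Carrier} {Z} → IsEndo Z → (f : Fin n → Bool) →
                     (∀ j → f j ≡ true → ∀ w → X j w ≈ Z w) → ∀ w →
                     monAct X (indicator f) w ≈ pow Z (count f) w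
  monAct-indicator {zero}  eZ f q w = refl
  monAct-indicator {suc n} eZ f q w with f zero in eq
  ... | true  = trans (q zero eq _) (cong eZ (monAct-indicator eZ (f ∘ suc) (q ∘ suc) w))
  ... | false = monAct-indicator eZ (f ∘ suc) (q ∘ suc) w

  monAct-single : ∀ {n} (X : Fin n → Carrier → Carrier) i k w →
                  monAct X (tabulate (λ v → if does (FinP._≟_ v i) then k else 0)) w ≡ pow (X i) k w
  monAct-single {suc n} X zero    k w = ≡.cong (pow (X zero) k)
    (≡.trans (≡.cong (λ u → monAct (X ∘ suc) u w) (tabulate-const n)) (monAct-zero (X ∘ suc) w))
    where
    tabulate-const : ∀ n → tabulate {n = n} (λ _ → 0) ≡ replicate n 0
    tabulate-const zero    = ≡.refl
    tabulate-const (suc n) = ≡.cong (0 ∷_) (tabulate-const n)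
  monAct-single {suc n} X (suc i) k w = monAct-single (X ∘ suc) i k w

-- Modules over the polynomial ring, and linear functionals on polynomials

module Linear {c ℓ} (K : Field c ℓ) (N : ℕ) where
  open Field K hiding (zero)
  open Poly K N

  -- A `K`-vector space with `N` commuting linear operators, that is, a module over the polynomial
  -- ring. The forms `θ` and the broken circuit monomials are evaluated in two such modules:
  -- functions of exponents for independence, the quotient ring for spanning.
  record OpModule m ℓm : Set (c ⊔ ℓ ⊔ lsuc (m ⊔ ℓm)) where
    infixr 8 _•_
    field
      group : AbelianGroup m ℓm
    module W = AbelianGroup group
    open Endomorphisms group
    field
      _•_         : Carrier → W.Carrier → W.Carrier
      •-cong      : ∀ {a b v w} → a ≈ b → v W.≈ w → a • v W.≈ b • w
      •-distribˡ  : ∀ a v w → a • (v W.∙ w) W.≈ a • v W.∙ a • w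
      •-distribʳ  : ∀ a b w → (a + b) • w W.≈ a • w W.∙ b • w
      •-assoc     : ∀ a b w → (a * b) • w W.≈ a • (b • w)
      •-identity  : ∀ w → 1# • w W.≈ w
      op          : Fin N → W.Carrier → W.Carrier
      op-endo     : ∀ v → IsEndo (op v)
      op-•        : ∀ v a w → op v (a • w) W.≈ a • op v w
      op-comm     : ∀ v v′ → Commute (op v) (op v′)

  module PolynomialAction {m ℓm} (M : OpModule m ℓm) where
    open OpModule M hiding (module W)
    private module W = AbelianGroup group
    open MonomialAction group public
    open AbelianGroupProperties group using (identityˡ-unique; inverseˡ-unique)

    •-endo : ∀ a → IsEndo (a •_)
    •-endo a = record { cong = •-cong refl ; homo = •-distribˡ a }

    0-• : ∀ w → 0# • w W.≈ W.ε
    0-• w = identityˡ-unique (0# • w) (0# • w)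
      (W.trans (W.sym (•-distribʳ 0# 0# w)) (•-cong (+-identityˡ 0#) W.refl))

    -1-• : ∀ w → (- 1#) • w W.≈ w W.⁻¹
    -1-• w = inverseˡ-unique ((- 1#) • w) w
      (W.trans (W.∙-congˡ (W.sym (•-identity w)))
        (W.trans (W.sym (•-distribʳ (- 1#) 1# w)) (W.trans (•-cong (-‿inverseˡ 1#) W.refl) (0-• w))))

    act : Mon → W.Carrier → W.Carrier
    act = monAct op

    act-endo : ∀ u → IsEndo (act u)
    act-endo = monAct-endo op-endo

    act-• : ∀ u a w → act u (a • w) W.≈ a • act u w
    act-• u a w = W.sym (monAct-comm {f = a •_} op-endo (λ v w → W.sym (op-• v a w)) u w)

    infixr 8 _▷_
    _▷_ : Pol → W.Carrier → W.Carrier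
    []            ▷ w = W.ε
    ((a , u) ∷ p) ▷ w = a • act u w W.∙ p ▷ w

    ▷-endo : ∀ p → IsEndo (p ▷_)
    ▷-endo []            = 0-endo
    ▷-endo ((a , u) ∷ p) = ⊞-endo
      (record { cong = λ e → •-cong refl (IsEndo.cong (act-endo u) e)
              ; homo = λ v w → W.trans (•-cong refl (IsEndo.homo (act-endo u) v w)) (•-distribˡ a _ _) })
      (▷-endo p)

    ▷-++ : ∀ p q w → (p List.++ q) ▷ w W.≈ p ▷ w W.∙ q ▷ w
    ▷-++ []      q w = W.sym (W.identityˡ _)
    ▷-++ (x ∷ p) q w = W.trans (W.∙-congˡ (▷-++ p q w)) (W.sym (W.assoc _ _ _))

    ▷-* : ∀ p q w → (p *P q) ▷ w W.≈ p ▷ (q ▷ w)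
    ▷-* []            q w = W.refl
    ▷-* ((a , u) ∷ p) q w = W.trans (▷-++ (map _ q) (p *P q) w) (W.∙-cong (term q) (▷-* p q w))
      where
      term : ∀ q → map (λ t → (a * proj₁ t , zipWith ℕ._+_ u (proj₂ t))) q ▷ w W.≈ a • act u (q ▷ w)
      term []            = W.sym (W.trans (•-cong refl (IsEndo.0-homo (act-endo u))) (IsEndo.0-homo (•-endo a)))
      term ((b , v) ∷ q) = begin
        (a * b) • act (zipWith ℕ._+_ u v) w W.∙ _
          ≈⟨ W.∙-cong (•-cong refl (monAct-zipWith op-endo op-comm u v w)) (term q) ⟩
        (a * b) • act u (act v w) W.∙ a • act u (q ▷ w)
          ≈⟨ W.∙-congʳ (W.trans (•-assoc a b _) (•-cong refl (W.sym (act-• u b _)))) ⟩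
        a • act u (b • act v w) W.∙ a • act u (q ▷ w)
          ≈⟨ •-distribˡ a _ _ ⟨
        a • (act u (b • act v w) W.∙ act u (q ▷ w))
          ≈⟨ •-cong refl (IsEndo.homo (act-endo u) _ _) ⟨
        a • act u (((b , v) ∷ q) ▷ w) ∎
        where open import Relation.Binary.Reasoning.Setoid W.setoid

    -- A product `h *P g` acts as `g` followed by `h`, so a vector annihilated by the generators is
    -- annihilated by all their combinations.
    ▷-ideal : ∀ {G : Pol → Set c} {w} → (∀ {g} → G g → g ▷ w W.≈ W.ε) →
              ∀ (hs : List (Pol × Pol)) → All (λ hg → G (proj₂ hg)) hs →
              sumP (map (λ hg → proj₁ hg *P proj₂ hg) hs) ▷ w W.≈ W.ε
    ▷-ideal kill []             []       = W.refl
    ▷-ideal {w = w} kill ((h , g) ∷ hs) (Gg ∷ Gs) = W.trans (▷-++ (h *P g) _ w)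
      (W.trans (W.∙-cong (W.trans (▷-* h g w) (W.trans (IsEndo.cong (▷-endo h) (kill Gg)) (IsEndo.0-homo (▷-endo h))))
                         (▷-ideal kill hs Gs))
               (W.identityˡ W.ε))

  open import Relation.Binary.Reasoning.Setoid setoid

  linear : (Mon → Carrier) → Pol → Carrier
  linear f []            = 0#
  linear f ((a , u) ∷ p) = a * f u + linear f p

  linear-++ : ∀ f p q → linear f (p List.++ q) ≈ linear f p + linear f q
  linear-++ f []      q = sym (+-identityˡ _)
  linear-++ f (x ∷ p) q = trans (+-congˡ (linear-++ f p q)) (sym (+-assoc _ _ _))

  coeff-++ : ∀ p q m → coeff (p List.++ q) m ≈ coeff p m + coeff q m
  coeff-++ []            q m = sym (+-identityˡ _)
  coeff-++ ((a , u) ∷ p) q m with VecP.≡-dec ℕ._≟_ u m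
  ... | yes _ = trans (+-congˡ (coeff-++ p q m)) (sym (+-assoc _ _ _))
  ... | no  _ = coeff-++ p q m

  open RingProperties ring using (-‿distribˡ-*; -0#≈0#; -‿+-comm)
  open CommutativeSemigroupProperties +-commutativeSemigroup using (x∙yz≈y∙xz)

  coeff-neg : ∀ p m → coeff (-P p) m ≈ - coeff p m
  coeff-neg []            m = sym -0#≈0#
  coeff-neg ((a , u) ∷ p) m with VecP.≡-dec ℕ._≟_ u m
  ... | yes _ = trans (+-congˡ (coeff-neg p m)) (-‿+-comm _ _)
  ... | no  _ = coeff-neg p m

  linear-neg : ∀ f p → linear f (-P p) ≈ - linear f p
  linear-neg f []            = sym -0#≈0#
  linear-neg f ((a , u) ∷ p) = trans (+-cong (sym (-‿distribˡ-* a (f u))) (linear-neg f p)) (-‿+-comm _ _)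

  private
    remove : Mon → Pol → Pol
    remove m []            = []
    remove m ((a , u) ∷ p) with VecP.≡-dec ℕ._≟_ u m
    ... | yes _ = remove m p
    ... | no  _ = (a , u) ∷ remove m p

    remove-length : ∀ m p → length (remove m p) ℕ.≤ length p
    remove-length m []            = ℕ.z≤n
    remove-length m ((a , u) ∷ p) with VecP.≡-dec ℕ._≟_ u m
    ... | yes _ = ℕP.m≤n⇒m≤1+n (remove-length m p)
    ... | no  _ = s≤s (remove-length m p)

    linear-remove : ∀ f m p → linear f p ≈ coeff p m * f m + linear f (remove m p)
    linear-remove f m []            = sym (trans (+-identityʳ _) (zeroˡ _))
    linear-remove f m ((a , u) ∷ p) with VecP.≡-dec ℕ._≟_ u m
    ... | yes ≡.refl = trans (+-congˡ (linear-remove f m p))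
                         (trans (sym (+-assoc _ _ _)) (+-congʳ (sym (distribʳ _ _ _))))
    ... | no  _ = trans (+-congˡ (linear-remove f m p)) (x∙yz≈y∙xz _ _ _)

    remove-zero : ∀ m p → p ≈P [] → remove m p ≈P []
    remove-zero m p z x with VecP.≡-dec ℕ._≟_ x m
    ... | yes ≡.refl = removed p
      where
      removed : ∀ p → coeff (remove m p) m ≈ 0#
      removed []            = refl
      removed ((a , u) ∷ p) with VecP.≡-dec ℕ._≟_ u m
      ... | yes _ = removed p
      ... | no u≢m with VecP.≡-dec ℕ._≟_ u m
      ...   | yes u≡m = contradiction u≡m u≢m
      ...   | no  _ = removed p
    ... | no x≢m = trans (kept p) (z x)
      where
      kept : ∀ p → coeff (remove m p) x ≈ coeff p x
      kept []            = refl
      kept ((a , u) ∷ p) with VecP.≡-dec ℕ._≟_ u m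
      kept ((a , u) ∷ p) | yes ≡.refl with VecP.≡-dec ℕ._≟_ u x
      ... | yes ≡.refl = contradiction ≡.refl x≢m
      ... | no  _ = kept p
      kept ((a , u) ∷ p) | no _ with VecP.≡-dec ℕ._≟_ u x
      ... | yes _ = +-congˡ (kept p)
      ... | no  _ = kept p

    -- A monomial may recur in the list, so a zero polynomial need not be empty. All terms sharing
    -- the first monomial are removed together: their coefficients add up to zero, and what is left
    -- is a shorter zero polynomial. The bound `n` carries the recursion.
    linear-zero : ∀ f n p → length p ℕ.≤ n → p ≈P [] → linear f p ≈ 0#
    linear-zero f n       []            l z = refl
    linear-zero f (suc n) ((a , u) ∷ p) (s≤s l) z = begin
      linear f ((a , u) ∷ p)
        ≈⟨ linear-remove f u ((a , u) ∷ p) ⟩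
      coeff ((a , u) ∷ p) u * f u + linear f (remove u ((a , u) ∷ p))
        ≈⟨ +-cong (trans (*-congʳ (z u)) (zeroˡ _))
             (linear-zero f n (remove u ((a , u) ∷ p)) shorter (remove-zero u ((a , u) ∷ p) z)) ⟩
      0# + 0#
        ≈⟨ +-identityˡ 0# ⟩
      0# ∎
      where
      shorter : length (remove u ((a , u) ∷ p)) ℕ.≤ n
      shorter with VecP.≡-dec ℕ._≟_ u u
      ... | yes _   = ℕP.≤-trans (remove-length u p) l
      ... | no  u≢u = contradiction ≡.refl u≢u

  linear-cong : ∀ f {p q} → p ≈P q → linear f p ≈ linear f q
  linear-cong f {p} {q} e = x∙y⁻¹≈ε⇒x≈y _ _ (trans (+-congˡ (sym (linear-neg f q)))
    (trans (sym (linear-++ f p (-P q))) (linear-zero f _ (p List.++ (-P q)) ℕP.≤-refl diff-zero)))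
    where
    open AbelianGroupProperties +-abelianGroup using (x∙y⁻¹≈ε⇒x≈y)
    diff-zero : (p List.++ (-P q)) ≈P []
    diff-zero m = trans (coeff-++ p (-P q) m)
      (trans (+-cong (e m) (coeff-neg q m)) (-‿inverseʳ _))

-- The sign matrix, the exponent bounds and the broken circuit monomials

pathSign : ∀ {s} → Fin s → Fin s → Sign
pathSign zero    i       = neg
pathSign (suc b) zero    = zer
pathSign (suc b) (suc i) = pathSign b i

diagSign : ∀ {r} → Fin r → Fin r → Sign
diagSign j j′ = if does (FinP._≟_ j′ j) then pos else zer

module Blocks (t r : ℕ) (blk : Fin r → Fin (suc t)) where
  s N : ℕ
  s = suc t
  N = s ℕ.+ r

  -- The row of an element b in block j gives θ_b = x_b - (x_j + … + x_t).
  splitSign : Fin s ⊎ Fin r → Fin s ⊎ Fin r → Sign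
  splitSign (inj₂ j) (inj₁ i)  = pathSign (blk j) i
  splitSign (inj₂ j) (inj₂ j′) = diagSign j j′
  splitSign (inj₁ _) _         = zer

  signs : Fin N → Fin N → Sign
  signs v w = splitSign (splitAt s v) (splitAt s w)

  inBlock : Fin s → Fin r → Bool
  inBlock i j = does (FinP._≟_ (blk j) i)

  -- L(M) is the set of monomials in the chords with exponent of x_i at most κ i.
  κ : Fin s → ℕ
  κ zero    = count (inBlock zero) ℕ.∸ 1
  κ (suc i) = count (inBlock (suc i))

  chordMon : Fin s → Vec ℕ s
  chordMon zero    = replicate s 0
  chordMon (suc i) = tabulate (λ v → if does (FinP._≟_ v (suc i)) then 1 else 0)

  -- The exponent vector of E_i minus its least element.
  brokenMon : Fin s → Vec ℕ N
  brokenMon i = chordMon i ++ indicator (inBlock i)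

  module Theta {c ℓ} (K : Field c ℓ) where
    open Field K hiding (zero)
    open Poly K N
    open Linear K N

    -- Opaque, since conversion checking would otherwise unfold the list at great cost.
    opaque
      θ-form : Fin N → Pol
      θ-form v = map (λ i → (⟦ signs v i ⟧ , unitMon i 1)) (allFin N)

      θ-form-≡ : ∀ v → θ-form v ≡ map (λ i → (⟦ signs v i ⟧ , unitMon i 1)) (allFin N)
      θ-form-≡ v = ≡.refl

    module _ {m ℓm} (M : OpModule m ℓm) where
      open OpModule M hiding (module W)
      private module W = AbelianGroup group
      open PolynomialAction M
      open AbelianGroupProperties group using (ε⁻¹≈ε; ⁻¹-∙-comm)
      open Sums W.commutativeMonoid

      X : Fin s → W.Carrier → W.Carrier
      X i = op (i ↑ˡ r)

      B : Fin r → W.Carrier → W.Carrier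
      B j = op (s ↑ʳ j)

      private
        ▷-tabulate : ∀ {n} (f : Fin n → Fin N) (a : Fin N → Carrier) w →
                     map (λ i → (a i , unitMon i 1)) (List.tabulate f) ▷ w
                       W.≈ sum (λ i → a (f i) • op (f i) w)
        ▷-tabulate {zero}  f a w = W.refl
        ▷-tabulate {suc n} f a w = W.∙-cong
          (•-cong refl (W.reflexive (monAct-single op (f zero) 1 w))) (▷-tabulate (f ∘ suc) a w)

        path-sum : ∀ {n} (Y : Fin n → W.Carrier → W.Carrier) b w →
                   sum (λ i → ⟦ pathSign b i ⟧ • Y i w) W.≈ tailFrom Y b w W.⁻¹
        path-sum {suc n} Y zero w = W.trans (W.∙-cong (-1-• _) (negated n (Y ∘ suc))) (⁻¹-∙-comm _ _)
          where
          negated : ∀ n (Z : Fin n → W.Carrier → W.Carrier) →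
                    sum (λ i → (- 1#) • Z i w) W.≈ tailSum Z w W.⁻¹
          negated zero    Z = W.sym ε⁻¹≈ε
          negated (suc n) Z = W.trans (W.∙-cong (-1-• _) (negated n (Z ∘ suc))) (⁻¹-∙-comm _ _)
        path-sum {suc n} Y (suc b) w = W.trans (W.∙-cong (0-• _) (path-sum (Y ∘ suc) b w)) (W.identityˡ _)

      -- The sum over all positions splits at `s`: the chords contribute minus a tail sum, and the
      -- diagonal leaves a single non-chord.
      θ-▷ : ∀ j w → θ-form (s ↑ʳ j) ▷ w W.≈ tailFrom X (blk j) w W.⁻¹ W.∙ B j w
      θ-▷ j w = begin
        θ-form (s ↑ʳ j) ▷ w
          ≡⟨ ≡.cong (_▷ w) (θ-form-≡ (s ↑ʳ j)) ⟩
        map (λ i → (⟦ signs (s ↑ʳ j) i ⟧ , unitMon i 1)) (allFin N) ▷ w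
          ≈⟨ ▷-tabulate (λ v → v) (λ v → ⟦ signs (s ↑ʳ j) v ⟧) w ⟩
        sum (λ v → ⟦ signs (s ↑ʳ j) v ⟧ • op v w)
          ≈⟨ sum-↑ s (λ v → ⟦ signs (s ↑ʳ j) v ⟧ • op v w) ⟩
        sum (λ i → ⟦ signs (s ↑ʳ j) (i ↑ˡ r) ⟧ • X i w) W.∙ sum (λ j′ → ⟦ signs (s ↑ʳ j) (s ↑ʳ j′) ⟧ • B j′ w)
          ≈⟨ W.∙-cong (sum-cong-≋ (λ i → •-cong (reflexive (≡.cong ⟦_⟧ (row-chord i))) (W.refl {X i w})))
                      (sum-cong-≋ (λ j′ → •-cong (reflexive (≡.cong ⟦_⟧ (row-basis j′))) (W.refl {B j′ w}))) ⟩
        sum (λ i → ⟦ pathSign (blk j) i ⟧ • X i w) W.∙ sum (λ j′ → ⟦ diagSign j j′ ⟧ • B j′ w)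
          ≈⟨ W.∙-cong (path-sum X (blk j) w) (sum-single j off-diagonal) ⟩
        tailFrom X (blk j) w W.⁻¹ W.∙ ⟦ diagSign j j ⟧ • B j w
          ≈⟨ W.∙-congˡ diagonal ⟩
        tailFrom X (blk j) w W.⁻¹ W.∙ B j w ∎
        where
        open import Relation.Binary.Reasoning.Setoid W.setoid
        row-chord : ∀ i → signs (s ↑ʳ j) (i ↑ˡ r) ≡ pathSign (blk j) i
        row-chord i rewrite FinP.splitAt-↑ʳ s r j | FinP.splitAt-↑ˡ s i r = ≡.refl
        row-basis : ∀ j′ → signs (s ↑ʳ j) (s ↑ʳ j′) ≡ diagSign j j′
        row-basis j′ rewrite FinP.splitAt-↑ʳ s r j | FinP.splitAt-↑ʳ s r j′ = ≡.refl
        off-diagonal : ∀ j′ → j′ ≢ j → ⟦ diagSign j j′ ⟧ • B j′ w W.≈ W.ε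
        off-diagonal j′ j′≢j rewrite dec-false (FinP._≟_ j′ j) j′≢j = 0-• _
        diagonal : ⟦ diagSign j j ⟧ • B j w W.≈ B j w
        diagonal rewrite dec-true (FinP._≟_ j j) ≡.refl = •-identity _

      module _ (Z : Fin s → W.Carrier → W.Carrier) (Z-endo : ∀ i → IsEndo (Z i)) (B≈Z : ∀ j w → B j w W.≈ Z (blk j) w) where

        private
          block : ∀ i w → monAct B (indicator (inBlock i)) w W.≈ pow (Z i) (count (inBlock i)) w
          block i = monAct-indicator (Z-endo i) (inBlock i) same
            where
            same : ∀ j → inBlock i j ≡ true → ∀ w → B j w W.≈ Z i w
            same j eq w with FinP._≟_ (blk j) i
            ... | yes ≡.refl = B≈Z j w
            same j () w | no _

        -- `Z i` stands for `y_i`: the shift of digit `i` in the function module, the tail sum in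
        -- the quotient. The broken circuit of `E_0` has no chord, so a pure power results; the
        -- later ones keep the factor `X (suc i)`.
        act-brokenMon-zero : ∀ w → act (brokenMon zero) w W.≈ pow (Z zero) (count (inBlock zero)) w
        act-brokenMon-zero w = W.trans
          (W.reflexive (≡.trans (monAct-++ op (replicate s 0) (indicator (inBlock zero)) w) (monAct-zero X _)))
          (block zero w)

        act-brokenMon-suc : ∀ i w → act (brokenMon (suc i)) w W.≈ X (suc i) (pow (Z (suc i)) (κ (suc i)) w)
        act-brokenMon-suc i w = W.trans
          (W.reflexive (≡.trans (monAct-++ op (chordMon (suc i)) (indicator (inBlock (suc i))) w) (monAct-single X (suc i) 1 _)))
          (IsEndo.cong (op-endo _) (block (suc i) w))

-- Linear independence

Box : ∀ {s} → (Fin s → ℕ) → Vec ℕ s → Set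
Box κ m = ∀ i → lookup m i ≤ κ i

_≺_ : ∀ {s} → Vec ℕ s → Vec ℕ s → Set
[]      ≺ []      = Empty.⊥
(a ∷ u) ≺ (b ∷ v) = a < b ⊎ (a ≡ b × u ≺ v)

≺-compare : ∀ {s} (u v : Vec ℕ s) → u ≺ v ⊎ u ≡ v ⊎ v ≺ u
≺-compare []      []      = inj₂ (inj₁ ≡.refl)
≺-compare (a ∷ u) (b ∷ v) with ℕP.<-cmp a b
... | tri< a<b _ _ = inj₁ (inj₁ a<b)
... | tri> _ _ b<a = inj₂ (inj₂ (inj₁ b<a))
... | tri≈ _ ≡.refl _ with ≺-compare u v
...   | inj₁ u≺v          = inj₁ (inj₂ (≡.refl , u≺v))
...   | inj₂ (inj₁ ≡.refl) = inj₂ (inj₁ ≡.refl)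
...   | inj₂ (inj₂ v≺u)   = inj₂ (inj₂ (inj₂ (≡.refl , v≺u)))

-- The box bounds ascending chains. The outer recursion is on the distance from the first digit to
-- its bound, the inner one on the remaining digits with the first digit fixed.
≺-descending-induction : ∀ {p s} (κ : Fin s → ℕ) (P : Vec ℕ s → Set p) →
  (∀ m → Box κ m → (∀ m′ → Box κ m′ → m ≺ m′ → P m′) → P m) → ∀ m → Box κ m → P m
≺-descending-induction {s = zero} κ P step [] b = step [] b λ { [] _ () }
≺-descending-induction {s = suc s} κ P step (a ∷ m) b = go (κ zero) a (ℕP.m≤n+m _ a) m b
  where
  -- `n` is fuel for raising the first digit: each larger `a′` costs at least one unit.
  go : ∀ n a → κ zero ≤ a ℕ.+ n → ∀ m → Box κ (a ∷ m) → P (a ∷ m)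
  go n a l m b = ≺-descending-induction (κ ∘ suc) (λ m → P (a ∷ m)) inner m (b ∘ suc)
    where
    cons : ∀ {m} → Box (κ ∘ suc) m → Box κ (a ∷ m)
    cons bm zero    = b zero
    cons bm (suc i) = bm i
    above : ∀ n → κ zero ≤ a ℕ.+ n → ∀ a′ m′ → Box κ (a′ ∷ m′) → a < a′ → P (a′ ∷ m′)
    above zero    l a′ m′ b′ a<a′ = contradiction (b′ zero)
      (ℕP.<⇒≱ (ℕP.≤-<-trans (≡.subst (κ zero ≤_) (ℕP.+-identityʳ a) l) a<a′))
    above (suc n) l a′ m′ b′ a<a′ = go n a′
      (ℕP.≤-trans l (≡.subst (_≤ a′ ℕ.+ n) (≡.sym (ℕP.+-suc a n)) (ℕP.+-monoˡ-≤ n a<a′))) m′ b′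
    inner : ∀ m → Box (κ ∘ suc) m → (∀ m′ → Box (κ ∘ suc) m′ → m ≺ m′ → P (a ∷ m′)) → P (a ∷ m)
    inner m bm rec = step (a ∷ m) (cons bm) λ where
      (a′ ∷ m′) b′ (inj₁ a<a′) → above n l a′ m′ b′ a<a′
      (a′ ∷ m′) b′ (inj₂ (≡.refl , m≺m′)) → rec m′ (b′ ∘ suc) m≺m′

-- Normal forms of monomials in the `y_i` by carrying

increment : ∀ {n} → Fin n → Vec ℕ n → Vec ℕ n
increment i u = updateAt u i suc

increment-comm : ∀ {n} (i j : Fin n) u → increment i (increment j u) ≡ increment j (increment i u)
increment-comm zero    zero    (a ∷ u) = ≡.refl
increment-comm zero    (suc j) (a ∷ u) = ≡.refl
increment-comm (suc i) zero    (a ∷ u) = ≡.refl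
increment-comm (suc i) (suc j) (a ∷ u) = ≡.cong (a ∷_) (increment-comm i j u)

pow-commute : ∀ {a} {A : Set a} (f g : A → A) → (∀ x → g (f x) ≡ f (g x)) →
              ∀ n x → g (pow f n x) ≡ pow f n (g x)
pow-commute f g c zero    x = ≡.refl
pow-commute f g c (suc n) x = ≡.trans (c _) (≡.cong f (pow-commute f g c n x))

pow-increment-zero : ∀ {n} k a (u : Vec ℕ n) → pow (increment zero) k (a ∷ u) ≡ (k ℕ.+ a) ∷ u
pow-increment-zero zero    a u = ≡.refl
pow-increment-zero (suc k) a u = ≡.cong (increment zero) (pow-increment-zero k a u)

pow-increment-suc : ∀ {n} (i : Fin n) k a u → pow (increment (suc i)) k (a ∷ u) ≡ a ∷ pow (increment i) k u
pow-increment-suc i zero    a u = ≡.refl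
pow-increment-suc i (suc k) a u = ≡.cong (increment (suc i)) (pow-increment-suc i k a u)

-- The normal form of the monomial y^u in the quotient ring, where y_i = x_i + … + x_{s-1} and
-- y_s = 0: the relation y_i^{κ i + 1} = y_{i+1} y_i^{κ i} moves the excess of digit i over κ i to
-- digit i + 1, unless carries i is false, in which case y_i^{κ i + 1} = 0.
carry : ∀ {s} → (Fin s → ℕ) → (Fin s → Bool) → Vec ℕ (suc s) → Maybe (Vec ℕ s)
carry {zero}  κ carries (zero ∷ []) = just []
carry {zero}  κ carries (suc _ ∷ []) = nothing
carry {suc s} κ carries (a ∷ u) with a ℕ.≤? κ zero
... | yes _ = Maybe.map (a ∷_) (carry (κ ∘ suc) (carries ∘ suc) u)
... | no  _ = if carries zero
    then Maybe.map (κ zero ∷_) (carry (κ ∘ suc) (carries ∘ suc) (pow (increment zero) (a ℕ.∸ κ zero) u))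
    else nothing

-- This is `y_s = 0`. Carries only increase later digits, so a positive last digit stays positive;
-- the pass ends in `nothing` there, or earlier at a digit that does not carry.
carry-last : ∀ {s} (κ : Fin s → ℕ) carries u → carry κ carries (increment (fromℕ s) u) ≡ nothing
carry-last {zero}  κ carries (a ∷ []) = ≡.refl
carry-last {suc s} κ carries (a ∷ u) with a ℕ.≤? κ zero
... | yes _ rewrite carry-last (κ ∘ suc) (carries ∘ suc) u = ≡.refl
... | no  _ with carries zero
...   | false = ≡.refl
...   | true  = ≡.cong (Maybe.map (κ zero ∷_)) (≡.trans
  (≡.cong (carry (κ ∘ suc) (carries ∘ suc))
    (≡.sym (pow-commute (increment zero) (increment (fromℕ s)) (increment-comm (fromℕ s) zero) (a ℕ.∸ κ zero) u)))
  (carry-last (κ ∘ suc) (carries ∘ suc) (pow (increment zero) (a ℕ.∸ κ zero) u)))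

private
  carry-overflow : ∀ {s} (κ : Fin (suc s) → ℕ) carries a u →
    carry κ carries (suc (κ zero ℕ.+ a) ∷ u) ≡
    (if carries zero then Maybe.map (κ zero ∷_) (carry (κ ∘ suc) (carries ∘ suc) (pow (increment zero) (suc a) u))
                     else nothing)
  carry-overflow κ carries a u with suc (κ zero ℕ.+ a) ℕ.≤? κ zero
  ... | yes l = contradiction l (ℕP.m+n≮m (κ zero) a)
  ... | no  _ rewrite ≡.sym (ℕP.+-suc (κ zero) a) | ℕP.m+n∸m≡n (κ zero) (suc a) = ≡.refl

  -- A digit exactly at its bound takes the branch without overflow, but carrying `0` gives the same
  -- result, so one formula serves for all excesses.
  carry-full : ∀ {s} (κ : Fin (suc s) → ℕ) carries → carries zero ≡ true → ∀ a u →
    carry κ carries (κ zero ℕ.+ a ∷ u) ≡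
    Maybe.map (κ zero ∷_) (carry (κ ∘ suc) (carries ∘ suc) (pow (increment zero) a u))
  carry-full κ carries on zero u rewrite ℕP.+-identityʳ (κ zero) with κ zero ℕ.≤? κ zero
  ... | yes _ = ≡.refl
  ... | no ¬l = contradiction ℕP.≤-refl ¬l
  carry-full κ carries on (suc a) u rewrite ℕP.+-suc (κ zero) a | carry-overflow κ carries a u | on = ≡.refl

carry-stop : ∀ {s} (κ : Fin (suc s) → ℕ) carries → carries zero ≡ false → ∀ u →
             carry κ carries (increment zero (pow (increment zero) (κ zero) u)) ≡ nothing
carry-stop κ carries off (a ∷ u)
  rewrite pow-increment-zero (κ zero) a u | carry-overflow κ carries a u | off = ≡.refl

-- In a multiple of `y_i^(κ_i)` digit `i` is already full, so one more `y_i` is carried on entirely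
-- and has the effect of `y_{i+1}`. Overflow of an earlier digit only adds to the next one and
-- commutes with every increment, which gives the induction.
carry-relation : ∀ {s} (κ : Fin s → ℕ) carries i → carries i ≡ true → ∀ u →
  carry κ carries (increment (inject₁ i) (pow (increment (inject₁ i)) (κ i) u)) ≡
  carry κ carries (increment (suc i) (pow (increment (inject₁ i)) (κ i) u))
carry-relation {suc s} κ carries zero on (a ∷ u)
  rewrite pow-increment-zero (κ zero) a u
        | carry-full κ carries on a (increment zero u)
        | carry-overflow κ carries a u
        | on
  = ≡.cong (λ v → Maybe.map (κ zero ∷_) (carry (κ ∘ suc) (carries ∘ suc) v))
      (pow-commute (increment zero) (increment zero) (λ _ → ≡.refl) a u)
carry-relation {suc s} κ carries (suc i) on (a ∷ u)
  rewrite pow-increment-suc (inject₁ i) (κ (suc i)) a u with a ℕ.≤? κ zero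
... | yes _ = ≡.cong (Maybe.map (a ∷_)) (carry-relation (κ ∘ suc) (carries ∘ suc) i on u)
... | no  _ with carries zero
...   | false = ≡.refl
...   | true  = ≡.cong (Maybe.map (κ zero ∷_)) (begin
    carry κ′ carries′ (pow (increment zero) e (increment (inject₁ i) v))
      ≡⟨ ≡.cong (carry κ′ carries′) (swap (inject₁ i)) ⟩
    carry κ′ carries′ (increment (inject₁ i) (pow (increment (inject₁ i)) (κ′ i) v′))
      ≡⟨ carry-relation κ′ carries′ i on v′ ⟩
    carry κ′ carries′ (increment (suc i) (pow (increment (inject₁ i)) (κ′ i) v′))
      ≡⟨ ≡.cong (carry κ′ carries′) (swap (suc i)) ⟨
    carry κ′ carries′ (pow (increment zero) e (increment (suc i) v)) ∎)
  where
  open ≡.≡-Reasoning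
  κ′ : Fin s → ℕ
  κ′ = κ ∘ suc
  carries′ : Fin s → Bool
  carries′ = carries ∘ suc
  e : ℕ
  e = a ℕ.∸ κ zero
  v v′ : Vec ℕ (suc s)
  v  = pow (increment (inject₁ i)) (κ′ i) u
  v′ = pow (increment zero) e u
  -- The carried excess `e` moves past the increments, so that the induction hypothesis applies to
  -- `v′`.
  swap : ∀ j → pow (increment zero) e (increment j v) ≡
               increment j (pow (increment (inject₁ i)) (κ′ i) v′)
  swap j = ≡.trans (≡.sym (pow-commute (increment zero) (increment j) (increment-comm j zero) e v))
    (≡.cong (increment j) (pow-commute (increment (inject₁ i)) (pow (increment zero) e)
      (λ x → ≡.sym (pow-commute (increment zero) (increment (inject₁ i)) (increment-comm (inject₁ i) zero) e x)) (κ′ i) u))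

-- The function module and its unitriangular functionals

module Independence (t r : ℕ) (blk : Fin r → Fin (suc t)) {c ℓ} (K : Field c ℓ) where
  open Field K hiding (zero)
  open Blocks t r blk
  open Poly K N
  open Linear K N
  open Theta K
  open AbelianGroupProperties +-abelianGroup using (⁻¹-∙-comm; x≈y⇒x∙y⁻¹≈ε)
  open RingProperties ring using (-‿distribʳ-*; -0#≈0#)

  functions : ∀ {a} (A : Set a) → AbelianGroup _ _
  functions A = Pointwise.abelianGroup A +-abelianGroup

  shift : ∀ {n} → Fin n → (Vec ℕ n → Carrier) → Vec ℕ n → Carrier
  shift i f u = f (increment i u)

  -- The action of `x_i = y_i - y_{i+1}`. There is one digit more than there are chords, to make
  -- room for `y_s`, which is not zero on arbitrary functions.
  difference : ∀ {n} → Fin n → (Vec ℕ (suc n) → Carrier) → Vec ℕ (suc n) → Carrier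
  difference i f u = shift (inject₁ i) f u + - shift (suc i) f u

  module Fun (n : ℕ) where
    open AbelianGroup (functions (Vec ℕ n)) public using () renaming (_≈_ to _≋_; Carrier to Func)
    open MonomialAction (functions (Vec ℕ n)) public

  module _ {n : ℕ} where
    open Fun n

    shift-endo : ∀ i → IsEndo (shift {n} i)
    shift-endo i = record { cong = λ e u → e (increment i u) ; homo = λ _ _ _ → refl }

    neg-endo : IsEndo (λ f u → - f u)
    neg-endo = record { cong = λ e u → -‿cong (e u) ; homo = λ _ _ _ → sym (⁻¹-∙-comm _ _) }

    ∘-endo : ∀ {f g} → IsEndo f → IsEndo g → IsEndo (λ w → f (g w))
    ∘-endo f g = record
      { cong = λ e → IsEndo.cong f (IsEndo.cong g e)
      ; homo = λ v w u → trans (IsEndo.cong f (IsEndo.homo g v w) u) (IsEndo.homo f _ _ u) }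

    shift-comm : ∀ i j → Commute (shift {n} i) (shift j)
    shift-comm i j f u = reflexive (≡.cong f (increment-comm j i u))

    pow-shift : ∀ (i : Fin n) k f u → pow (shift i) k f u ≡ f (pow (increment i) k u)
    pow-shift i zero    f u = ≡.refl
    pow-shift i (suc k) f u = ≡.trans (pow-shift i k f (increment i u))
      (≡.cong f (≡.sym (pow-commute (increment i) (increment i) (λ _ → ≡.refl) k u)))

  difference-endo : ∀ {n} i → Fun.IsEndo (suc n) (difference i)
  difference-endo i = Fun.⊞-endo _ (shift-endo (inject₁ i)) (∘-endo neg-endo (shift-endo (suc i)))

  operator : Fin s ⊎ Fin r → (Vec ℕ (suc s) → Carrier) → Vec ℕ (suc s) → Carrier
  operator (inj₁ i) = difference i
  operator (inj₂ j) = shift (inject₁ (blk j))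

  -- Functions of the exponents of y_0, …, y_s, on which y_i acts as the i-th shift.
  functionModule : OpModule _ _
  functionModule = record
    { group      = functions (Vec ℕ (suc s))
    ; _•_        = λ a f u → a * f u
    ; •-cong     = λ e e′ u → *-cong e (e′ u)
    ; •-distribˡ = λ a f g u → distribˡ a (f u) (g u)
    ; •-distribʳ = λ a b f u → distribʳ (f u) a b
    ; •-assoc    = λ a b f u → *-assoc a b (f u)
    ; •-identity = λ f u → *-identityˡ (f u)
    ; op         = λ v → operator (splitAt s v)
    ; op-endo    = λ v → endo (splitAt s v)
    ; op-•       = λ v → scale (splitAt s v)
    ; op-comm    = λ v v′ → commute (splitAt s v) (splitAt s v′)
    }
    where
    open Fun (suc s)
    endo : ∀ x → IsEndo (operator x)
    endo (inj₁ i) = difference-endo i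
    endo (inj₂ j) = shift-endo (inject₁ (blk j))
    scale : ∀ x a f → operator x (λ u → a * f u) ≋ (λ u → a * operator x f u)
    scale (inj₁ i) a f u = trans (+-congˡ (-‿distribʳ-* a _)) (sym (distribˡ a _ _))
    scale (inj₂ j) a f u = refl
    shift-difference : ∀ j i → Commute (shift j) (difference i)
    shift-difference j i f u = +-cong (shift-comm j (inject₁ i) f u) (-‿cong (shift-comm j (suc i) f u))
    commute : ∀ x y → Commute (operator x) (operator y)
    commute (inj₁ i) (inj₁ i′) f u = trans
      (+-cong (shift-difference (inject₁ i) i′ f u) (-‿cong (shift-difference (suc i) i′ f u)))
      (regroup _ _ _ _)
      where
      open CommutativeSemigroupProperties +-commutativeSemigroup using (interchange)
      regroup : ∀ a b c d → (a + - b) + - (c + - d) ≈ (a + - c) + - (b + - d)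
      regroup a b c d = trans (+-congˡ (sym (⁻¹-∙-comm c (- d))))
        (trans (interchange a (- b) (- c) (- - d)) (+-congˡ (⁻¹-∙-comm b (- d))))
    commute (inj₁ i) (inj₂ j) f u = sym (shift-difference (inject₁ (blk j)) i f u)
    commute (inj₂ j) (inj₁ i) f u = shift-difference (inject₁ (blk j)) i f u
    commute (inj₂ j) (inj₂ j′)    = shift-comm (inject₁ (blk j)) (inject₁ (blk j′))

  private
    module V = PolynomialAction functionModule
    open V using (act; _▷_; act-endo)
    open Fun (suc s)

    X′ : Fin s → Func → Func
    X′ = X functionModule

    B′ : Fin r → Func → Func
    B′ = B functionModule

  X≡difference : ∀ i → X′ i ≡ difference i
  X≡difference i = ≡.cong operator (FinP.splitAt-↑ˡ s i r)

  B≡shift : ∀ j → B′ j ≡ shift (inject₁ (blk j))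
  B≡shift j = ≡.cong operator (FinP.splitAt-↑ʳ s r j)

  δ : ∀ {n} → Maybe (Vec ℕ n) → Vec ℕ n → Carrier
  δ nothing  m = 0#
  δ (just u) m = if does (VecP.≡-dec ℕ._≟_ u m) then 1# else 0#

  -- Digit `0` stops because the relation of `E_0` is `y_0^(κ_0 + 1) = 0`, without the factor `x_0`
  -- that would produce a carry.
  carries : Fin s → Bool
  carries zero    = false
  carries (suc _) = true

  -- The coefficient of `y^m` in the normal form of `y^u`, as a function of `u`.
  functional : Vec ℕ s → Func
  functional m u = δ (carry κ carries u) m

  tailFrom-telescope : ∀ {n} {Y : Fin n → Func → Func} (T : Fin (suc n) → Func → Func) →
    (∀ i f u → Y i f u ≈ T (inject₁ i) f u + - T (suc i) f u) → ∀ b f u →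
    tailFrom Y b f u ≈ T (inject₁ b) f u + - T (fromℕ n) f u
  tailFrom-telescope {suc n} T Y≈ (suc b) f u = tailFrom-telescope (T ∘ suc) (Y≈ ∘ suc) b f u
  tailFrom-telescope {suc zero} T Y≈ zero f u = trans (+-identityʳ _) (Y≈ zero f u)
  tailFrom-telescope {suc (suc n)} {Y} T Y≈ zero f u = trans
    (+-cong (Y≈ zero f u) (tailFrom-telescope (T ∘ suc) (Y≈ ∘ suc) zero f u))
    (trans (+-assoc _ _ _) (+-congˡ (trans (sym (+-assoc _ _ _)) (trans (+-congʳ (-‿inverseˡ _)) (+-identityˡ _)))))

  functional-last : ∀ m u → shift (fromℕ s) (functional m) u ≈ 0#
  functional-last m u = reflexive (≡.cong (λ x → δ x m) (carry-last κ carries u))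

  Kills : Pol → Set ℓ
  Kills g = ∀ m → g ▷ functional m ≋ (λ _ → 0#)

  -- The tail sum telescopes, and `θ` is left acting as the shift of the last digit. This vanishes
  -- on the functionals, though not on all functions, because `carry` rejects a positive last digit.
  θ-kills : ∀ j → Kills (θ-form (s ↑ʳ j))
  θ-kills j m u = begin
    (θ-form (s ↑ʳ j) ▷ functional m) u
      ≈⟨ θ-▷ functionModule j (functional m) u ⟩
    - tailFrom X′ (blk j) (functional m) u + B′ j (functional m) u
      ≈⟨ +-cong (-‿cong (tailFrom-telescope shift
           (λ i f u → reflexive (≡.cong (λ g → g f u) (X≡difference i))) (blk j) (functional m) u))
           (reflexive (≡.cong (λ g → g (functional m) u) (B≡shift j))) ⟩
    - (y + - shift (fromℕ s) (functional m) u) + y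
      ≈⟨ +-congʳ (-‿cong (trans (+-congˡ (trans (-‿cong (functional-last m u)) -0#≈0#)) (+-identityʳ y))) ⟩
    - y + y
      ≈⟨ -‿inverseˡ y ⟩
    0# ∎
    where
    open import Relation.Binary.Reasoning.Setoid setoid
    y : Carrier
    y = shift (inject₁ (blk j)) (functional m) u

  module _ (block₀ : 1 ≤ count (inBlock zero)) where

    -- For `E_0` this is `carry-stop`. For a later polygon the factor `x_i` is a difference of two
    -- shifts, whose values agree by `carry-relation`.
    brokenMon-kills : ∀ m i → act (brokenMon i) (functional m) ≋ (λ _ → 0#)
    brokenMon-kills m zero u = begin
      act (brokenMon zero) (functional m) u
        ≈⟨ act-brokenMon-zero functionModule (shift ∘ inject₁) (shift-endo ∘ inject₁) B≈shift (functional m) u ⟩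
      pow (shift zero) (count (inBlock zero)) (functional m) u
        ≡⟨ ≡.cong (λ k → pow (shift zero) k (functional m) u) (ℕP.m+[n∸m]≡n block₀) ⟨
      pow (shift zero) (suc (κ zero)) (functional m) u
        ≡⟨ pow-shift zero (suc (κ zero)) (functional m) u ⟩
      functional m (pow (increment zero) (suc (κ zero)) u)
        ≡⟨ ≡.cong (λ x → δ x m) (carry-stop κ carries ≡.refl u) ⟩
      0# ∎
      where
      open import Relation.Binary.Reasoning.Setoid setoid
      B≈shift : ∀ j w → B′ j w ≋ shift (inject₁ (blk j)) w
      B≈shift j w u = reflexive (≡.cong (λ g → g w u) (B≡shift j))
    brokenMon-kills m (suc i) u = begin
      act (brokenMon (suc i)) (functional m) u
        ≈⟨ act-brokenMon-suc functionModule (shift ∘ inject₁) (shift-endo ∘ inject₁) B≈shift i (functional m) u ⟩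
      X′ (suc i) f u
        ≡⟨ ≡.cong (λ g → g f u) (X≡difference (suc i)) ⟩
      f (increment (inject₁ (suc i)) u) + - f (increment (suc (suc i)) u)
        ≈⟨ x≈y⇒x∙y⁻¹≈ε equal ⟩
      0# ∎
      where
      open import Relation.Binary.Reasoning.Setoid setoid
      y : Fin (suc s)
      y = inject₁ (suc i)
      f : Func
      f = pow (shift y) (κ (suc i)) (functional m)
      B≈shift : ∀ j w → B′ j w ≋ shift (inject₁ (blk j)) w
      B≈shift j w u = reflexive (≡.cong (λ g → g w u) (B≡shift j))
      move : ∀ j → f (increment j u) ≡ functional m (increment j (pow (increment y) (κ (suc i)) u))
      move j = ≡.trans (pow-shift y (κ (suc i)) (functional m) (increment j u))
        (≡.cong (functional m) (≡.sym (pow-commute (increment y) (increment j) (increment-comm j y) (κ (suc i)) u)))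
      equal : f (increment y u) ≈ f (increment (suc (suc i)) u)
      equal = reflexive (≡.trans (move y) (≡.trans
        (≡.cong (λ x → δ x m) (carry-relation κ carries (suc i) ≡.refl u)) (≡.sym (move (suc (suc i))))))

    -- The ideal has a generator for every nonface, not only for the minimal ones, so arbitrary
    -- multiples of the broken circuit monomials are treated.
    multiple-kills : ∀ w i → Kills ((1# , zipWith ℕ._+_ w (brokenMon i)) ∷ [])
    multiple-kills w i m u = begin
      1# * act (zipWith ℕ._+_ w (brokenMon i)) (functional m) u + 0#
        ≈⟨ trans (+-identityʳ _) (*-identityˡ _) ⟩
      act (zipWith ℕ._+_ w (brokenMon i)) (functional m) u
        ≈⟨ monAct-zipWith (OpModule.op-endo functionModule) (OpModule.op-comm functionModule) w (brokenMon i) (functional m) u ⟩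
      act w (act (brokenMon i) (functional m)) u
        ≈⟨ IsEndo.cong (act-endo w) {w = λ _ → 0#} (brokenMon-kills m i) u ⟩
      act w (λ _ → 0#) u
        ≈⟨ V.IsEndo.0-homo (act-endo w) u ⟩
      0# ∎
      where open import Relation.Binary.Reasoning.Setoid setoid

  slice-pow : ∀ {n} (i : Fin n) k f j →
    (λ w → pow (difference (suc i)) k f (j ∷ w)) ≡ pow (difference i) k (λ w → f (j ∷ w))
  slice-pow i zero    f j = ≡.refl
  slice-pow i (suc k) f j = ≡.cong (difference i) (slice-pow i k f j)

  -- The operators of later chords never touch digit `0`, so fixing that digit commutes with them.
  -- The map `p` keeps the recursion on `u` general.
  slice-monAct : ∀ {l n} (p : Fin l → Fin n) u f j →
    (λ w → monAct (difference ∘ suc ∘ p) u f (j ∷ w)) ≡ monAct (difference ∘ p) u (λ w → f (j ∷ w))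
  slice-monAct p []      f j = ≡.refl
  slice-monAct p (a ∷ u) f j = ≡.trans (slice-pow (p zero) a (monAct (difference ∘ suc ∘ p ∘ suc) u f) j)
    (≡.cong (pow (difference (p zero)) a) (slice-monAct (p ∘ suc) u f j))

  module _ {n : ℕ} (f : Vec ℕ (suc (suc n)) → Carrier) (b : ℕ) (below : ∀ j → j < b → ∀ w → f (j ∷ w) ≈ 0#) where

    -- Each factor `y_0 - y_1` raises digit `0` by at most one, so `a` factors leave it below `b`.
    pow-difference-below : ∀ a j → a ℕ.+ j < b → ∀ w → pow (difference zero) a f (j ∷ w) ≈ 0#
    pow-difference-below zero    j l w = below j l w
    pow-difference-below (suc a) j l w = x≈y⇒x∙y⁻¹≈ε (trans
      (pow-difference-below a (suc j) (≡.subst (_< b) (≡.sym (ℕP.+-suc a j)) l) w)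
      (sym (pow-difference-below a j (ℕP.<⇒≤ l) (increment zero w))))

    -- In the expansion of `(y_0 - y_1)^a` only the term `y_0^a` brings digit `0` up to `b`.
    pow-difference-leading : ∀ a j → a ℕ.+ j ≡ b → ∀ w → pow (difference zero) a f (j ∷ w) ≈ f (b ∷ w)
    pow-difference-leading zero    j ≡.refl w = refl
    pow-difference-leading (suc a) j e w = trans
      (+-cong (pow-difference-leading a (suc j) (≡.trans (ℕP.+-suc a j) e) w)
        (-‿cong (pow-difference-below a j (ℕP.≤-reflexive e) (increment zero w))))
      (trans (+-congˡ -0#≈0#) (+-identityʳ _))

  δ-just-≡ : ∀ {n} {u m : Vec ℕ n} → u ≡ m → δ (just u) m ≡ 1#
  δ-just-≡ {u = u} {m} e = ≡.cong (if_then 1# else 0#) (dec-true (VecP.≡-dec ℕ._≟_ u m) e)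

  δ-just-≢ : ∀ {n} {u m : Vec ℕ n} → u ≢ m → δ (just u) m ≡ 0#
  δ-just-≢ {u = u} {m} e = ≡.cong (if_then 1# else 0#) (dec-false (VecP.≡-dec ℕ._≟_ u m) e)

  δ-cons-≡ : ∀ {n} a (x : Maybe (Vec ℕ n)) m → δ (Maybe.map (a ∷_) x) (a ∷ m) ≡ δ x m
  δ-cons-≡ a nothing  m = ≡.refl
  δ-cons-≡ a (just u) m = cases (VecP.≡-dec ℕ._≟_ u m)
    where
    cases : Dec (u ≡ m) → δ (just (a ∷ u)) (a ∷ m) ≡ δ (just u) m
    cases (yes e) = ≡.trans (δ-just-≡ {u = a ∷ u} {a ∷ m} (≡.cong (a ∷_) e)) (≡.sym (δ-just-≡ e))
    cases (no ¬e) = ≡.trans (δ-just-≢ {u = a ∷ u} {a ∷ m} (¬e ∘ VecP.∷-injectiveʳ)) (≡.sym (δ-just-≢ ¬e))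

  δ-cons-≢ : ∀ {n} {a b} (x : Maybe (Vec ℕ n)) m → a ≢ b → δ (Maybe.map (a ∷_) x) (b ∷ m) ≡ 0#
  δ-cons-≢ nothing  m a≢b = ≡.refl
  δ-cons-≢ {a = a} {b} (just u) m a≢b = δ-just-≢ {u = a ∷ u} {b ∷ m} (a≢b ∘ VecP.∷-injectiveˡ)

  -- The coefficient of y^m in the normal form of x^u, where x_i = y_i - y_{i+1}.
  transition : ∀ {n} → (Fin n → ℕ) → (Fin n → Bool) → Vec ℕ n → Vec ℕ n → Carrier
  transition {n} κ cs u m = monAct difference u (λ w → δ (carry κ cs w) m) (replicate (suc n) 0)

  module _ {n : ℕ} (κ : Fin (suc n) → ℕ) (cs : Fin (suc n) → Bool) (a b : ℕ) (u m : Vec ℕ n) (b≤κ : b ≤ κ zero) where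

    private
      f : Vec ℕ (suc (suc n)) → Carrier
      f w = δ (carry κ cs w) (b ∷ m)

      h : Vec ℕ (suc (suc n)) → Carrier
      h = monAct (difference ∘ suc) u f

      f-slice : ∀ j → j ≤ κ zero → ∀ w → f (j ∷ w) ≡ δ (Maybe.map (j ∷_) (carry (κ ∘ suc) (cs ∘ suc) w)) (b ∷ m)
      f-slice j j≤κ w with j ℕ.≤? κ zero
      ... | yes _  = ≡.refl
      ... | no j≰κ = contradiction j≤κ j≰κ

      u-endo : Fun.IsEndo (suc n) (monAct difference u)
      u-endo = Fun.monAct-endo (suc n) difference-endo u

      -- Below `b`, hence within its bound, digit `0` does not overflow and survives in the normal
      -- form, where it fails to match the digit `b` of the target.
      h-below : ∀ j → j < b → ∀ w → h (j ∷ w) ≈ 0#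
      h-below j j<b w = trans (reflexive (≡.cong (λ g → g w) (slice-monAct (λ i → i) u f j)))
        (trans (Fun.IsEndo.cong u-endo {w = λ _ → 0#} (λ w → trans
            (reflexive (f-slice j (ℕP.≤-trans (ℕP.<⇒≤ j<b) b≤κ) w))
            (reflexive (δ-cons-≢ (carry (κ ∘ suc) (cs ∘ suc) w) m (ℕP.<⇒≢ j<b)))) w)
          (Fun.IsEndo.0-homo (suc n) u-endo w))

      h-leading : h (b ∷ replicate (suc n) 0) ≈ transition (κ ∘ suc) (cs ∘ suc) u m
      h-leading = trans (reflexive (≡.cong (λ g → g (replicate (suc n) 0)) (slice-monAct (λ i → i) u f b)))
        (Fun.IsEndo.cong u-endo (λ w → trans (reflexive (f-slice b b≤κ w))
          (reflexive (δ-cons-≡ b (carry (κ ∘ suc) (cs ∘ suc) w) m))) (replicate (suc n) 0))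

    transition-cons-< : a < b → transition κ cs (a ∷ u) (b ∷ m) ≈ 0#
    transition-cons-< a<b = pow-difference-below h b h-below a 0
      (≡.subst (_< b) (≡.sym (ℕP.+-identityʳ a)) a<b) (replicate (suc n) 0)

    transition-cons-≡ : a ≡ b → transition κ cs (a ∷ u) (b ∷ m) ≈ transition (κ ∘ suc) (cs ∘ suc) u m
    transition-cons-≡ a≡b = trans (pow-difference-leading h b h-below a 0
      (≡.trans (ℕP.+-identityʳ a) a≡b) (replicate (suc n) 0)) h-leading

  -- Expanding `x_i = y_i - y_{i+1}` and carrying both move exponents to later digits only, so a
  -- first digit of `m` above that of `u` is never reached. Equal first digits reduce to the
  -- remaining ones.
  transition-≺ : ∀ {n} (κ : Fin n → ℕ) cs u m → Box κ m → u ≺ m → transition κ cs u m ≈ 0#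
  transition-≺ κ cs []      []      bm ()
  transition-≺ κ cs (a ∷ u) (b ∷ m) bm (inj₁ a<b) = transition-cons-< κ cs a b u m (bm zero) a<b
  transition-≺ κ cs (a ∷ u) (b ∷ m) bm (inj₂ (a≡b , u≺m)) = trans
    (transition-cons-≡ κ cs a b u m (bm zero) a≡b) (transition-≺ (κ ∘ suc) (cs ∘ suc) u m (bm ∘ suc) u≺m)

  transition-diagonal : ∀ {n} (κ : Fin n → ℕ) cs m → Box κ m → transition κ cs m m ≈ 1#
  transition-diagonal κ cs []      bm = refl
  transition-diagonal κ cs (a ∷ m) bm = trans
    (transition-cons-≡ κ cs a a m m (bm zero) ≡.refl) (transition-diagonal (κ ∘ suc) (cs ∘ suc) m (bm ∘ suc))

  -- Evaluation at exponent zero applies the functional to `x^u` times `1`; the padding means that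
  -- no non-chord acts.
  act-transition : ∀ u m → act (u ++ replicate r 0) (functional m) (replicate (suc s) 0) ≈ transition κ carries u m
  act-transition u m = trans (reflexive (≡.cong (λ g → g (replicate (suc s) 0))
      (≡.trans (monAct-++ (OpModule.op functionModule) u (replicate r 0) (functional m))
               (≡.cong (monAct X′ u) (monAct-zero B′ (functional m))))))
    (monAct-cong-ops (λ i → OpModule.op-endo functionModule (i ↑ˡ r))
      (λ i f w → reflexive (≡.cong (λ g → g f w) (X≡difference i))) u (functional m) (replicate (suc s) 0))

  BoxMon : Mon → Set
  BoxMon m = ∃ λ u → m ≡ u ++ replicate r 0 × Box κ u

  coeff-unique : ∀ q → Unique (map proj₂ q) → All (λ t → coeff q (proj₂ t) ≈ proj₁ t) q
  coeff-unique []            [] = []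
  coeff-unique ((a , u) ∷ q) (u∉q ∷ uq) = head ∷ tail q (coeff-unique q uq) u∉q
    where
    absent : ∀ q → All (u ≢_) (map proj₂ q) → coeff q u ≈ 0#
    absent []            [] = refl
    absent ((b , v) ∷ q) (u≢v ∷ n) with VecP.≡-dec ℕ._≟_ v u
    ... | yes v≡u = contradiction (≡.sym v≡u) u≢v
    ... | no  _   = absent q n
    head : coeff ((a , u) ∷ q) u ≈ a
    head with VecP.≡-dec ℕ._≟_ u u
    ... | yes _  = trans (+-congˡ (absent q u∉q)) (+-identityʳ a)
    ... | no u≢u = contradiction ≡.refl u≢u
    tail : ∀ q′ → All (λ t → coeff q (proj₂ t) ≈ proj₁ t) q′ → All (u ≢_) (map proj₂ q′) →
           All (λ t → coeff ((a , u) ∷ q) (proj₂ t) ≈ proj₁ t) q′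
    tail []             []       []        = []
    tail ((b , v) ∷ q′) (e ∷ es) (u≢v ∷ n) = unchanged ∷ tail q′ es n
      where
      unchanged : coeff ((a , u) ∷ q) v ≈ b
      unchanged with VecP.≡-dec ℕ._≟_ u v
      ... | yes u≡v = contradiction u≡v u≢v
      ... | no  _   = e

  -- The second condition is on the product because a term can drop out in two ways: `f` vanishes at
  -- its monomial, or its coefficient is zero.
  linear-pick : ∀ f m q → All (λ t → (proj₂ t ≡ m → f (proj₂ t) ≈ 1#) × (proj₂ t ≢ m → proj₁ t * f (proj₂ t) ≈ 0#)) q →
                linear f q ≈ coeff q m
  linear-pick f m []            [] = refl
  linear-pick f m ((a , u) ∷ q) ((one , zeros) ∷ as) with VecP.≡-dec ℕ._≟_ u m
  ... | yes e = +-cong (trans (*-congˡ (one e)) (*-identityʳ a)) (linear-pick f m q as)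
  ... | no ¬e = trans (+-cong (zeros ¬e) (linear-pick f m q as)) (+-identityˡ _)

  evaluate : ∀ p m → (p ▷ functional m) (replicate (suc s) 0) ≡
                     linear (λ u → act u (functional m) (replicate (suc s) 0)) p
  evaluate []            m = ≡.refl
  evaluate ((a , u) ∷ p) m = ≡.cong (a * act u (functional m) (replicate (suc s) 0) +_) (evaluate p m)

  independent : {G : Pol → Set c} → (∀ {g} → G g → Kills g) →
    ∀ q → All (BoxMon ∘ proj₂) q → Unique (map proj₂ q) → InIdeal G q → All (λ t → proj₁ t ≈ 0#) q
  independent kills q boxed unique (hs , hs∈G , q≈) = All.zipWith finish (boxed , coeff-unique q unique)
    where
    o : Vec ℕ (suc s)
    o = replicate (suc s) 0
    ideal : Pol
    ideal = sumP (map (λ hg → proj₁ hg *P proj₂ hg) hs)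
    vanish : ∀ m → linear (λ u → act u (functional m) o) q ≈ 0#
    vanish m = trans (linear-cong _ {q} {ideal} q≈) (trans (reflexive (≡.sym (evaluate ideal m)))
      (V.▷-ideal (λ Gg → kills Gg m) hs hs∈G o))
    coeff-zero : ∀ m → Box κ m → coeff q (m ++ replicate r 0) ≈ 0#
    coeff-zero = ≺-descending-induction κ _ step
      where
      step : ∀ m → Box κ m → (∀ m′ → Box κ m′ → m ≺ m′ → coeff q (m′ ++ replicate r 0) ≈ 0#) →
             coeff q (m ++ replicate r 0) ≈ 0#
      step m bm rec = trans
        (sym (linear-pick _ (m ++ replicate r 0) q (All.zipWith term (boxed , coeff-unique q unique)))) (vanish m)
        where
        term : ∀ {t} → BoxMon (proj₂ t) × coeff q (proj₂ t) ≈ proj₁ t →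
               (proj₂ t ≡ m ++ replicate r 0 → act (proj₂ t) (functional m) o ≈ 1#) ×
               (proj₂ t ≢ m ++ replicate r 0 → proj₁ t * act (proj₂ t) (functional m) o ≈ 0#)
        term ((u , ≡.refl , bu) , e) =
            (λ u≡m → trans (act-transition u m) (trans
              (reflexive (≡.cong (λ v → transition κ carries v m) (VecP.++-injectiveˡ u m u≡m)))
              (transition-diagonal κ carries m bm)))
          , λ u≢m → other u≢m (≺-compare u m)
          where
          other : u ++ replicate r 0 ≢ m ++ replicate r 0 → u ≺ m ⊎ u ≡ m ⊎ m ≺ u → _
          -- For `u` below `m` the functional vanishes; for `u` above `m` the coefficient is zero by
          -- the descending induction.
          other u≢m (inj₁ u≺m) = trans (*-congˡ (trans (act-transition u m) (transition-≺ κ carries u m bm u≺m))) (zeroʳ _)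
          other u≢m (inj₂ (inj₁ ≡.refl)) = contradiction ≡.refl u≢m
          other u≢m (inj₂ (inj₂ m≺u)) = trans (*-congʳ (trans (sym e) (rec u bu m≺u))) (zeroˡ _)
    finish : ∀ {t} → BoxMon (proj₂ t) × coeff q (proj₂ t) ≈ proj₁ t → proj₁ t ≈ 0#
    finish ((u , ≡.refl , bu) , e) = trans (sym e) (coeff-zero u bu)

-- Spanning

unit : ∀ {n} → Fin n → Vec ℕ n
unit i = tabulate (λ v → if does (FinP._≟_ v i) then 1 else 0)

-- For `act-scale`: repeated multiplication by single variables amounts to multiplication by the
-- whole monomial.
monAct-unit : ∀ {n} (u : Vec ℕ n) → monAct (λ i → zipWith ℕ._+_ (unit i)) u (replicate n 0) ≡ u
monAct-unit []      = ≡.refl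
monAct-unit {suc n} (a ∷ u) = ≡.trans
  (≡.cong (pow (zipWith ℕ._+_ (unit zero)) a)
    (≡.trans (drop u unit (replicate n 0)) (≡.cong (0 ∷_) (monAct-unit u))))
  (≡.trans (raise a 0 u) (≡.cong (_∷ u) (ℕP.+-identityʳ a)))
  where
  drop-pow : ∀ {n} k (v : Vec ℕ n) w → pow (zipWith ℕ._+_ (0 ∷ v)) k (0 ∷ w) ≡ 0 ∷ pow (zipWith ℕ._+_ v) k w
  drop-pow zero    v w = ≡.refl
  drop-pow (suc k) v w = ≡.cong (zipWith ℕ._+_ (0 ∷ v)) (drop-pow k v w)
  drop : ∀ {n l} (u : Vec ℕ l) (V : Fin l → Vec ℕ n) w →
         monAct (λ i → zipWith ℕ._+_ (0 ∷ V i)) u (0 ∷ w) ≡ 0 ∷ monAct (λ i → zipWith ℕ._+_ (V i)) u w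
  drop []      V w = ≡.refl
  drop (a ∷ u) V w = ≡.trans (≡.cong (pow _ a) (drop u (V ∘ suc) w)) (drop-pow a (V zero) _)
  tabulate-zero : ∀ n (w : Vec ℕ n) → zipWith ℕ._+_ (tabulate (λ _ → 0)) w ≡ w
  tabulate-zero zero    []      = ≡.refl
  tabulate-zero (suc n) (b ∷ w) = ≡.cong (b ∷_) (tabulate-zero n w)
  raise : ∀ {n} k b (w : Vec ℕ n) → pow (zipWith ℕ._+_ (unit zero)) k (b ∷ w) ≡ k ℕ.+ b ∷ w
  raise zero    b w = ≡.refl
  raise (suc k) b w = ≡.trans (≡.cong (zipWith ℕ._+_ (unit zero)) (raise k b w))
    (≡.cong (suc (k ℕ.+ b) ∷_) (tabulate-zero _ w))

-- The quotient ring as a module over the polynomial ring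

module PolynomialQuotient {c ℓ} (K : Field c ℓ) (N : ℕ) (G : Poly.Pol K N → Set c) where
  open Field K hiding (zero)
  open Poly K N
  open Linear K N
  open AbelianGroupProperties +-abelianGroup using (⁻¹-∙-comm; x≈y⇒x∙y⁻¹≈ε)
  open RingProperties ring using (-‿distribʳ-*; -1*x≈-x; -‿involutive)
  open CommutativeSemigroupProperties +-commutativeSemigroup using (interchange)
  open CommutativeSemigroupProperties *-commutativeSemigroup using () renaming (x∙yz≈y∙xz to x*yz≈y*xz)
  open import Relation.Binary.Reasoning.Setoid setoid

  infix 4 _≈ᴸ_

  -- Equality under every linear functional, which agrees with equality of coefficients by
  -- `linear-cong` and `≈ᴸ⇒≈P`. Identities between lists of terms become identities in `K`, with no
  -- comparison of monomials.
  _≈ᴸ_ : Pol → Pol → Set (c ⊔ ℓ)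
  p ≈ᴸ q = ∀ f → linear f p ≈ linear f q

  ≈ᴸ⇒≈P : ∀ {p q} → p ≈ᴸ q → p ≈P q
  ≈ᴸ⇒≈P {p} {q} e m = trans (coeff-linear p) (trans (e at-m) (sym (coeff-linear q)))
    where
    at-m : Mon → Carrier
    at-m u with VecP.≡-dec ℕ._≟_ u m
    ... | yes _ = 1#
    ... | no  _ = 0#
    coeff-linear : ∀ p → coeff p m ≈ linear at-m p
    coeff-linear []            = refl
    coeff-linear ((a , u) ∷ p) with VecP.≡-dec ℕ._≟_ u m
    ... | yes _ = +-cong (sym (*-identityʳ a)) (coeff-linear p)
    ... | no  _ = trans (coeff-linear p) (sym (trans (+-congʳ (zeroʳ a)) (+-identityˡ _)))

  linear-ext : ∀ {f g} → (∀ u → f u ≈ g u) → ∀ p → linear f p ≈ linear g p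
  linear-ext e []            = refl
  linear-ext e ((a , u) ∷ p) = +-cong (*-congˡ (e u)) (linear-ext e p)

  linear-pointwise-+ : ∀ f g p → linear (λ u → f u + g u) p ≈ linear f p + linear g p
  linear-pointwise-+ f g []            = sym (+-identityˡ 0#)
  linear-pointwise-+ f g ((a , u) ∷ p) = trans (+-cong (distribˡ a _ _) (linear-pointwise-+ f g p)) (interchange _ _ _ _)

  linear-pointwise-* : ∀ b f p → linear (λ u → b * f u) p ≈ b * linear f p
  linear-pointwise-* b f []            = sym (zeroʳ b)
  linear-pointwise-* b f ((a , u) ∷ p) = trans
    (+-cong (x*yz≈y*xz a b (f u)) (linear-pointwise-* b f p)) (sym (distribˡ b _ _))

  linear-swap : ∀ (f : Mon → Mon → Carrier) p q →
    linear (λ u → linear (f u) q) p ≈ linear (λ v → linear (λ u → f u v) p) q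
  linear-swap f []            q = sym (trans (linear-ext (λ v → sym (zeroˡ 0#)) q) (trans (linear-pointwise-* 0# (λ _ → 0#) q) (zeroˡ _)))
  linear-swap f ((a , u) ∷ p) q = trans
    (+-cong (sym (linear-pointwise-* a (f u) q)) (linear-swap f p q)) (sym (linear-pointwise-+ _ _ q))

  scale : Carrier → Mon → Pol → Pol
  scale c u = map (λ t → (c * proj₁ t , zipWith ℕ._+_ u (proj₂ t)))

  linear-scale : ∀ f c u p → linear f (scale c u p) ≈ c * linear (λ v → f (zipWith ℕ._+_ u v)) p
  linear-scale f c u []            = sym (zeroʳ c)
  linear-scale f c u ((a , v) ∷ p) = trans
    (+-cong (*-assoc c a _) (linear-scale f c u p)) (sym (distribˡ c _ _))

  linear-* : ∀ f p q → linear f (p *P q) ≈ linear (λ u → linear (λ v → f (zipWith ℕ._+_ u v)) q) p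
  linear-* f []            q = refl
  linear-* f ((a , u) ∷ p) q = trans (linear-++ f (scale a u q) (p *P q))
    (+-cong (linear-scale f a u q) (linear-* f p q))

  linear-diff : ∀ f p q → linear f (p List.++ (-P q)) ≈ linear f p + - linear f q
  linear-diff f p q = trans (linear-++ f p (-P q)) (+-congˡ (linear-neg f q))

  +-assocᴹ : ∀ {n} (u v w : Vec ℕ n) → zipWith ℕ._+_ (zipWith ℕ._+_ u v) w ≡ zipWith ℕ._+_ u (zipWith ℕ._+_ v w)
  +-assocᴹ = VecP.zipWith-assoc ℕP.+-assoc

  +-commᴹ : ∀ {n} (u v : Vec ℕ n) → zipWith ℕ._+_ u v ≡ zipWith ℕ._+_ v u
  +-commᴹ = VecP.zipWith-comm ℕP.+-comm

  +-identityᴹ : ∀ {n} (u : Vec ℕ n) → zipWith ℕ._+_ (replicate n 0) u ≡ u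
  +-identityᴹ = VecP.zipWith-identityˡ ℕP.+-identityˡ

  scale-scale : ∀ a u b v p → scale a u (scale b v p) ≈ᴸ scale (a * b) (zipWith ℕ._+_ u v) p
  scale-scale a u b v p f = begin
    linear f (scale a u (scale b v p))
      ≈⟨ linear-scale f a u (scale b v p) ⟩
    a * linear (λ w → f (zipWith ℕ._+_ u w)) (scale b v p)
      ≈⟨ *-congˡ (linear-scale _ b v p) ⟩
    a * (b * linear (λ w → f (zipWith ℕ._+_ u (zipWith ℕ._+_ v w))) p)
      ≈⟨ *-assoc a b _ ⟨
    (a * b) * linear (λ w → f (zipWith ℕ._+_ u (zipWith ℕ._+_ v w))) p
      ≈⟨ *-congˡ (linear-ext (λ w → reflexive (≡.cong f (≡.sym (+-assocᴹ u v w)))) p) ⟩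
    (a * b) * linear (λ w → f (zipWith ℕ._+_ (zipWith ℕ._+_ u v) w)) p
      ≈⟨ linear-scale f (a * b) _ p ⟨
    linear f (scale (a * b) (zipWith ℕ._+_ u v) p) ∎

  scale-cong : ∀ {a b u v} → a ≈ b → u ≡ v → ∀ p → scale a u p ≈ᴸ scale b v p
  scale-cong {a} {b} {u} e ≡.refl p f = trans (linear-scale f a u p) (trans (*-congʳ e) (sym (linear-scale f b u p)))

  scale-congʳ : ∀ a u {p q} → p ≈ᴸ q → scale a u p ≈ᴸ scale a u q
  scale-congʳ a u {p} {q} e f = trans (linear-scale f a u p) (trans (*-congˡ (e _)) (sym (linear-scale f a u q)))

  scale-++ : ∀ a u p q → scale a u (p List.++ q) ≈ᴸ scale a u p List.++ scale a u q
  scale-++ a u p q f = reflexive (≡.cong (linear f) (ListP.map-++ _ p q))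

  scale-1 : ∀ p → scale 1# (replicate N 0) p ≈ᴸ p
  scale-1 p f = trans (linear-scale f 1# _ p) (trans (*-identityˡ _)
    (linear-ext (λ u → reflexive (≡.cong f (+-identityᴹ u))) p))

  0ᴹ : Mon
  0ᴹ = replicate N 0

  record Ideal (p : Pol) : Set (c ⊔ ℓ) where
    constructor member
    field membership : InIdeal G p

  Ideal-resp : ∀ {p q} → p ≈ᴸ q → Ideal q → Ideal p
  Ideal-resp {p} {q} e (member (hs , hs∈G , q≈)) = member (hs , hs∈G , λ m → trans (≈ᴸ⇒≈P {p} {q} e m) (q≈ m))

  Ideal-zero : ∀ {p} → p ≈ᴸ [] → Ideal p
  Ideal-zero {p} e = member ([] , [] , ≈ᴸ⇒≈P {p} {[]} e)

  combination : List (Pol × Pol) → Pol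
  combination hs = sumP (map (λ hg → proj₁ hg *P proj₂ hg) hs)

  combination-++ : ∀ hs hs′ → combination (hs List.++ hs′) ≈ᴸ combination hs List.++ combination hs′
  combination-++ []             hs′ f = refl
  combination-++ ((h , g) ∷ hs) hs′ f = begin
    linear f ((h *P g) List.++ combination (hs List.++ hs′))
      ≈⟨ linear-++ f (h *P g) _ ⟩
    linear f (h *P g) + linear f (combination (hs List.++ hs′))
      ≈⟨ +-congˡ (trans (combination-++ hs hs′ f) (linear-++ f (combination hs) (combination hs′))) ⟩
    linear f (h *P g) + (linear f (combination hs) + linear f (combination hs′))
      ≈⟨ +-assoc _ _ _ ⟨
    (linear f (h *P g) + linear f (combination hs)) + linear f (combination hs′)
      ≈⟨ +-congʳ (linear-++ f (h *P g) (combination hs)) ⟨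
    linear f (combination ((h , g) ∷ hs)) + linear f (combination hs′)
      ≈⟨ linear-++ f (combination ((h , g) ∷ hs)) (combination hs′) ⟨
    linear f (combination ((h , g) ∷ hs) List.++ combination hs′) ∎

  Ideal-++ : ∀ {p q} → Ideal p → Ideal q → Ideal (p List.++ q)
  Ideal-++ {p} {q} (member (hs , hs∈G , p≈)) (member (hs′ , hs′∈G , q≈)) = member (hs List.++ hs′ , AllP.++⁺ hs∈G hs′∈G ,
    ≈ᴸ⇒≈P {p List.++ q} {combination (hs List.++ hs′)} λ f → begin
      linear f (p List.++ q)
        ≈⟨ linear-++ f p q ⟩
      linear f p + linear f q
        ≈⟨ +-cong (linear-cong f {p} {combination hs} p≈) (linear-cong f {q} {combination hs′} q≈) ⟩
      linear f (combination hs) + linear f (combination hs′)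
        ≈⟨ linear-++ f (combination hs) (combination hs′) ⟨
      linear f (combination hs List.++ combination hs′)
        ≈⟨ combination-++ hs hs′ f ⟨
      linear f (combination (hs List.++ hs′)) ∎)

  Ideal-scale : ∀ a u {p} → Ideal p → Ideal (scale a u p)
  Ideal-scale a u {p} (member (hs , hs∈G , p≈)) = member (scaleAll hs , scaled∈G hs hs∈G ,
    ≈ᴸ⇒≈P {scale a u p} {combination (scaleAll hs)} λ f →
      trans (scale-congʳ a u {p} {combination hs} (λ f → linear-cong f {p} {combination hs} p≈) f) (scale-combination hs f))
    where
    scaleAll : List (Pol × Pol) → List (Pol × Pol)
    scaleAll = map (λ hg → scale a u (proj₁ hg) , proj₂ hg)
    scaled∈G : ∀ hs → All (λ hg → G (proj₂ hg)) hs → All (λ hg → G (proj₂ hg)) (scaleAll hs)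
    scaled∈G []       []         = []
    scaled∈G (_ ∷ hs) (Gg ∷ Gs) = Gg ∷ scaled∈G hs Gs
    scale-* : ∀ h g → scale a u (h *P g) ≈ᴸ scale a u h *P g
    scale-* h g f = begin
      linear f (scale a u (h *P g))
        ≈⟨ linear-scale f a u (h *P g) ⟩
      a * linear (λ w → f (zipWith ℕ._+_ u w)) (h *P g)
        ≈⟨ *-congˡ (linear-* _ h g) ⟩
      a * linear (λ v → linear (λ w → f (zipWith ℕ._+_ u (zipWith ℕ._+_ v w))) g) h
        ≈⟨ *-congˡ (linear-ext (λ v → linear-ext (λ w → reflexive (≡.cong f (≡.sym (+-assocᴹ u v w)))) g) h) ⟩
      a * linear (λ v → linear (λ w → f (zipWith ℕ._+_ (zipWith ℕ._+_ u v) w)) g) h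
        ≈⟨ linear-scale _ a u h ⟨
      linear (λ v → linear (λ w → f (zipWith ℕ._+_ v w)) g) (scale a u h)
        ≈⟨ linear-* f (scale a u h) g ⟨
      linear f (scale a u h *P g) ∎
    scale-combination : ∀ hs → scale a u (combination hs) ≈ᴸ combination (scaleAll hs)
    scale-combination []             f = refl
    scale-combination ((h , g) ∷ hs) f = begin
      linear f (scale a u ((h *P g) List.++ combination hs))
        ≈⟨ scale-++ a u (h *P g) (combination hs) f ⟩
      linear f (scale a u (h *P g) List.++ scale a u (combination hs))
        ≈⟨ linear-++ f (scale a u (h *P g)) _ ⟩
      linear f (scale a u (h *P g)) + linear f (scale a u (combination hs))
        ≈⟨ +-cong (scale-* h g f) (scale-combination hs f) ⟩
      linear f (scale a u h *P g) + linear f (combination (scaleAll hs))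
        ≈⟨ linear-++ f (scale a u h *P g) _ ⟨
      linear f (combination (scaleAll ((h , g) ∷ hs))) ∎

  Ideal-multiple : ∀ h {g} → G g → Ideal (h *P g)
  Ideal-multiple h {g} Gg = member ((h , g) ∷ [] , Gg ∷ [] ,
    ≈ᴸ⇒≈P {h *P g} {combination ((h , g) ∷ [])} λ f →
      sym (trans (linear-++ f (h *P g) []) (+-identityʳ _)))

  infix 4 _~_

  record _~_ (p q : Pol) : Set (c ⊔ ℓ) where
    constructor congruent
    field difference : Ideal (p List.++ (-P q))

  open _~_

  ≈ᴸ⇒~ : ∀ {p q} → p ≈ᴸ q → p ~ q
  ≈ᴸ⇒~ {p} {q} e = congruent (Ideal-zero λ f → trans (linear-diff f p q) (x≈y⇒x∙y⁻¹≈ε (e f)))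

  ~-sym : ∀ {p q} → p ~ q → q ~ p
  ~-sym {p} {q} (congruent d) = congruent (Ideal-resp
    (λ f → begin
      linear f (q List.++ (-P p))
        ≈⟨ linear-diff f q p ⟩
      linear f q + - linear f p
        ≈⟨ +-comm _ _ ⟩
      - linear f p + linear f q
        ≈⟨ +-congˡ (-‿involutive _) ⟨
      - linear f p + - - linear f q
        ≈⟨ ⁻¹-∙-comm _ _ ⟩
      - (linear f p + - linear f q)
        ≈⟨ -‿cong (linear-diff f p q) ⟨
      - linear f (p List.++ (-P q))
        ≈⟨ -1*x≈-x _ ⟨
      - 1# * linear f (p List.++ (-P q))
        ≈⟨ *-congˡ (linear-ext (λ u → reflexive (≡.cong f (≡.sym (+-identityᴹ u)))) (p List.++ (-P q))) ⟩
      - 1# * linear (λ u → f (zipWith ℕ._+_ 0ᴹ u)) (p List.++ (-P q))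
        ≈⟨ linear-scale f (- 1#) 0ᴹ (p List.++ (-P q)) ⟨
      linear f (scale (- 1#) 0ᴹ (p List.++ (-P q))) ∎)
    (Ideal-scale (- 1#) 0ᴹ d))

  ~-trans : ∀ {p q r} → p ~ q → q ~ r → p ~ r
  ~-trans {p} {q} {r} (congruent d) (congruent d′) = congruent (Ideal-resp
    (λ f → begin
      linear f (p List.++ (-P r))
        ≈⟨ linear-diff f p r ⟩
      linear f p + - linear f r
        ≈⟨ +-congˡ (trans (+-congʳ (-‿inverseˡ _)) (+-identityˡ _)) ⟨
      linear f p + ((- linear f q + linear f q) + - linear f r)
        ≈⟨ trans (+-assoc _ _ _) (+-congˡ (sym (+-assoc _ _ _))) ⟨
      (linear f p + - linear f q) + (linear f q + - linear f r)
        ≈⟨ +-cong (linear-diff f p q) (linear-diff f q r) ⟨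
      linear f (p List.++ (-P q)) + linear f (q List.++ (-P r))
        ≈⟨ linear-++ f (p List.++ (-P q)) (q List.++ (-P r)) ⟨
      linear f ((p List.++ (-P q)) List.++ (q List.++ (-P r))) ∎)
    (Ideal-++ d d′))

  ~-++ : ∀ {p q p′ q′} → p ~ q → p′ ~ q′ → p List.++ p′ ~ q List.++ q′
  ~-++ {p} {q} {p′} {q′} (congruent d) (congruent d′) = congruent (Ideal-resp
    (λ f → begin
      linear f ((p List.++ p′) List.++ (-P (q List.++ q′)))
        ≈⟨ linear-diff f (p List.++ p′) (q List.++ q′) ⟩
      linear f (p List.++ p′) + - linear f (q List.++ q′)
        ≈⟨ +-cong (linear-++ f p p′) (trans (-‿cong (linear-++ f q q′)) (sym (⁻¹-∙-comm _ _))) ⟩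
      (linear f p + linear f p′) + (- linear f q + - linear f q′)
        ≈⟨ interchange _ _ _ _ ⟩
      (linear f p + - linear f q) + (linear f p′ + - linear f q′)
        ≈⟨ +-cong (linear-diff f p q) (linear-diff f p′ q′) ⟨
      linear f (p List.++ (-P q)) + linear f (p′ List.++ (-P q′))
        ≈⟨ linear-++ f (p List.++ (-P q)) (p′ List.++ (-P q′)) ⟨
      linear f ((p List.++ (-P q)) List.++ (p′ List.++ (-P q′))) ∎)
    (Ideal-++ d d′))

  ~-scale : ∀ a u {p q} → p ~ q → scale a u p ~ scale a u q
  ~-scale a u {p} {q} (congruent d) = congruent (Ideal-resp
    (λ f → begin
      linear f (scale a u p List.++ (-P scale a u q))
        ≈⟨ linear-diff f (scale a u p) (scale a u q) ⟩
      linear f (scale a u p) + - linear f (scale a u q)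
        ≈⟨ +-cong (linear-scale f a u p) (-‿cong (linear-scale f a u q)) ⟩
      a * linear _ p + - (a * linear _ q)
        ≈⟨ +-congˡ (-‿distribʳ-* a _) ⟩
      a * linear _ p + a * - linear _ q
        ≈⟨ distribˡ a _ _ ⟨
      a * (linear _ p + - linear _ q)
        ≈⟨ *-congˡ (linear-diff _ p q) ⟨
      a * linear _ (p List.++ (-P q))
        ≈⟨ linear-scale f a u (p List.++ (-P q)) ⟨
      linear f (scale a u (p List.++ (-P q))) ∎)
    (Ideal-scale a u d))

  -P≈scale : ∀ p → (-P p) ≈ᴸ scale (- 1#) 0ᴹ p
  -P≈scale p f = trans (linear-neg f p) (trans (sym (-1*x≈-x _)) (trans
    (*-congˡ (linear-ext (λ u → reflexive (≡.cong f (≡.sym (+-identityᴹ u)))) p)) (sym (linear-scale f (- 1#) 0ᴹ p))))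

  quotientGroup : AbelianGroup c (c ⊔ ℓ)
  quotientGroup = record
    { Carrier = Pol ; _≈_ = _~_ ; _∙_ = List._++_ ; ε = [] ; _⁻¹ = -P_
    ; isAbelianGroup = record
      { isGroup = record
        { isMonoid = record
          { isSemigroup = record
            { isMagma = record
              { isEquivalence = record { refl = ≈ᴸ⇒~ (λ f → refl) ; sym = ~-sym ; trans = ~-trans }
              ; ∙-cong = ~-++ }
            ; assoc = λ p q r → ≈ᴸ⇒~ (λ f → reflexive (≡.cong (linear f) (ListP.++-assoc p q r))) }
          ; identity = (λ p → ≈ᴸ⇒~ (λ f → refl))
                     , (λ p → ≈ᴸ⇒~ (λ f → reflexive (≡.cong (linear f) (ListP.++-identityʳ p)))) }
        ; inverse = (λ p → ≈ᴸ⇒~ (λ f → trans (linear-++ f (-P p) p) (trans (+-congʳ (linear-neg f p)) (-‿inverseˡ _))))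
                  , (λ p → ≈ᴸ⇒~ (λ f → trans (linear-diff f p p) (-‿inverseʳ _)))
        ; ⁻¹-cong = λ {p} {q} e → ~-trans (≈ᴸ⇒~ (-P≈scale p))
            (~-trans (~-scale (- 1#) 0ᴹ e) (~-sym (≈ᴸ⇒~ (-P≈scale q)))) }
      ; comm = λ p q → ≈ᴸ⇒~ (λ f → trans (linear-++ f p q) (trans (+-comm _ _) (sym (linear-++ f q p)))) } }

  quotient : OpModule c (c ⊔ ℓ)
  quotient = record
    { group      = quotientGroup
    ; _•_        = λ a → scale a 0ᴹ
    ; •-cong     = λ {a} {b} {v} {w} a≈b e → ~-trans (≈ᴸ⇒~ (scale-cong a≈b ≡.refl v)) (~-scale b 0ᴹ e)
    ; •-distribˡ = λ a p q → ≈ᴸ⇒~ (scale-++ a 0ᴹ p q)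
    ; •-distribʳ = λ a b p → ≈ᴸ⇒~ (λ f → trans (linear-scale f (a + b) 0ᴹ p) (trans (distribʳ _ a b)
        (trans (+-cong (sym (linear-scale f a 0ᴹ p)) (sym (linear-scale f b 0ᴹ p)))
          (sym (linear-++ f (scale a 0ᴹ p) (scale b 0ᴹ p))))))
    ; •-assoc    = λ a b p → ~-sym (≈ᴸ⇒~ (λ f → trans (scale-scale a 0ᴹ b 0ᴹ p f)
        (scale-cong refl (+-identityᴹ 0ᴹ) p f)))
    ; •-identity = λ p → ≈ᴸ⇒~ (scale-1 p)
    ; op         = λ v → scale 1# (unit v)
    ; op-endo    = λ v → record { cong = ~-scale 1# (unit v) ; homo = λ p q → ≈ᴸ⇒~ (scale-++ 1# (unit v) p q) }
    ; op-•       = λ v a p → ≈ᴸ⇒~ (scale-comm 1# (unit v) a 0ᴹ p)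
    ; op-comm    = λ v v′ p → ≈ᴸ⇒~ (scale-comm 1# (unit v) 1# (unit v′) p)
    }
    where
    scale-comm : ∀ a u b v p → scale a u (scale b v p) ≈ᴸ scale b v (scale a u p)
    scale-comm a u b v p f = trans (scale-scale a u b v p f)
      (trans (scale-cong (*-comm a b) (+-commᴹ u v) p f) (sym (scale-scale b v a u p f)))

  open PolynomialAction quotient

  act-scale : ∀ u p → act u p ≈ᴸ scale 1# u p
  act-scale u p f = trans (go u unit f) (scale-cong refl (monAct-unit u) p f)
    where
    pow-scale : ∀ k v q w → q ≈ᴸ scale 1# w p →
                pow (scale 1# v) k q ≈ᴸ scale 1# (pow (zipWith ℕ._+_ v) k w) p
    pow-scale zero    v q w e = e
    pow-scale (suc k) v q w e f = trans (scale-congʳ 1# v {pow (scale 1# v) k q} {scale 1# (pow (zipWith ℕ._+_ v) k w) p} (pow-scale k v q w e) f)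
      (trans (scale-scale 1# v 1# _ p f) (scale-cong (*-identityˡ 1#) ≡.refl p f))
    go : ∀ {n} (u : Vec ℕ n) (U : Fin n → Mon) →
         monAct (λ i → scale 1# (U i)) u p ≈ᴸ scale 1# (monAct (λ i → zipWith ℕ._+_ (U i)) u 0ᴹ) p
    go []      U f = sym (scale-1 p f)
    go (a ∷ u) U   = pow-scale a (U zero) _ _ (go u (U ∘ suc))

  -- Acting by `g` is multiplication by `g`. The order `p *P g` puts `g` where `InIdeal` expects a
  -- generator; commutativity comes from `linear-swap`, the interchange of two finite sums.
  ▷-product : ∀ g p → g ▷ p ≈ᴸ p *P g
  ▷-product g p f = trans (go g) (trans (linear-swap (λ u v → f (zipWith ℕ._+_ u v)) g p)
    (trans (linear-ext (λ v → linear-ext (λ u → reflexive (≡.cong f (+-commᴹ u v))) g) p) (sym (linear-* f p g))))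
    where
    go : ∀ g → linear f (g ▷ p) ≈ linear (λ u → linear (λ v → f (zipWith ℕ._+_ u v)) p) g
    go []            = refl
    go ((a , u) ∷ g) = trans (linear-++ f (scale a 0ᴹ (act u p)) (g ▷ p)) (+-cong (begin
      linear f (scale a 0ᴹ (act u p))
        ≈⟨ scale-congʳ a 0ᴹ {act u p} {scale 1# u p} (act-scale u p) f ⟩
      linear f (scale a 0ᴹ (scale 1# u p))
        ≈⟨ scale-scale a 0ᴹ 1# u p f ⟩
      linear f (scale (a * 1#) (zipWith ℕ._+_ 0ᴹ u) p)
        ≈⟨ scale-cong (*-identityʳ a) (+-identityᴹ u) p f ⟩
      linear f (scale a u p)
        ≈⟨ linear-scale f a u p ⟩
      a * linear (λ v → f (zipWith ℕ._+_ u v)) p ∎) (go g))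

  generator-▷ : ∀ {g} → G g → ∀ p → g ▷ p ~ []
  generator-▷ {g} Gg p = congruent (Ideal-resp (λ f → trans
    (reflexive (≡.cong (linear f) (ListP.++-identityʳ (g ▷ p)))) (▷-product g p f)) (Ideal-multiple p Gg))

module Generation {a ℓ} (W : AbelianGroup a ℓ) {c} {C : Set c} (constant : C → AbelianGroup.Carrier W) where
  open AbelianGroup W
  open MonomialAction W
  open IsEndo

  expand : ∀ {n} → (Fin n → Carrier → Carrier) → List (C × Vec ℕ n) → Carrier
  expand X []            = ε
  expand X ((a , u) ∷ q) = monAct X u (constant a) ∙ expand X q

  IsConstant : Carrier → Set (c ⊔ ℓ)
  IsConstant w = ∃ λ a → w ≈ constant a

  expand-++ : ∀ {n} (X : Fin n → Carrier → Carrier) q q′ → expand X (q List.++ q′) ≈ expand X q ∙ expand X q′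
  expand-++ X []      q′ = sym (identityˡ _)
  expand-++ X (x ∷ q) q′ = trans (∙-congˡ (expand-++ X q q′)) (sym (assoc _ _ _))

  expand-pow : ∀ {n} {X : Fin (suc n) → Carrier → Carrier} → (∀ i → IsEndo (X i)) → ∀ k q →
    expand X (map (λ t → proj₁ t , k ∷ proj₂ t) q) ≈ pow (X zero) k (expand (X ∘ suc) q)
  expand-pow eX k []      = sym (0-homo (pow-endo (eX zero) k))
  expand-pow eX k (x ∷ q) = trans (∙-congˡ (expand-pow eX k q)) (sym (homo (pow-endo (eX zero) k) _ _))

  -- Nested membership is flattened into a list of terms: the layer of `Adjoin` at stage `suc k`
  -- contributes the exponent `k` of the first variable, and the stages end at `suc (κ zero)`.
  BoxSpan⇒expand : ∀ {n} {X : Fin n → Carrier → Carrier} {κ} → (∀ i → IsEndo (X i)) → ∀ {w} →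
    BoxSpan IsConstant X κ w → ∃ λ q → All (Box κ ∘ proj₂) q × w ≈ expand X q
  BoxSpan⇒expand {zero} eX (v , (a , v≈) , w≈v) =
    (a , []) ∷ [] , (λ ()) ∷ [] , trans w≈v (trans v≈ (sym (identityʳ _)))
  BoxSpan⇒expand {suc n} {X} {κ} eX = adjoin (suc (κ zero)) ℕP.≤-refl
    where
    adjoin : ∀ k → k ≤ suc (κ zero) → ∀ {w} → Adjoin (BoxSpan IsConstant (X ∘ suc) (κ ∘ suc)) (X zero) k w →
             ∃ λ q → All (Box κ ∘ proj₂) q × w ≈ expand X q
    adjoin zero    l (none w≈) = [] , [] , w≈
    adjoin (suc k) l (more f s w≈) with adjoin k (ℕP.<⇒≤ l) f | BoxSpan⇒expand (eX ∘ suc) s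
    ... | q , bq , f≈ | q′ , bq′ , s≈ = q List.++ map (λ t → proj₁ t , k ∷ proj₂ t) q′
      , AllP.++⁺ bq (AllP.map⁺ (All.map (λ {t} → boxed {t}) bq′))
      , trans w≈ (trans (∙-cong f≈ (trans (cong (pow-endo (eX zero) k) s≈) (sym (expand-pow eX k q′))))
          (sym (expand-++ X q (map (λ t → proj₁ t , k ∷ proj₂ t) q′))))
      where
      boxed : ∀ {t : C × Vec ℕ n} → Box (κ ∘ suc) (proj₂ t) → Box κ (k ∷ proj₂ t)
      boxed b zero    = ℕP.≤-pred l
      boxed b (suc i) = b i

module SpanningProof (t r : ℕ) (blk : Fin r → Fin (suc t)) {c ℓ} (K : Field c ℓ)
  (G : Poly.Pol K (suc t ℕ.+ r) → Set c) where
  open Field K hiding (zero)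
  open Blocks t r blk
  open Poly K N
  open Linear K N
  open Theta K
  open PolynomialQuotient K N G
  open PolynomialAction quotient
  open Independence t r blk K using (BoxMon)
  private module Q = AbelianGroup quotientGroup
  open AbelianGroupProperties quotientGroup using (inverseʳ-unique; ⁻¹-involutive)

  constant : Carrier → Pol
  constant a = (a , 0ᴹ) ∷ []

  open Generation quotientGroup constant

  private
    Y : Fin s → Pol → Pol
    Y = X quotient

    Y-endo : ∀ i → IsEndo (Y i)
    Y-endo i = OpModule.op-endo quotient (i ↑ˡ r)

  module _ (θ∈G : ∀ j → G (θ-form (s ↑ʳ j))) (mon∈G : ∀ i → G ((1# , brokenMon i) ∷ []))
           (block₀ : 1 ≤ count (inBlock zero)) where

    B~tail : ∀ j w → B quotient j w ~ tailFrom Y (blk j) w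
    B~tail j w = Q.trans
      (inverseʳ-unique (-P tailFrom Y (blk j) w) (B quotient j w)
        (Q.trans (Q.sym (θ-▷ quotient j w)) (generator-▷ {θ-form (s ↑ʳ j)} (θ∈G j) w)))
      (⁻¹-involutive (tailFrom Y (blk j) w))

    mon~0 : ∀ i w → act (brokenMon i) w ~ []
    mon~0 i w = Q.trans (Q.sym (Q.trans (Q.identityʳ _) (OpModule.•-identity quotient _))) (generator-▷ (mon∈G i) w)

    relations : Relations Y κ
    relations zero    = inj₂ λ w → Q.trans
      (Q.reflexive (≡.cong (λ k → pow (tailFrom Y zero) k w) (ℕP.m+[n∸m]≡n block₀)))
      (Q.trans (Q.sym (act-brokenMon-zero quotient (tailFrom Y) (tailFrom-endo Y-endo) B~tail w)) (mon~0 zero w))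
    relations (suc i) = inj₁ λ w → Q.trans
      (Q.sym (act-brokenMon-suc quotient (tailFrom Y) (tailFrom-endo Y-endo) B~tail i w)) (mon~0 (suc i) w)

    private
      S : Pol → Set (c ⊔ ℓ)
      S = BoxSpan IsConstant Y κ

      constants : IsSubgroup IsConstant
      constants = record
        { resp = λ e (a , w~) → a , Q.trans (Q.sym e) w~
        ; zero-closed = 0# , ≈ᴸ⇒~ (λ f → sym (trans (+-identityʳ _) (zeroˡ _)))
        ; +-closed = λ (a , v~) (b , w~) → a + b , Q.trans (Q.∙-cong v~ w~)
            (≈ᴸ⇒~ (λ f → trans (sym (+-assoc _ _ _)) (+-congʳ (sym (distribʳ _ a b)))))
        ; neg-closed = λ (a , w~) → - a , Q.⁻¹-cong w~ }

      isS : IsSubgroup S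
      isS = BoxSpan-isSubgroup IsConstant constants {κ = κ} Y-endo

      Y-closed : ∀ i {w} → S w → S (Y i w)
      Y-closed = BoxSpan-closed IsConstant constants {κ = κ} Y-endo
        (λ i j → OpModule.op-comm quotient (i ↑ˡ r) (j ↑ˡ r)) relations

      tailFrom-closed : ∀ {n} {Z : Fin n → Pol → Pol} → (∀ i {w} → S w → S (Z i w)) →
                        ∀ i {w} → S w → S (tailFrom Z i w)
      tailFrom-closed h (suc i) Sw = tailFrom-closed (h ∘ suc) i Sw
      tailFrom-closed {suc zero}    h zero Sw = IsSubgroup.+-closed isS (h zero Sw) (IsSubgroup.zero-closed isS)
      tailFrom-closed {suc (suc n)} h zero Sw = IsSubgroup.+-closed isS (h zero Sw) (tailFrom-closed (h ∘ suc) zero Sw)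

      op-closed : ∀ v {w} → S w → S (OpModule.op quotient v w)
      op-closed v {w} Sw = ≡.subst (λ v → S (OpModule.op quotient v w)) (FinP.join-splitAt s r v) (go (splitAt s v))
        where
        go : ∀ x → S (OpModule.op quotient (join s r x) w)
        go (inj₁ i) = Y-closed i Sw
        go (inj₂ j) = IsSubgroup.resp isS (Q.sym (B~tail j w)) (tailFrom-closed Y-closed (blk j) Sw)

      act-closed : ∀ {n} {Z : Fin n → Pol → Pol} → (∀ v {w} → S w → S (Z v w)) → ∀ u {w} → S w → S (monAct Z u w)
      act-closed h []      Sw = Sw
      act-closed {Z = Z} h (a ∷ u) Sw = go a
        where
        go : ∀ k → S (pow (Z zero) k _)
        go zero    = act-closed (h ∘ suc) u Sw
        go (suc k) = h zero (go k)

      constant∈S : ∀ a → S (constant a)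
      constant∈S a = go {κ = κ} Y-endo
        where
        go : ∀ {n} {Z : Fin n → Pol → Pol} {κ} → (∀ i → IsEndo (Z i)) → BoxSpan IsConstant Z κ (constant a)
        go {zero}  eZ = constant a , (a , Q.refl) , Q.refl
        go {suc n} {Z} {κ} eZ = weaken (κ zero)
          where
          sub : IsSubgroup (BoxSpan IsConstant (Z ∘ suc) (κ ∘ suc))
          sub = BoxSpan-isSubgroup IsConstant constants (eZ ∘ suc)
          weaken : ∀ k → Adjoin (BoxSpan IsConstant (Z ∘ suc) (κ ∘ suc)) (Z zero) (suc k) (constant a)
          weaken zero    = Adjoin-pow sub (eZ zero) zero (go (eZ ∘ suc))
          weaken (suc k) = Adjoin-weaken sub (eZ zero) (weaken k)

      act-constant : ∀ u a → act u (constant a) ~ (a , u) ∷ []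
      act-constant u a = ≈ᴸ⇒~ λ f → trans (act-scale u (constant a) f) (+-congʳ
        (*-cong (*-identityˡ a) (reflexive (≡.cong f (≡.trans (+-commᴹ u 0ᴹ) (+-identityᴹ u))))))

      -- `S` contains the constants and is closed under all variables: under chords by the tower,
      -- under non-chords because they are congruent to tail sums of chords.
      all∈S : ∀ p → S p
      all∈S []            = IsSubgroup.zero-closed isS
      all∈S ((a , u) ∷ p) = IsSubgroup.+-closed isS
        (IsSubgroup.resp isS (act-constant u a) (act-closed op-closed u (constant∈S a))) (all∈S p)

    private
      pad : List (Carrier × Vec ℕ s) → Pol
      pad = map (λ t → proj₁ t , proj₂ t ++ replicate r 0)

      pad-box : ∀ {q} → All (Box κ ∘ proj₂) q → All (BoxMon ∘ proj₂) (pad q)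
      pad-box []       = []
      pad-box (b ∷ bs) = (_ , ≡.refl , b) ∷ pad-box bs

      expand~pad : ∀ q → expand Y q ~ pad q
      expand~pad []            = Q.refl
      expand~pad ((a , u) ∷ q) = Q.∙-cong
        (Q.trans (Q.reflexive (≡.sym (≡.trans (monAct-++ (OpModule.op quotient) u (replicate r 0) (constant a))
            (≡.cong (monAct Y u) (monAct-zero (B quotient) (constant a))))))
          (act-constant (u ++ replicate r 0) a))
        (expand~pad q)

      expansion : ∀ p → ∃ λ q → All (Box κ ∘ proj₂) q × p ~ expand Y q
      expansion p = BoxSpan⇒expand {κ = κ} Y-endo (all∈S p)

    spanning : ∀ p → ∃ λ q → All (BoxMon ∘ proj₂) q × InIdeal G (p List.++ (-P q))
    spanning p = pad q , pad-box (proj₁ (proj₂ (expansion p)))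
      , Ideal.membership (_~_.difference p~q)
      where
      q : List (Carrier × Vec ℕ s)
      q = proj₁ (expansion p)
      p~q : p ~ pad q
      p~q = ~-trans (proj₂ (proj₂ (expansion p))) (expand~pad q)

-- Circuits of a chain of polygons

subset-ext : ∀ {n} {p q : Subset n} → (∀ x → x ∈ p ⇔ x ∈ q) → p ≡ q
subset-ext e = SubsetP.⊆-antisym (λ {x} → ⇒ (e x)) (λ {x} → ⇐ (e x))

∈-tabulate : ∀ {n} (f : Fin n → Bool) x → x ∈ tabulate f ⇔ f x ≡ true
∈-tabulate f x = mk⇔
  (λ x∈ → ≡.trans (≡.sym (VecP.lookup∘tabulate f x)) (VecP.[]=⇒lookup x∈))
  (λ e → VecP.lookup⇒[]= x (tabulate f) (≡.trans (VecP.lookup∘tabulate f x) e))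

does-true : ∀ {a} {A : Set a} (d : Dec A) → does d ≡ true ⇔ A
does-true (yes a) = mk⇔ (λ _ → a) (λ _ → ≡.refl)
does-true (no ¬a) = mk⇔ (λ ()) (λ a → contradiction a ¬a)

∈-separate : ∀ {n} {P : Fin n → Set} (P? : ∀ x → Dec (P x)) x → x ∈ tabulate (does ∘ P?) ⇔ P x
∈-separate P? x = mk⇔ (⇒ (does-true (P? x)) ∘ ⇒ (∈-tabulate _ x)) (⇐ (∈-tabulate _ x) ∘ ⇐ (does-true (P? x)))

x∈p─q⇒x∉q : ∀ {n} (p q : Subset n) {x} → x ∈ p ─ q → x ∉ q
x∈p─q⇒x∉q (inside ∷ p) (inside ∷ q) () here
x∈p─q⇒x∉q (outside ∷ p) (inside ∷ q) () here
x∈p─q⇒x∉q (_ ∷ p) (outside ∷ q) (there x∈) (there x∈q) = x∈p─q⇒x∉q p q x∈ x∈q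
x∈p─q⇒x∉q (_ ∷ p) (inside ∷ q) (there x∈) (there x∈q) = x∈p─q⇒x∉q p q x∈ x∈q

∈-∖ : ∀ {n} (p : Subset n) y x → x ∈ p ∖ y ⇔ (x ∈ p × x ≢ y)
∈-∖ p y x = mk⇔
  (λ x∈ → SubsetP.p─q⊆p p ⁅ y ⁆ x∈ , λ { ≡.refl → x∈p─q⇒x∉q p ⁅ y ⁆ x∈ (SubsetP.x∈⁅x⁆ y) })
  (λ (x∈p , x≢y) → SubsetP.x∈p∧x≢y⇒x∈p-y x∈p x≢y)

∣p∖x∣ : ∀ {n} {p : Subset n} {x} → x ∈ p → suc ∣ p ∖ x ∣ ≡ ∣ p ∣
∣p∖x∣ {p = inside ∷ p} here = ≡.cong (suc ∘ ∣_∣) (SubsetP.p─⊥≡p p)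
∣p∖x∣ {p = inside ∷ p} (there x∈p) = ≡.cong suc (∣p∖x∣ x∈p)
∣p∖x∣ {p = outside ∷ p} (there x∈p) = ∣p∖x∣ x∈p

0<∣p∣⇒Nonempty : ∀ {n} (p : Subset n) → 0 < ∣ p ∣ → Nonempty p
0<∣p∣⇒Nonempty {n} p 0<p with SubsetP.nonempty? p
... | yes ne = ne
... | no ¬ne rewrite SubsetP.Empty-unique ¬ne | SubsetP.∣⊥∣≡0 n = contradiction 0<p λ ()

another-element : ∀ {n} (p : Subset n) → 2 ≤ ∣ p ∣ → ∀ y → ∃ λ x → x ∈ p × x ≢ y
another-element p 2≤p y with y ∈? p
... | yes y∈p with 0<∣p∣⇒Nonempty (p ∖ y) (ℕP.≤-pred (≡.subst (2 ≤_) (≡.sym (∣p∖x∣ y∈p)) 2≤p))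
...   | x , x∈ = x , ⇒ (∈-∖ p y x) x∈
another-element p 2≤p y | no y∉p with 0<∣p∣⇒Nonempty p (ℕP.<⇒≤ 2≤p)
... | x , x∈p = x , x∈p , λ { ≡.refl → y∉p x∈p }

-- A subset missing `x ∈ E` lies in the basis `E ∖ x`, while `E` is too large to lie in a basis;
-- `1 ≤ n` keeps the truncated `n ∸ 1` below `n`.
UCirc-corank-one : ∀ {N n} (E : Subset N) → ∣ E ∣ ≡ n → 1 ≤ n → ∀ C → UCirc E (n ∸ 1) C ⇔ C ≡ E
UCirc-corank-one E ≡.refl 1≤E C = mk⇔ circuit⇒ (λ { ≡.refl → ⇒circuit })
  where
  indep : ∀ D x → D ⊆ E → x ∈ E → x ∉ D → UIndep E (∣ E ∣ ∸ 1) D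
  indep D x D⊆E x∈E x∉D = E ∖ x
    , ((λ {y} y∈ → proj₁ (⇒ (∈-∖ E x y) y∈)) , ≡.cong (_∸ 1) (∣p∖x∣ x∈E))
    , λ {y} y∈D → ⇐ (∈-∖ E x y) (D⊆E y∈D , λ { ≡.refl → x∉D y∈D })
  circuit⇒ : UCirc E (∣ E ∣ ∸ 1) C → C ≡ E
  circuit⇒ (C⊆E , dep , _) = SubsetP.⊆-antisym C⊆E λ {x} x∈E → go x x∈E
    where
    go : ∀ x → x ∈ E → x ∈ C
    go x x∈E with x ∈? C
    ... | yes x∈C = x∈C
    ... | no  x∉C = contradiction (indep C x C⊆E x∈E x∉C) dep
  ⇒circuit : UCirc E (∣ E ∣ ∸ 1) E
  ⇒circuit = (λ x∈ → x∈)
    , (λ (B , (_ , ∣B∣) , E⊆B) → ℕP.<⇒≱ (ℕP.≤-reflexive (ℕP.m+[n∸m]≡n 1≤E))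
         (≡.subst (∣ E ∣ ≤_) ∣B∣ (SubsetP.p⊆q⇒∣p∣≤∣q∣ E⊆B)))
    , λ D (D⊆E , x , x∈E , x∉D) → indep D x D⊆E x∈E x∉D

-- The kind of an element: inj₁ l for the chord x_l separating E_l from E_{l+1} (or from nothing if
-- l is the last index), inj₂ j for an element lying in E_j only.
Kind : Set
Kind = ℕ ⊎ ℕ

LiesIn : ℕ → Kind → Set
LiesIn i (inj₁ l) = i ≡ l ⊎ i ≡ suc l
LiesIn i (inj₂ j) = i ≡ j

-- The symmetric difference of E_a, …, E_c.
Cut : ℕ → ℕ → Kind → Set
Cut a c (inj₁ l) = l ≡ c ⊎ suc l ≡ a
Cut a c (inj₂ j) = a ≤ j × j ≤ c

cut? : ∀ a c k → Dec (Cut a c k)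
cut? a c (inj₁ l) = (l ℕ.≟ c) ⊎-dec (suc l ℕ.≟ a)
cut? a c (inj₂ j) = (a ℕ.≤? j) ×-dec (j ℕ.≤? c)

Cut-diagonal : ∀ i k → LiesIn i k ⇔ Cut i i k
Cut-diagonal i (inj₁ l) = mk⇔ (λ { (inj₁ e) → inj₁ (≡.sym e) ; (inj₂ e) → inj₂ (≡.sym e) })
                              (λ { (inj₁ e) → inj₁ (≡.sym e) ; (inj₂ e) → inj₂ (≡.sym e) })
Cut-diagonal i (inj₂ j) = mk⇔ (λ { ≡.refl → ℕP.≤-refl , ℕP.≤-refl }) (λ (i≤j , j≤i) → ℕP.≤-antisym i≤j j≤i)

-- Adding the next polygon turns `x_t`, the end of the old interval, into an interior chord. It
-- belongs to both parts and is the element deleted by the gluing.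
Cut-extend : ∀ {a t} → a ≤ t → ∀ k →
  Cut a (suc t) k ⇔ ((Cut a t k ⊎ LiesIn (suc t) k) × k ≢ inj₁ t)
Cut-extend {a} {t} a≤t (inj₁ l) = mk⇔
  (λ { (inj₁ ≡.refl) → inj₂ (inj₁ ≡.refl) , λ e → ℕP.1+n≢n (inj₁-injective e)
     ; (inj₂ e) → inj₁ (inj₂ e) , λ { ≡.refl → ℕP.1+n≰n (≡.subst (_≤ t) (≡.sym e) a≤t) } })
  (λ { (inj₁ (inj₁ ≡.refl) , ne) → contradiction ≡.refl ne
     ; (inj₁ (inj₂ e) , ne) → inj₂ e
     ; (inj₂ (inj₁ e) , ne) → inj₁ (≡.sym e)
     ; (inj₂ (inj₂ ≡.refl) , ne) → contradiction ≡.refl ne })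
Cut-extend {a} {t} a≤t (inj₂ j) = mk⇔ forward backward
  where
  forward : a ≤ j × j ≤ suc t → ((a ≤ j × j ≤ t) ⊎ suc t ≡ j) × inj₂ j ≢ inj₁ t
  forward (a≤j , j≤1+t) with ℕP.m≤n⇒m<n∨m≡n j≤1+t
  ... | inj₁ j<1+t = inj₁ (a≤j , ℕP.≤-pred j<1+t) , λ ()
  ... | inj₂ j≡1+t = inj₂ (≡.sym j≡1+t) , λ ()
  backward : ((a ≤ j × j ≤ t) ⊎ suc t ≡ j) × inj₂ j ≢ inj₁ t → a ≤ j × j ≤ suc t
  backward (inj₁ (a≤j , j≤t) , _) = a≤j , ℕP.m≤n⇒m≤1+n j≤t
  backward (inj₂ ≡.refl , _)      = ℕP.m≤n⇒m≤1+n a≤t , ℕP.≤-refl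

module _ {N : ℕ} (kind : Fin N → Kind) where

  cutSet : ℕ → ℕ → Subset N
  cutSet a c = tabulate (λ x → does (cut? a c (kind x)))

  ∈-cutSet : ∀ a c x → x ∈ cutSet a c ⇔ Cut a c (kind x)
  ∈-cutSet a c = ∈-separate (λ x → cut? a c (kind x))

  -- Induction on the number of polygons. Old circuits have `c ≤ t`, the new polygon is an interval
  -- of length one, and the old circuits that can be glued are those ending at `c = t`.
  parChain-circuits : ∀ {t} (E : Fin (suc t) → Subset N) (n : Fin (suc t) → ℕ) (p : Fin t → Fin N) →
    (∀ i → ∣ E i ∣ ≡ n i) → (∀ i → 1 ≤ n i) →
    (∀ i x → x ∈ E i ⇔ LiesIn (toℕ i) (kind x)) →
    (∀ k x → x ≡ p k ⇔ kind x ≡ inj₁ (toℕ k)) →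
    ∀ C → parChain (λ i → UCirc (E i) (n i ∸ 1)) p C ⇔
          ∃₂ λ a c → a ≤ c × c ≤ t × C ≡ cutSet a c
  parChain-circuits {zero} E n p ∣E∣ 1≤n mem chord C = mk⇔
    (λ circ → 0 , 0 , z≤n , z≤n , ≡.trans (⇒ (UCirc-corank-one (E zero) (∣E∣ zero) (1≤n zero) C) circ) E≡)
    (λ { (0 , 0 , _ , _ , e) → ⇐ (UCirc-corank-one (E zero) (∣E∣ zero) (1≤n zero) C) (≡.trans e (≡.sym E≡)) })
    where
    E≡ : E zero ≡ cutSet 0 0
    E≡ = subset-ext λ x → mk⇔
      (⇐ (∈-cutSet 0 0 x) ∘ ⇒ (Cut-diagonal 0 (kind x)) ∘ ⇒ (mem zero x))
      (⇐ (mem zero x) ∘ ⇐ (Cut-diagonal 0 (kind x)) ∘ ⇒ (∈-cutSet 0 0 x))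
  parChain-circuits {suc t} E n p ∣E∣ 1≤n mem chord C = mk⇔ forward backward
    where
    T : Fin (suc (suc t))
    T = fromℕ (suc t)

    IH : ∀ C → parChain (λ i → UCirc (E (inject₁ i)) (n (inject₁ i) ∸ 1)) (p ∘ inject₁) C ⇔
               ∃₂ λ a c → a ≤ c × c ≤ t × C ≡ cutSet a c
    IH = parChain-circuits (E ∘ inject₁) (n ∘ inject₁) (p ∘ inject₁) (∣E∣ ∘ inject₁) (1≤n ∘ inject₁)
      (λ i x → ≡.subst (λ j → x ∈ E (inject₁ i) ⇔ LiesIn j (kind x)) (FinP.toℕ-inject₁ i) (mem (inject₁ i) x))
      (λ k x → ≡.subst (λ j → x ≡ p (inject₁ k) ⇔ kind x ≡ inj₁ j) (FinP.toℕ-inject₁ k) (chord (inject₁ k) x))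

    mem-T : ∀ x → x ∈ E T ⇔ LiesIn (suc t) (kind x)
    mem-T x = ≡.subst (λ j → x ∈ E T ⇔ LiesIn j (kind x)) (FinP.toℕ-fromℕ (suc t)) (mem T x)

    chord-T : ∀ x → x ≡ p (fromℕ t) ⇔ kind x ≡ inj₁ t
    chord-T x = ≡.subst (λ j → x ≡ p (fromℕ t) ⇔ kind x ≡ inj₁ j) (FinP.toℕ-fromℕ t) (chord (fromℕ t) x)

    E≡ : E T ≡ cutSet (suc t) (suc t)
    E≡ = subset-ext λ x → mk⇔
      (⇐ (∈-cutSet _ _ x) ∘ ⇒ (Cut-diagonal (suc t) (kind x)) ∘ ⇒ (mem-T x))
      (⇐ (mem-T x) ∘ ⇐ (Cut-diagonal (suc t) (kind x)) ∘ ⇒ (∈-cutSet _ _ x))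

    kind-p : kind (p (fromℕ t)) ≡ inj₁ t
    kind-p = ⇒ (chord-T _) ≡.refl

    glued : ∀ {a} → a ≤ t → (cutSet a t ∪ E T) ∖ p (fromℕ t) ≡ cutSet a (suc t)
    glued {a} a≤t = subset-ext λ x → mk⇔
      (λ x∈ → let (x∈∪ , x≢p) = ⇒ (∈-∖ _ _ x) x∈ in
        ⇐ (∈-cutSet a (suc t) x) (⇐ (Cut-extend a≤t (kind x))
          (Sum.map (⇒ (∈-cutSet a t x)) (⇒ (mem-T x)) (SubsetP.x∈p∪q⁻ (cutSet a t) (E T) x∈∪) , x≢p ∘ ⇐ (chord-T x))))
      (λ x∈ → let (x∈∪ , k≢) = ⇒ (Cut-extend a≤t (kind x)) (⇒ (∈-cutSet a (suc t) x) x∈) in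
        ⇐ (∈-∖ _ _ x) (SubsetP.x∈p∪q⁺ (Sum.map (⇐ (∈-cutSet a t x)) (⇐ (mem-T x)) x∈∪) , k≢ ∘ ⇒ (chord-T x)))

    forward : parChain (λ i → UCirc (E i) (n i ∸ 1)) p C → ∃₂ λ a c → a ≤ c × c ≤ suc t × C ≡ cutSet a c
    forward (inM circ) with ⇒ (IH C) circ
    ... | a , c , a≤c , c≤t , e = a , c , a≤c , ℕP.m≤n⇒m≤1+n c≤t , e
    forward (inN circ) = suc t , suc t , ℕP.≤-refl , ℕP.≤-refl , ≡.trans (⇒ (UCirc-corank-one (E T) (∣E∣ T) (1≤n T) C) circ) E≡
    forward (glue C₁ C₂ circ₁ circ₂ p∈₁ p∈₂ e) with ⇒ (IH C₁) circ₁
    ... | a , c , a≤c , c≤t , ≡.refl with ≡.subst (Cut a c) kind-p (⇒ (∈-cutSet a c _) p∈₁)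
    -- The gluing element could also be the starting chord of the circuit, but then `a = t + 1` lies
    -- beyond the old chain.
    ...   | inj₂ 1+t≡a  = contradiction (ℕP.≤-trans (≡.subst (_≤ c) (≡.sym 1+t≡a) a≤c) c≤t) ℕP.1+n≰n
    ...   | inj₁ ≡.refl = a , suc t , ℕP.m≤n⇒m≤1+n a≤c , ℕP.≤-refl , (≡.trans e (≡.trans
            (≡.cong (λ D → (cutSet a t ∪ D) ∖ p (fromℕ t)) (⇒ (UCirc-corank-one (E T) (∣E∣ T) (1≤n T) C₂) circ₂)) (glued a≤c)))

    backward : (∃₂ λ a c → a ≤ c × c ≤ suc t × C ≡ cutSet a c) → parChain (λ i → UCirc (E i) (n i ∸ 1)) p C
    backward (a , c , a≤c , c≤1+t , e) with ℕP.m≤n⇒m<n∨m≡n c≤1+t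
    ... | inj₁ c<1+t = inM (⇐ (IH C) (a , c , a≤c , ℕP.≤-pred c<1+t , e))
    ... | inj₂ ≡.refl with ℕP.m≤n⇒m<n∨m≡n a≤c
    ...   | inj₂ ≡.refl = inN (⇐ (UCirc-corank-one (E T) (∣E∣ T) (1≤n T) C) (≡.trans e (≡.sym E≡)))
    ...   | inj₁ a<1+t = glue (cutSet a t) (E T)
              (⇐ (IH _) (a , t , a≤t , ℕP.≤-refl , ≡.refl))
              (⇐ (UCirc-corank-one (E T) (∣E∣ T) (1≤n T) (E T)) ≡.refl)
              (⇐ (∈-cutSet a t _) (≡.subst (Cut a t) (≡.sym kind-p) (inj₁ ≡.refl)))
              (⇐ (mem-T _) (≡.subst (LiesIn (suc t)) (≡.sym kind-p) (inj₂ ≡.refl)))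
              (≡.trans e (≡.sym (glued a≤t)))
      where
      a≤t : a ≤ t
      a≤t = ℕP.≤-pred a<1+t

-- Least positions, counting, and extension of an injection to an ordering

firstPos-just : ∀ {n} (f : Fin n → Bool) i → f i ≡ true → (∀ j → toℕ j < toℕ i → f j ≡ false) →
                firstPos f ≡ just i
firstPos-just f zero    on below rewrite on = ≡.refl
firstPos-just f (suc i) on below
  rewrite below zero (s≤s z≤n) | firstPos-just (f ∘ suc) i on (λ j j<i → below (suc j) (s≤s j<i)) = ≡.refl

firstPos-just⁻ : ∀ {n} (f : Fin n → Bool) {i} → firstPos f ≡ just i → f i ≡ true
firstPos-just⁻ {suc n} f e with f zero in on
firstPos-just⁻ {suc n} f ≡.refl | true = on
firstPos-just⁻ {suc n} f e | false with firstPos (f ∘ suc) in eq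
firstPos-just⁻ {suc n} f ≡.refl | false | just i = firstPos-just⁻ (f ∘ suc) eq

firstPos-nothing : ∀ {n} (f : Fin n → Bool) → (∀ i → f i ≡ false) → firstPos f ≡ nothing
firstPos-nothing {zero}  f off = ≡.refl
firstPos-nothing {suc n} f off rewrite off zero | firstPos-nothing (f ∘ suc) (off ∘ suc) = ≡.refl

firstPos-nothing⁻ : ∀ {n} (f : Fin n → Bool) → firstPos f ≡ nothing → ∀ i → f i ≡ false
firstPos-nothing⁻ {suc n} f e i with f zero in off
firstPos-nothing⁻ {suc n} f e zero    | false = off
firstPos-nothing⁻ {suc n} f e (suc i) | false with firstPos (f ∘ suc) in eq
... | nothing = firstPos-nothing⁻ (f ∘ suc) eq i

count-↑ : ∀ m {n} (f : Fin (m ℕ.+ n) → Bool) → count f ≡ count (λ i → f (i ↑ˡ n)) ℕ.+ count (λ j → f (m ↑ʳ j))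
count-↑ m f = ℕSums.sum-↑ m (λ v → if f v then 1 else 0)

count-cong : ∀ {n} {f g : Fin n → Bool} → (∀ i → f i ≡ g i) → count f ≡ count g
count-cong e = ℕSums.sum-cong-≗ (λ i → ≡.cong (if_then 1 else 0) (e i))

count-none : ∀ {n} {f : Fin n → Bool} → (∀ i → f i ≡ false) → count f ≡ 0
count-none off = ℕSums.sum-zero (λ i → ≡.cong (if_then 1 else 0) (off i))

count-mono : ∀ {n} {f g : Fin n → Bool} → (∀ i → f i ≡ true → g i ≡ true) → count f ≤ count g
count-mono {zero} le = z≤n
count-mono {suc n} {f} {g} le with f zero in fz | g zero in gz
... | false | _     = ℕP.≤-trans (count-mono (le ∘ suc)) (ℕP.m≤n+m _ _)
... | true  | true  = s≤s (count-mono (le ∘ suc))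
... | true  | false = contradiction (≡.trans (≡.sym gz) (le zero fz)) λ ()

count-strict : ∀ {n} {f g : Fin n → Bool} i → (∀ i → f i ≡ true → g i ≡ true) →
               f i ≡ false → g i ≡ true → suc (count f) ≤ count g
count-strict zero    le fi gi rewrite fi | gi = s≤s (count-mono (le ∘ suc))
count-strict {suc n} {f} {g} (suc i) le fi gi with f zero in fz | g zero in gz
... | false | _     = ℕP.≤-trans (count-strict i (le ∘ suc) fi gi) (ℕP.m≤n+m _ _)
... | true  | true  = s≤s (count-strict i (le ∘ suc) fi gi)
... | true  | false = contradiction (≡.trans (≡.sym gz) (le zero fz)) λ ()

count-positive : ∀ {n} {f : Fin n → Bool} i → f i ≡ true → 1 ≤ count f
count-positive i on = ℕP.≤-trans (s≤s z≤n) (count-strict {f = λ _ → false} i (λ _ ()) ≡.refl on)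

count-single : ∀ {n} (f : Fin n → Bool) i → (∀ j → j ≢ i → f j ≡ false) → f i ≡ true → count f ≡ 1
count-single f i off on = ≡.trans (ℕSums.sum-single i (λ j j≢i → ≡.cong (if_then 1 else 0) (off j j≢i)))
  (≡.cong (if_then 1 else 0) on)

countFin≡count : ∀ {n} (f : Fin n → Bool) → countFin f ≡ count f
countFin≡count {n} f = go (λ i → i)
  where
  go : ∀ {m} (g : Fin m → Fin n) →
       foldr ℕ._+_ 0 (map (λ i → if f i then 1 else 0) (List.tabulate g)) ≡ count (f ∘ g)
  go {zero}  g = ≡.refl
  go {suc m} g = ≡.cong (_ ℕ.+_) (go (g ∘ suc))

∣p∣≡count : ∀ {n} (p : Subset n) → ∣ p ∣ ≡ count (λ x → does (x ∈? p))
∣p∣≡count []            = ≡.refl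
∣p∣≡count (inside ∷ p)  = ≡.cong suc (∣p∣≡count p)
∣p∣≡count (outside ∷ p) = ∣p∣≡count p

∣p∣≡count-permuted : ∀ {n} (π : Fin n ↔ Fin n) p → ∣ p ∣ ≡ count (λ v → does (Inverse.to π v ∈? p))
∣p∣≡count-permuted π p = ≡.trans (∣p∣≡count p) (ℕSums.sum-permute (λ x → if does (x ∈? p) then 1 else 0) π)

tabulate-↑ : ∀ {a} {A : Set a} m {n} (f : Fin (m ℕ.+ n) → A) →
             tabulate f ≡ tabulate (λ i → f (i ↑ˡ n)) ++ tabulate (λ j → f (m ↑ʳ j))
tabulate-↑ zero    f = ≡.refl
tabulate-↑ (suc m) f = ≡.cong (f zero ∷_) (tabulate-↑ m (f ∘ suc))

tabulate-constant : ∀ {a} {A : Set a} n (x : A) → tabulate {n = n} (λ _ → x) ≡ replicate n x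
tabulate-constant zero    x = ≡.refl
tabulate-constant (suc n) x = ≡.cong (x ∷_) (tabulate-constant n x)

≤⇒summand : ∀ {n} (u v : Vec ℕ n) → (∀ i → lookup u i ≤ lookup v i) → ∃ λ w → v ≡ zipWith ℕ._+_ w u
≤⇒summand []      []      le = [] , ≡.refl
≤⇒summand (a ∷ u) (b ∷ v) le with ≤⇒summand u v (le ∘ suc)
... | w , e = b ∸ a ∷ w , ≡.cong₂ _∷_ (≡.sym (ℕP.m∸n+n≡m (le zero))) e

transpose-fixes : ∀ {n} {i j k : Fin n} → k ≢ i → k ≢ j → PermC.transpose i j k ≡ k
transpose-fixes {i = i} {j} {k} k≢i k≢j rewrite dec-false (k FinP.≟ i) k≢i | dec-false (k FinP.≟ j) k≢j = ≡.refl

transpose-left : ∀ {n} (i j : Fin n) → PermC.transpose i j i ≡ j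
transpose-left i j rewrite dec-true (i FinP.≟ i) ≡.refl = ≡.refl

-- Stage `k` swaps the right element into position `k`. Earlier positions are undisturbed: they
-- differ from `k`, and by injectivity of `f` none of them holds the element that is fetched.
extend-injection : ∀ s {r} (f : Fin s → Fin (s ℕ.+ r)) → Injective _≡_ _≡_ f →
                   ∃ λ (π : Fin (s ℕ.+ r) ↔ Fin (s ℕ.+ r)) → ∀ i → Inverse.to π (i ↑ˡ r) ≡ f i
extend-injection s {r} f inj with go s ℕP.≤-refl
  where
  N : ℕ
  N = s ℕ.+ r
  go : ∀ k → k ≤ s → ∃ λ (π : Fin N ↔ Fin N) → ∀ i → toℕ i < k → Inverse.to π (i ↑ˡ r) ≡ f i
  go zero    k≤s = Perm.id , λ i ()
  go (suc k) k<s with go k (ℕP.<⇒≤ k<s)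
  ... | π , agrees = Perm.transpose here′ there′ Perm.∘ₚ π , agrees′
    where
    i₀ : Fin s
    i₀ = fromℕ< k<s
    here′ there′ : Fin N
    here′  = i₀ ↑ˡ r
    there′ = Inverse.from π (f i₀)
    to-there : Inverse.to π there′ ≡ f i₀
    to-there = Inverse.strictlyInverseˡ π (f i₀)
    agrees′ : ∀ i → toℕ i < suc k → Inverse.to π (PermC.transpose here′ there′ (i ↑ˡ r)) ≡ f i
    agrees′ i i<1+k with i FinP.≟ i₀
    ... | yes ≡.refl = ≡.trans (≡.cong (Inverse.to π) (transpose-left here′ there′)) to-there
    ... | no i≢i₀ = ≡.trans (≡.cong (Inverse.to π) (transpose-fixes ≢here ≢there)) (agrees i i<k)
      where
      i<k : toℕ i < k
      i<k = ℕP.≤∧≢⇒< (ℕP.≤-pred i<1+k) λ e → i≢i₀ (FinP.toℕ-injective (≡.trans e (≡.sym (FinP.toℕ-fromℕ< k<s))))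
      ≢here : i ↑ˡ r ≢ here′
      ≢here e = i≢i₀ (FinP.↑ˡ-injective r i i₀ e)
      ≢there : i ↑ˡ r ≢ there′
      ≢there e = i≢i₀ (inj (≡.trans (≡.sym (agrees i i<k)) (≡.trans (≡.cong (Inverse.to π) e) to-there)))
... | π , agrees = π , λ i → agrees i (FinP.toℕ<n i)

-- The ordering and its broken circuits

module Broken (t r : ℕ) (blk : Fin r → Fin (suc t)) (π : Fin (suc t ℕ.+ r) ↔ Fin (suc t ℕ.+ r)) where
  open Blocks t r blk

  e : Fin N → Fin N
  e = Inverse.to π

  chord : Fin s → Fin N
  chord i = e (i ↑ˡ r)

  member : Fin r → Fin N
  member j = e (s ↑ʳ j)

  by-position : ∀ {p} {P : Fin N → Set p} → (∀ i → P (i ↑ˡ r)) → (∀ j → P (s ↑ʳ j)) → ∀ v → P v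
  by-position {P = P} f g v = ≡.subst P (FinP.join-splitAt s r v) (go (splitAt s v))
    where
    go : ∀ x → P (join s r x)
    go (inj₁ i) = f i
    go (inj₂ j) = g j

  by-element : ∀ {p} {P : Fin N → Set p} → (∀ i → P (chord i)) → (∀ j → P (member j)) → ∀ x → P x
  by-element {P = P} f g x = ≡.subst P (Inverse.strictlyInverseˡ π x) (by-position {P = P ∘ e} f g (Inverse.from π x))

  e-injective : ∀ {v w} → e v ≡ e w → v ≡ w
  e-injective {v} {w} q = ≡.trans (≡.sym (Inverse.strictlyInverseʳ π v))
    (≡.trans (≡.cong (Inverse.from π) q) (Inverse.strictlyInverseʳ π w))

  chord-injective : ∀ {i i′} → chord i ≡ chord i′ → i ≡ i′
  chord-injective {i} {i′} q = FinP.↑ˡ-injective r i i′ (e-injective q)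

  member-injective : ∀ {j j′} → member j ≡ member j′ → j ≡ j′
  member-injective {j} {j′} q = FinP.↑ʳ-injective s j j′ (e-injective q)

  ↑ˡ≢↑ʳ : ∀ {i j} → i ↑ˡ r ≢ s ↑ʳ j
  ↑ˡ≢↑ʳ {i} {j} q with () ← ≡.trans (≡.sym (FinP.splitAt-↑ˡ s i r)) (≡.trans (≡.cong (splitAt s) q) (FinP.splitAt-↑ʳ s r j))

  chord≢member : ∀ {i j} → chord i ≢ member j
  chord≢member = ↑ˡ≢↑ʳ ∘ e-injective

  positionKind : Fin s ⊎ Fin r → Kind
  positionKind (inj₁ i) = inj₁ (toℕ i)
  positionKind (inj₂ j) = inj₂ (toℕ (blk j))

  kind : Fin N → Kind
  kind x = positionKind (splitAt s (Inverse.from π x))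

  kind-chord : ∀ i → kind (chord i) ≡ inj₁ (toℕ i)
  kind-chord i rewrite Inverse.strictlyInverseʳ π (i ↑ˡ r) | FinP.splitAt-↑ˡ s i r = ≡.refl

  kind-member : ∀ j → kind (member j) ≡ inj₂ (toℕ (blk j))
  kind-member j rewrite Inverse.strictlyInverseʳ π (s ↑ʳ j) | FinP.splitAt-↑ʳ s r j = ≡.refl

  cut : ℕ → ℕ → Subset N
  cut = cutSet kind

  chord∈cut : ∀ a c i → chord i ∈ cut a c ⇔ (toℕ i ≡ c ⊎ suc (toℕ i) ≡ a)
  chord∈cut a c i = ≡.subst (λ k → chord i ∈ cut a c ⇔ Cut a c k) (kind-chord i) (∈-cutSet kind a c (chord i))

  member∈cut : ∀ a c j → member j ∈ cut a c ⇔ (a ≤ toℕ (blk j) × toℕ (blk j) ≤ c)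
  member∈cut a c j = ≡.subst (λ k → member j ∈ cut a c ⇔ Cut a c k) (kind-member j) (∈-cutSet kind a c (member j))

  lastChord : ∀ {c} → c ≤ t → ∃ λ i → toℕ {s} i ≡ c
  lastChord c≤t = fromℕ< (s≤s c≤t) , FinP.toℕ-fromℕ< (s≤s c≤t)

  -- The fundamental circuit of a chord; the value at other elements is junk.
  ci : Fin N → Subset N
  ci x = circuitOf (splitAt s (Inverse.from π x))
    where
    circuitOf : Fin s ⊎ Fin r → Subset N
    circuitOf (inj₁ i) = cut 0 (toℕ i)
    circuitOf (inj₂ _) = ∅

  ci-chord : ∀ i → ci (chord i) ≡ cut 0 (toℕ i)
  ci-chord i rewrite Inverse.strictlyInverseʳ π (i ↑ˡ r) | FinP.splitAt-↑ˡ s i r = ≡.refl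

  nonzero? : ∀ σ → Dec (σ ≢ zer)
  nonzero? neg = yes λ ()
  nonzero? zer = no λ ne → ne ≡.refl
  nonzero? pos = yes λ ()

  -- Taken as the support of the sign row, so that the sign condition is immediate and being a
  -- cocircuit is what needs proof.
  coc : Fin N → Subset N
  coc x = tabulate (λ y → does (nonzero? (signs (Inverse.from π x) (Inverse.from π y))))

  ∈coc : ∀ v w → e w ∈ coc (e v) ⇔ signs v w ≢ zer
  ∈coc v w = ≡.subst₂ (λ v′ w′ → e w ∈ coc (e v) ⇔ signs v′ w′ ≢ zer)
    (Inverse.strictlyInverseʳ π v) (Inverse.strictlyInverseʳ π w)
    (∈-separate (λ y → nonzero? (signs (Inverse.from π (e v)) (Inverse.from π y))) (e w))

  signs-chord : ∀ j i → signs (s ↑ʳ j) (i ↑ˡ r) ≡ pathSign (blk j) i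
  signs-chord j i rewrite FinP.splitAt-↑ʳ s r j | FinP.splitAt-↑ˡ s i r = ≡.refl

  signs-member : ∀ j j′ → signs (s ↑ʳ j) (s ↑ʳ j′) ≡ diagSign j j′
  signs-member j j′ rewrite FinP.splitAt-↑ʳ s r j | FinP.splitAt-↑ʳ s r j′ = ≡.refl

  pathSign-≤ : ∀ {n} (b i : Fin n) → toℕ b ≤ toℕ i → pathSign b i ≡ neg
  pathSign-≤ zero    i       le       = ≡.refl
  pathSign-≤ (suc b) (suc i) (s≤s le) = pathSign-≤ b i le

  pathSign-> : ∀ {n} (b i : Fin n) → toℕ i < toℕ b → pathSign b i ≡ zer
  pathSign-> (suc b) zero    lt       = ≡.refl
  pathSign-> (suc b) (suc i) (s≤s lt) = pathSign-> b i lt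

  chord∈coc : ∀ j i → chord i ∈ coc (member j) ⇔ toℕ (blk j) ≤ toℕ i
  chord∈coc j i = mk⇔ forward backward
    where
    forward : chord i ∈ coc (member j) → toℕ (blk j) ≤ toℕ i
    forward i∈ with toℕ (blk j) ℕ.≤? toℕ i
    ... | yes le = le
    ... | no ¬le = contradiction (≡.trans (signs-chord j i) (pathSign-> (blk j) i (ℕP.≰⇒> ¬le))) (⇒ (∈coc (s ↑ʳ j) (i ↑ˡ r)) i∈)
    backward : toℕ (blk j) ≤ toℕ i → chord i ∈ coc (member j)
    backward le = ⇐ (∈coc (s ↑ʳ j) (i ↑ˡ r)) λ z → contradiction
      (≡.trans (≡.sym (≡.trans (signs-chord j i) (pathSign-≤ (blk j) i le))) z) λ ()

  member∈coc : ∀ j j′ → member j′ ∈ coc (member j) ⇔ j′ ≡ j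
  member∈coc j j′ = mk⇔ forward backward
    where
    forward : member j′ ∈ coc (member j) → j′ ≡ j
    forward j′∈ with j′ FinP.≟ j
    ... | yes q = q
    ... | no ¬q = contradiction (≡.trans (signs-member j j′) (≡.cong (if_then pos else zer) (dec-false (j′ FinP.≟ j) ¬q)))
                    (⇒ (∈coc (s ↑ʳ j) (s ↑ʳ j′)) j′∈)
    backward : j′ ≡ j → member j′ ∈ coc (member j)
    backward q = ⇐ (∈coc (s ↑ʳ j) (s ↑ʳ j′)) λ z → contradiction
      (≡.trans (≡.sym (≡.trans (signs-member j j′) (≡.cong (if_then pos else zer) (dec-true (j′ FinP.≟ j) q)))) z) λ ()

  basisPosition : ∀ (j : Fin r) → N ∸ r ≤ toℕ (s ↑ʳ j)
  basisPosition j = ≡.subst₂ _≤_ (≡.sym (ℕP.m+n∸n≡m s r)) (≡.sym (FinP.toℕ-↑ʳ s j)) (ℕP.m≤m+n s (toℕ j))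

  chordPosition : ∀ (i : Fin s) → toℕ (i ↑ˡ r) < N ∸ r
  chordPosition i = ≡.subst₂ _<_ (≡.sym (FinP.toℕ-↑ˡ i r)) (≡.sym (ℕP.m+n∸n≡m s r)) (FinP.toℕ<n i)

  basis : Subset N
  basis = BsetOf π r

  ∈basis : ∀ v → e v ∈ basis ⇔ N ∸ r ≤ toℕ v
  ∈basis v = ≡.subst (λ w → e v ∈ basis ⇔ N ∸ r ≤ toℕ w) (Inverse.strictlyInverseʳ π v)
    (∈-separate (λ x → (N ∸ r) ℕ.≤? toℕ (Inverse.from π x)) (e v))

  member∈basis : ∀ j → member j ∈ basis
  member∈basis j = ⇐ (∈basis (s ↑ʳ j)) (basisPosition j)

  chord∉basis : ∀ i → chord i ∉ basis
  chord∉basis i i∈ = ℕP.<⇒≱ (chordPosition i) (⇒ (∈basis _) i∈)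

  module Matroid (Circ : CircFam N)
    (circuits : ∀ C → Circ C ⇔ ∃₂ λ a c → a ≤ c × c ≤ t × C ≡ cut a c) where

    circuit : ∀ a i → a ≤ toℕ i → Circ (cut a (toℕ i))
    circuit a i a≤i = ⇐ (circuits _) (a , toℕ i , a≤i , ℕP.≤-pred (FinP.toℕ<n i) , ≡.refl)

    circuit-elim : ∀ {p} {P : Subset N → Set p} → (∀ a i → a ≤ toℕ i → P (cut a (toℕ i))) → ∀ C → Circ C → P C
    circuit-elim f C circ with ⇒ (circuits C) circ
    ... | a , c , a≤c , c≤t , ≡.refl with lastChord c≤t
    ...   | i , ≡.refl = f a i a≤c

    last∈cut : ∀ a i → chord i ∈ cut a (toℕ i)
    last∈cut a i = ⇐ (chord∈cut a (toℕ i) i) (inj₁ ≡.refl)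

    cut⊆ : ∀ {S} a i → chord i ∈ S → (∀ i′ → suc (toℕ i′) ≡ a → chord i′ ∈ S) →
           (∀ j → a ≤ toℕ (blk j) → toℕ (blk j) ≤ toℕ i → member j ∈ S) → cut a (toℕ i) ⊆ S
    cut⊆ {S} a i last first members {x} = by-element {P = λ x → x ∈ cut a (toℕ i) → x ∈ S}
      (λ i′ i′∈ → chords i′ (⇒ (chord∈cut a (toℕ i) i′) i′∈))
      (λ j j∈ → let (le , le′) = ⇒ (member∈cut a (toℕ i) j) j∈ in members j le le′) x
      where
      chords : ∀ i′ → toℕ i′ ≡ toℕ i ⊎ suc (toℕ i′) ≡ a → chord i′ ∈ S
      chords i′ (inj₁ q) rewrite FinP.toℕ-injective q = last
      chords i′ (inj₂ q) = first i′ q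

    -- Every circuit contains its last chord, so the non-chords are independent; adding `x_i`
    -- completes the circuit around `E_0, …, E_i`.
    basis-isBasis : IsBasis Circ basis
    basis-isBasis = circuit-elim {P = λ C → ¬ C ⊆ basis} (λ a i _ C⊆ → chord∉basis i (C⊆ (last∈cut a i)))
      , by-element (λ i _ indep → indep (cut 0 (toℕ i)) (circuit 0 i z≤n)
          (cut⊆ 0 i (SubsetP.q⊆p∪q basis _ (SubsetP.x∈⁅x⁆ _)) (λ _ ())
            (λ j _ _ → SubsetP.p⊆p∪q _ (member∈basis j))))
        (λ j j∉ → contradiction (member∈basis j) j∉)

    exchange : Fin r → Fin s → Subset N
    exchange j i = (basis ∖ member j) ∪ ⁅ chord i ⁆

    chord∈exchange : ∀ j i i′ → chord i′ ∈ exchange j i → i′ ≡ i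
    chord∈exchange j i i′ i′∈ with SubsetP.x∈p∪q⁻ (basis ∖ member j) ⁅ chord i ⁆ i′∈
    ... | inj₁ i′∈basis = contradiction (proj₁ (⇒ (∈-∖ basis (member j) _) i′∈basis)) (chord∉basis i′)
    ... | inj₂ i′∈⁅i⁆  = chord-injective (SubsetP.x∈⁅y⁆⇒x≡y _ i′∈⁅i⁆)

    member∈exchange : ∀ j i j′ → member j′ ∈ exchange j i ⇔ j′ ≢ j
    member∈exchange j i j′ = mk⇔ forward
      (λ ne → SubsetP.x∈p∪q⁺ (inj₁ (⇐ (∈-∖ basis (member j) _) (member∈basis j′ , ne ∘ member-injective))))
      where
      forward : member j′ ∈ exchange j i → j′ ≢ j
      forward j′∈ with SubsetP.x∈p∪q⁻ (basis ∖ member j) ⁅ chord i ⁆ j′∈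
      ... | inj₁ j′∈basis = proj₂ (⇒ (∈-∖ basis (member j) _) j′∈basis) ∘ ≡.cong member
      ... | inj₂ j′∈⁅i⁆  = contradiction (≡.sym (SubsetP.x∈⁅y⁆⇒x≡y _ j′∈⁅i⁆)) chord≢member

    -- The only chord present is `x_i`, so a circuit inside would run from polygon `0` to `i` and
    -- contain the removed non-chord. For maximality, that non-chord completes this very circuit,
    -- and any further chord completes a circuit avoiding it.
    exchange-isBasis : ∀ j i → toℕ (blk j) ≤ toℕ i → IsBasis Circ (exchange j i)
    exchange-isBasis j i j≤i = circuit-elim {P = λ C → ¬ C ⊆ exchange j i} independent , by-element maximal-chord maximal-member
      where
      independent : ∀ a i′ → a ≤ toℕ i′ → ¬ cut a (toℕ i′) ⊆ exchange j i
      independent a i′ a≤i′ C⊆ with chord∈exchange j i i′ (C⊆ (last∈cut a i′))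
      independent zero i a≤i C⊆ | ≡.refl =
        ⇒ (member∈exchange j i j) (C⊆ (⇐ (member∈cut 0 (toℕ i) j) (z≤n , j≤i))) ≡.refl
      independent (suc a) i a<i C⊆ | ≡.refl with lastChord (ℕP.≤-trans (ℕP.<⇒≤ a<i) (ℕP.≤-pred (FinP.toℕ<n i)))
      ... | i′ , ≡.refl with chord∈exchange j i i′ (C⊆ (⇐ (chord∈cut _ _ i′) (inj₂ ≡.refl)))
      ...   | ≡.refl = ℕP.<-irrefl ≡.refl a<i
      old : ∀ {x y} → x ∈ exchange j i → x ∈ exchange j i ∪ ⁅ y ⁆
      old = SubsetP.p⊆p∪q _
      new : ∀ {y} → y ∈ exchange j i ∪ ⁅ y ⁆
      new = SubsetP.q⊆p∪q (exchange j i) _ (SubsetP.x∈⁅x⁆ _)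
      chord-i : chord i ∈ exchange j i
      chord-i = SubsetP.q⊆p∪q (basis ∖ member j) _ (SubsetP.x∈⁅x⁆ _)
      maximal-member : ∀ j′ → member j′ ∉ exchange j i → ¬ Indep Circ (exchange j i ∪ ⁅ member j′ ⁆)
      maximal-member j′ j′∉ indep = indep (cut 0 (toℕ i)) (circuit 0 i z≤n)
        (cut⊆ 0 i (old chord-i) (λ _ ()) members)
        where
        members : ∀ j″ → 0 ≤ toℕ (blk j″) → toℕ (blk j″) ≤ toℕ i → member j″ ∈ exchange j i ∪ ⁅ member j′ ⁆
        members j″ _ _ with j″ FinP.≟ j′
        ... | yes ≡.refl = new
        ... | no j″≢j′ = old (⇐ (member∈exchange j i j″) λ { ≡.refl → j′∉ (⇐ (member∈exchange j i j′) (j″≢j′ ∘ ≡.sym)) })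
      maximal-chord : ∀ l → chord l ∉ exchange j i → ¬ Indep Circ (exchange j i ∪ ⁅ chord l ⁆)
      maximal-chord l l∉ indep with toℕ l ℕ.<? toℕ (blk j)
      -- A chord before the block of `j` closes a circuit starting at `E_0`. Any other chord closes
      -- the circuit between itself and `x_i`, which lies beyond that block.
      ... | yes l<j = indep (cut 0 (toℕ l)) (circuit 0 l z≤n) (cut⊆ 0 l new (λ _ ())
              (λ j′ _ j′≤l → old (⇐ (member∈exchange j i j′) λ { ≡.refl → ℕP.<⇒≱ l<j j′≤l })))
      ... | no l≮j with ℕP.<-cmp (toℕ l) (toℕ i)
      ...   | tri≈ _ q _ = l∉ (≡.subst (λ l → chord l ∈ exchange j i) (≡.sym (FinP.toℕ-injective q)) chord-i)

      ...   | tri< l<i _ _ = indep (cut (suc (toℕ l)) (toℕ i)) (circuit _ i l<i) (cut⊆ _ i (old chord-i)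
                (λ i′ q → ≡.subst (λ l → chord l ∈ _) (≡.sym (FinP.toℕ-injective (ℕP.suc-injective q))) new)
                (λ j′ l<j′ _ → old (⇐ (member∈exchange j i j′) λ { ≡.refl → ℕP.<⇒≱ l<j′ (ℕP.≮⇒≥ l≮j) })))
      ...   | tri> _ _ i<l = indep (cut (suc (toℕ i)) (toℕ l)) (circuit _ l i<l) (cut⊆ _ l new
                (λ i′ q → ≡.subst (λ l → chord l ∈ _) (≡.sym (FinP.toℕ-injective (ℕP.suc-injective q))) (old chord-i))
                (λ j′ i<j′ _ → old (⇐ (member∈exchange j i j′) λ { ≡.refl → ℕP.<⇒≱ i<j′ j≤i })))

    -- A basis missing the set could be enlarged by the non-chord `b = member j`, since every
    -- circuit through `b` ends at a chord of the set. For minimality, omitting `b` misses the basis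
    -- of non-chords, and omitting `x_i` misses the basis with `b` exchanged for `x_i`.
    coc-isCocircuit : ∀ j → IsCocircuit Circ (coc (member j))
    coc-isCocircuit j = meets , minimal
      where
      D : Subset N
      D = coc (member j)
      meets : MeetsAllBases Circ D
      meets B (indep , maximal) with SubsetP.nonempty? (D ∩ B)
      ... | yes (x , x∈) = x , SubsetP.x∈p∩q⁻ D B x∈
      ... | no disjoint = contradiction enlarged (maximal (member j) j∉B)
        where
        j∉B : member j ∉ B
        j∉B j∈B = disjoint (_ , SubsetP.x∈p∩q⁺ (⇐ (member∈coc j j) ≡.refl , j∈B))
        enlarged : Indep Circ (B ∪ ⁅ member j ⁆)
        enlarged = circuit-elim {P = λ C → ¬ C ⊆ B ∪ ⁅ member j ⁆} go
          where
          shrink : ∀ {x} → x ∈ B ∪ ⁅ member j ⁆ → x ≢ member j → x ∈ B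
          shrink x∈ x≢ with SubsetP.x∈p∪q⁻ B ⁅ member j ⁆ x∈
          ... | inj₁ x∈B = x∈B
          ... | inj₂ x∈⁅j⁆ = contradiction (SubsetP.x∈⁅y⁆⇒x≡y _ x∈⁅j⁆) x≢
          go : ∀ a i → a ≤ toℕ i → ¬ cut a (toℕ i) ⊆ B ∪ ⁅ member j ⁆
          go a i a≤i C⊆ with member j ∈? cut a (toℕ i)
          ... | no j∉C = indep _ (circuit a i a≤i) (λ x∈ → shrink (C⊆ x∈) λ { ≡.refl → j∉C x∈ })
          ... | yes j∈C = disjoint (chord i , SubsetP.x∈p∩q⁺
                  ( ⇐ (chord∈coc j i) (proj₂ (⇒ (member∈cut a (toℕ i) j) j∈C))
                  , shrink (C⊆ (last∈cut a i)) chord≢member))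
      minimal : ∀ D′ → D′ ⊂ D → ¬ MeetsAllBases Circ D′
      minimal D′ (D′⊆D , y , y∈D , y∉D′) meets′ = by-element {P = λ y → y ∈ D → y ∉ D′ → _} omit-chord omit-member y y∈D y∉D′
        where
        omit-member : ∀ j′ → member j′ ∈ D → member j′ ∉ D′ → _
        omit-member j′ j′∈D j′∉D′ with ⇒ (member∈coc j j′) j′∈D
        ... | ≡.refl with meets′ basis basis-isBasis
        ...   | z , z∈D′ , z∈B = by-element {P = λ z → z ∈ D′ → z ∈ basis → Empty.⊥}
                  (λ i _ i∈B → chord∉basis i i∈B)
                  (λ j″ j″∈D′ _ → j′∉D′ (≡.subst (λ j → member j ∈ D′) (⇒ (member∈coc j j″) (D′⊆D j″∈D′)) j″∈D′)) z z∈D′ z∈B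
        omit-chord : ∀ i → chord i ∈ D → chord i ∉ D′ → _
        omit-chord i i∈D i∉D′ with meets′ (exchange j i) (exchange-isBasis j i (⇒ (chord∈coc j i) i∈D))
        ... | z , z∈D′ , z∈B = by-element {P = λ z → z ∈ D′ → z ∈ exchange j i → Empty.⊥}
                  (λ i′ i′∈D′ i′∈B → i∉D′ (≡.subst (λ i → chord i ∈ D′) (chord∈exchange j i i′ i′∈B) i′∈D′))
                  (λ j″ j″∈D′ j″∈B → ⇒ (member∈exchange j i j″) j″∈B (⇒ (member∈coc j j″) (D′⊆D j″∈D′))) z z∈D′ z∈B

    coc⊆ : ∀ j → coc (member j) ⊆ (∁ basis ∪ ⁅ member j ⁆)
    coc⊆ j {x} = by-element {P = λ x → x ∈ coc (member j) → x ∈ (∁ basis ∪ ⁅ member j ⁆)}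
      (λ i _ → SubsetP.p⊆p∪q _ (SubsetP.x∉p⇒x∈∁p (chord∉basis i)))
      (λ j′ j′∈ → SubsetP.q⊆p∪q (∁ basis) _ (≡.subst (λ k → member k ∈ ⁅ member j ⁆) (≡.sym (⇒ (member∈coc j j′) j′∈)) (SubsetP.x∈⁅x⁆ _))) x

    ci⊆ : ∀ i → cut 0 (toℕ i) ⊆ (basis ∪ ⁅ chord i ⁆)
    ci⊆ i = cut⊆ 0 i (SubsetP.q⊆p∪q basis _ (SubsetP.x∈⁅x⁆ _)) (λ _ ()) (λ j _ _ → SubsetP.p⊆p∪q _ (member∈basis j))

-- Broken circuits, the monomials of `L(M)` and the admissible signs

module NBCBasis (t r : ℕ) (blk : Fin r → Fin (suc t)) (π : Fin (suc t ℕ.+ r) ↔ Fin (suc t ℕ.+ r))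
  (Circ : CircFam (suc t ℕ.+ r))
  (circuits : ∀ C → Circ C ⇔ ∃₂ λ a c → a ≤ c × c ≤ t × C ≡ cutSet (Broken.kind t r blk π) a c)
  (block₀ : ∃ λ j → blk j ≡ zero) {c ℓ} (K : Field c ℓ) where

  open Blocks t r blk
  open Broken t r blk π
  open Matroid Circ circuits
  open NBC K Circ π r coc ci signs hiding (e)

  chord-below : ∀ {C} i → (∀ i′ → toℕ i′ < toℕ i → chord i′ ∉ C) →
                ∀ v → toℕ v < toℕ (i ↑ˡ r) → does (e v ∈? C) ≡ false
  chord-below i absent = by-position
    (λ i′ lt → dec-false (chord i′ ∈? _) (absent i′ (≡.subst₂ _<_ (FinP.toℕ-↑ˡ i′ r) (FinP.toℕ-↑ˡ i r) lt)))
    (λ j lt → contradiction (ℕP.<-≤-trans lt (ℕP.<⇒≤ (ℕP.<-≤-trans (chordPosition i) (basisPosition j)))) (ℕP.<-irrefl ≡.refl))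

  bar-first : ∀ {C} i → chord i ∈ C → (∀ i′ → toℕ i′ < toℕ i → chord i′ ∉ C) → bar C ≡ C ∖ chord i
  bar-first {C} i i∈C absent = go (firstPos-just (λ v → does (e v ∈? C)) (i ↑ˡ r) (dec-true (chord i ∈? C) i∈C) (chord-below i absent))
    where
    go : firstPos (λ v → does (e v ∈? C)) ≡ just (i ↑ˡ r) → bar C ≡ C ∖ chord i
    go q with firstPos (λ v → does (e v ∈? C)) | q
    ... | just _ | ≡.refl = ≡.refl

  bar-cut-zero : ∀ i → bar (cut 0 (toℕ i)) ≡ cut 0 (toℕ i) ∖ chord i
  bar-cut-zero i = bar-first i (last∈cut 0 i) absent
    where
    absent : ∀ i′ → toℕ i′ < toℕ i → chord i′ ∉ cut 0 (toℕ i)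
    absent i′ lt i′∈ with ⇒ (chord∈cut 0 (toℕ i) i′) i′∈
    ... | inj₁ q = ℕP.<⇒≢ lt q

  -- The starting chord precedes the end chord, and every chord precedes the non-chords.
  bar-cut-suc : ∀ i₀ (i : Fin s) → toℕ i₀ < toℕ i → bar (cut (suc (toℕ i₀)) (toℕ i)) ≡ cut (suc (toℕ i₀)) (toℕ i) ∖ chord i₀
  bar-cut-suc i₀ i i₀<i = bar-first i₀ (⇐ (chord∈cut _ _ i₀) (inj₂ ≡.refl)) absent
    where
    absent : ∀ i′ → toℕ i′ < toℕ i₀ → chord i′ ∉ cut (suc (toℕ i₀)) (toℕ i)
    absent i′ lt i′∈ with ⇒ (chord∈cut _ (toℕ i) i′) i′∈
    ... | inj₁ q = ℕP.<⇒≢ (ℕP.<-trans lt i₀<i) q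
    ... | inj₂ q = ℕP.<⇒≢ lt (ℕP.suc-injective q)

  member∈bar : ∀ a (i : Fin s) → a ≤ toℕ i → ∀ j →
    member j ∈ bar (cut a (toℕ i)) ⇔ (a ≤ toℕ (blk j) × toℕ (blk j) ≤ toℕ i)
  member∈bar zero i a≤i j rewrite bar-cut-zero i = mk⇔
    (λ j∈ → ⇒ (member∈cut 0 (toℕ i) j) (proj₁ (⇒ (∈-∖ _ (chord i) _) j∈)))
    (λ le → ⇐ (∈-∖ _ (chord i) _) (⇐ (member∈cut 0 (toℕ i) j) le , chord≢member ∘ ≡.sym))
  member∈bar (suc a) i a<i j with lastChord (ℕP.≤-trans (ℕP.<⇒≤ a<i) (ℕP.≤-pred (FinP.toℕ<n i)))
  ... | i₀ , ≡.refl rewrite bar-cut-suc i₀ i a<i = mk⇔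
    (λ j∈ → ⇒ (member∈cut _ (toℕ i) j) (proj₁ (⇒ (∈-∖ _ (chord i₀) _) j∈)))
    (λ le → ⇐ (∈-∖ _ (chord i₀) _) (⇐ (member∈cut _ (toℕ i) j) le , chord≢member ∘ ≡.sym))

  -- A circuit from polygon `0` has `x_i` as its only chord and loses it as the minimum; any other
  -- loses the smaller chord `x_{a-1}` and keeps `x_i`.
  chord∈bar : ∀ a (i : Fin s) → a ≤ toℕ i → ∀ i′ → chord i′ ∈ bar (cut a (toℕ i)) ⇔ (i′ ≡ i × 1 ≤ a)
  chord∈bar zero i a≤i i′ rewrite bar-cut-zero i = mk⇔ forward (λ ())
    where
    forward : chord i′ ∈ cut 0 (toℕ i) ∖ chord i → i′ ≡ i × 1 ≤ 0
    forward i′∈ with ⇒ (∈-∖ (cut 0 (toℕ i)) (chord i) (chord i′)) i′∈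
    ... | i′∈cut , i′≢i with ⇒ (chord∈cut 0 (toℕ i) i′) i′∈cut
    ...   | inj₁ q = contradiction (≡.cong chord (FinP.toℕ-injective q)) i′≢i
  chord∈bar (suc a) i a<i i′ with lastChord (ℕP.≤-trans (ℕP.<⇒≤ a<i) (ℕP.≤-pred (FinP.toℕ<n i)))
  ... | i₀ , ≡.refl rewrite bar-cut-suc i₀ i a<i = mk⇔ forward
      (λ { (≡.refl , _) → ⇐ (∈-∖ _ (chord i₀) (chord i))
             (last∈cut _ i , λ q → ℕP.<⇒≢ a<i (≡.cong toℕ (≡.sym (chord-injective q)))) })
    where
    forward : chord i′ ∈ cut (suc (toℕ i₀)) (toℕ i) ∖ chord i₀ → i′ ≡ i × 1 ≤ suc (toℕ i₀)
    forward i′∈ with ⇒ (∈-∖ (cut (suc (toℕ i₀)) (toℕ i)) (chord i₀) (chord i′)) i′∈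
    ... | i′∈cut , i′≢i₀ with ⇒ (chord∈cut _ (toℕ i) i′) i′∈cut
    ...   | inj₁ q = FinP.toℕ-injective q , s≤s z≤n
    ...   | inj₂ q = contradiction (≡.cong chord (FinP.toℕ-injective (ℕP.suc-injective q))) i′≢i₀

  brokenSet : Fin s → Subset N
  brokenSet i = bar (cut (toℕ i) (toℕ i))

  chord∈brokenSet : ∀ i i′ → chord i′ ∈ brokenSet i ⇔ (i′ ≡ i × 1 ≤ toℕ i)
  chord∈brokenSet i = chord∈bar (toℕ i) i ℕP.≤-refl

  member∈brokenSet : ∀ i j → member j ∈ brokenSet i ⇔ blk j ≡ i
  member∈brokenSet i j = mk⇔
    (λ j∈ → let (le , le′) = ⇒ (member∈bar (toℕ i) i ℕP.≤-refl j) j∈ in FinP.toℕ-injective (ℕP.≤-antisym le′ le))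
    (λ { ≡.refl → ⇐ (member∈bar (toℕ i) i ℕP.≤-refl j) (ℕP.≤-refl , ℕP.≤-refl) })

  -- For `a = 0` the broken circuit contains all non-chords of `E_0`; otherwise it contains `x_i`
  -- and the non-chords of `E_i`. Single polygons therefore determine the nonfaces.
  brokenSet⊆bar : ∀ a (i : Fin s) → a ≤ toℕ i → ∃ λ i₀ → brokenSet i₀ ⊆ bar (cut a (toℕ i))
  brokenSet⊆bar zero i a≤i = zero , λ {x} → by-element {P = λ x → x ∈ brokenSet zero → x ∈ bar (cut 0 (toℕ i))}
    (λ i′ i′∈ → contradiction (proj₂ (⇒ (chord∈brokenSet zero i′) i′∈)) λ ())
    (λ j j∈ → ⇐ (member∈bar 0 i a≤i j) (z≤n , ≡.subst (λ b → toℕ b ≤ toℕ i) (≡.sym (⇒ (member∈brokenSet zero j) j∈)) z≤n)) x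
  brokenSet⊆bar (suc a) i a<i = i , λ {x} → by-element {P = λ x → x ∈ brokenSet i → x ∈ bar (cut (suc a) (toℕ i))}
    (λ i′ i′∈ → ⇐ (chord∈bar (suc a) i a<i i′) (proj₁ (⇒ (chord∈brokenSet i i′) i′∈) , s≤s z≤n))
    (λ j j∈ → let q = ≡.cong toℕ (⇒ (member∈brokenSet i j) j∈) in
      ⇐ (member∈bar (suc a) i a<i j) (ℕP.≤-trans a<i (ℕP.≤-reflexive (≡.sym q)) , ℕP.≤-reflexive q)) x

  brokenSet-nonface : ∀ i → ¬ Face (brokenSet i)
  brokenSet-nonface i face = face (cut (toℕ i) (toℕ i)) (circuit (toℕ i) i ℕP.≤-refl) (λ x∈ → x∈)

  -- `¬ Face F` carries no witness, but the candidates are finite in number, so a decidable search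
  -- finds one.
  nonface⇒brokenSet⊆ : ∀ F → ¬ Face F → ∃ λ i → brokenSet i ⊆ F
  nonface⇒brokenSet⊆ F nonface with FinP.any? (λ i → brokenSet i SubsetP.⊆? F)
  ... | yes found = found
  ... | no none = contradiction
    (circuit-elim {P = λ C → ¬ bar C ⊆ F} (λ a i a≤i bar⊆F →
      let (i₀ , ⊆bar) = brokenSet⊆bar a i a≤i in none (i₀ , λ x∈ → bar⊆F (⊆bar x∈)))) nonface

  open Poly K N

  monoOf-brokenSet : ∀ i → monoOf (brokenSet i) ≡ brokenMon i
  monoOf-brokenSet i = ≡.trans (tabulate-↑ s (λ v → if does (e v ∈? brokenSet i) then 1 else 0)) (≡.cong₂ _++_ (chords i)
    (VecP.tabulate-cong (λ j → ≡.cong (if_then 1 else 0)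
      (does-⇔ (member∈brokenSet i j) (member j ∈? brokenSet i) (blk j FinP.≟ i)))))
    where
    chords : ∀ i → tabulate (λ i′ → if does (chord i′ ∈? brokenSet i) then 1 else 0) ≡ chordMon i
    chords zero = ≡.trans
      (VecP.tabulate-cong (λ i′ → ≡.cong (if_then 1 else 0)
        (dec-false (chord i′ ∈? brokenSet zero) (λ i′∈ → contradiction (proj₂ (⇒ (chord∈brokenSet zero i′) i′∈)) λ ()))))
      (tabulate-constant s 0)
    chords (suc i) = VecP.tabulate-cong (λ i′ → ≡.cong (if_then 1 else 0) (does-⇔
      (mk⇔ (proj₁ ∘ ⇒ (chord∈brokenSet (suc i) i′)) (λ q → ⇐ (chord∈brokenSet (suc i) i′) (q , s≤s z≤n)))
      (chord i′ ∈? brokenSet (suc i)) (i′ FinP.≟ suc i)))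

  monoOf-mono : ∀ {D F} → D ⊆ F → ∀ v → lookup (monoOf D) v ≤ lookup (monoOf F) v
  monoOf-mono {D} {F} D⊆F v = ≡.subst₂ _≤_ (≡.sym (lookup-monoOf D)) (≡.sym (lookup-monoOf F)) (go (e v ∈? D) (e v ∈? F))
    where
    lookup-monoOf : ∀ F → lookup (monoOf F) v ≡ (if does (e v ∈? F) then 1 else 0)
    lookup-monoOf F = VecP.lookup∘tabulate (λ v → if does (e v ∈? F) then 1 else 0) v
    go : (d : Dec (e v ∈ D)) (d′ : Dec (e v ∈ F)) → (if does d then 1 else 0) ≤ (if does d′ then 1 else 0)
    go (no _)  _       = z≤n
    go (yes _) (yes _) = ℕP.≤-refl
    go (yes x) (no ¬x) = contradiction (D⊆F x) ¬x

  nonface⇒brokenMon : ∀ F → ¬ Face F → ∃₂ λ i u → monoOf F ≡ zipWith ℕ._+_ u (brokenMon i)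
  nonface⇒brokenMon F nonface with nonface⇒brokenSet⊆ F nonface
  ... | i , D⊆F with ≤⇒summand (monoOf (brokenSet i)) (monoOf F) (monoOf-mono D⊆F)
  ...   | u , q = i , u , ≡.trans q (≡.cong (zipWith ℕ._+_ u) (monoOf-brokenSet i))

  isFundamental : Subset N → Fin N → Bool
  isFundamental C v = (toℕ v <ᵇ N ∸ r) ∧ does (C ≟S ci (e v))

  mC-just : ∀ C v → firstPos (isFundamental C) ≡ just v → mC C ≡ unitMon v ∣ bar C ∣
  mC-just C v q with firstPos (isFundamental C) | q
  ... | just _ | ≡.refl = ≡.refl

  mC-nothing : ∀ C → firstPos (isFundamental C) ≡ nothing → ∀ v →
               lookup (mC C) v ≡ count (λ w → does (e w ∈? bar C) ∧ does (d w FinP.≟ v))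
  mC-nothing C q v with firstPos (isFundamental C) | q
  ... | nothing | ≡.refl = ≡.trans
    (VecP.lookup∘tabulate (λ v → countFin (λ w → does (e w ∈? bar C) ∧ does (d w FinP.≟ v))) v)
    (countFin≡count (λ w → does (e w ∈? bar C) ∧ does (d w FinP.≟ v)))

  chordPosition-true : ∀ i → (toℕ (i ↑ˡ r) <ᵇ N ∸ r) ≡ true
  chordPosition-true i = dec-true (toℕ (i ↑ˡ r) ℕ.<? N ∸ r) (chordPosition i)

  memberPosition-false : ∀ j → (toℕ (s ↑ʳ j) <ᵇ N ∸ r) ≡ false
  memberPosition-false j = dec-false (toℕ (s ↑ʳ j) ℕ.<? N ∸ r) (ℕP.≤⇒≯ (basisPosition j))

  isFundamental-chord : ∀ C i → isFundamental C (i ↑ˡ r) ≡ does (C ≟S cut 0 (toℕ i))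
  isFundamental-chord C i = ≡.cong₂ _∧_ (chordPosition-true i) (≡.cong (λ D → does (C ≟S D)) (ci-chord i))

  isFundamental-member : ∀ C j → isFundamental C (s ↑ʳ j) ≡ false
  isFundamental-member C j = ≡.cong (_∧ does (C ≟S ci (member j))) (memberPosition-false j)

  -- The only chord of a fundamental circuit is its last one, so the end of the interval can be read
  -- off from the set.
  isFundamental-cut : ∀ a i v → isFundamental (cut a (toℕ i)) v ≡ true → v ≡ i ↑ˡ r × cut a (toℕ i) ≡ cut 0 (toℕ i)
  isFundamental-cut a i = by-position
    (λ i′ on → let q = ⇒ (does-true (cut a (toℕ i) ≟S cut 0 (toℕ i′))) (≡.trans (≡.sym (isFundamental-chord (cut a (toℕ i)) i′)) on)
               in same i′ q (⇒ (chord∈cut 0 (toℕ i′) i) (≡.subst (chord i ∈_) q (last∈cut a i))))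
    (λ j on → contradiction (≡.trans (≡.sym on) (isFundamental-member (cut a (toℕ i)) j)) λ ())
    where
    same : ∀ i′ → cut a (toℕ i) ≡ cut 0 (toℕ i′) → toℕ i ≡ toℕ i′ ⊎ suc (toℕ i) ≡ 0 →
           i′ ↑ˡ r ≡ i ↑ˡ r × cut a (toℕ i) ≡ cut 0 (toℕ i)
    same i′ q (inj₁ i≡i′) = ≡.cong (_↑ˡ r) (FinP.toℕ-injective (≡.sym i≡i′)) , ≡.trans q (≡.cong (cut 0) (≡.sym i≡i′))

  d-chord : ∀ i → d (i ↑ˡ r) ≡ i ↑ˡ r
  d-chord i rewrite chordPosition-true i = ≡.refl

  -- The chords in the cocircuit are those from the block's own index onwards, and chords come
  -- before non-chords in the ordering.
  d-member : ∀ j → d (s ↑ʳ j) ≡ blk j ↑ˡ r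
  d-member j rewrite memberPosition-false j = ≡.cong (Maybe.fromMaybe (s ↑ʳ j))
    (firstPos-just (λ v → does (e v ∈? coc (member j))) (blk j ↑ˡ r)
      (dec-true (chord (blk j) ∈? coc (member j)) (⇐ (chord∈coc j (blk j)) ℕP.≤-refl))
      (chord-below (blk j) (λ i′ lt i′∈ → ℕP.<⇒≱ lt (⇒ (chord∈coc j i′) i′∈))))

  j₀ : Fin r
  j₀ = proj₁ block₀

  0<block₀ : 1 ≤ count (inBlock zero)
  0<block₀ = count-positive j₀ (dec-true (blk j₀ FinP.≟ zero) (proj₂ block₀))

  ∣bar-fundamental∣ : ∀ i → ∣ bar (cut 0 (toℕ i)) ∣ ≡ count (λ j → does (toℕ (blk j) ℕ.≤? toℕ i))
  ∣bar-fundamental∣ i = begin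
    ∣ bar C ∣
      ≡⟨ ∣p∣≡count-permuted π (bar C) ⟩
    count (λ v → does (e v ∈? bar C))
      ≡⟨ count-↑ s (λ v → does (e v ∈? bar C)) ⟩
    count (λ i′ → does (chord i′ ∈? bar C)) ℕ.+ count (λ j → does (member j ∈? bar C))
      ≡⟨ ≡.cong₂ ℕ._+_ (count-none (λ i′ → dec-false (chord i′ ∈? bar C) (λ i′∈ → contradiction (proj₂ (⇒ (chord∈bar 0 i z≤n i′) i′∈)) λ ())))
           (count-cong (λ j → does-⇔ (mk⇔ (proj₂ ∘ ⇒ (member∈bar 0 i z≤n j)) (λ le → ⇐ (member∈bar 0 i z≤n j) (z≤n , le)))
             (member j ∈? bar C) (toℕ (blk j) ℕ.≤? toℕ i))) ⟩
    count (λ j → does (toℕ (blk j) ℕ.≤? toℕ i)) ∎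
    where
    open ≡.≡-Reasoning
    C : Subset N
    C = cut 0 (toℕ i)

  -- The broken fundamental circuit collects the non-chords of blocks `0, …, i`. For `i > 0` the
  -- nonempty block `0` makes this strictly more than block `i`; for `i = 0` the strictness is the
  -- `1` subtracted in `κ`.
  κ<∣bar-fundamental∣ : ∀ i → κ i < ∣ bar (cut 0 (toℕ i)) ∣
  κ<∣bar-fundamental∣ i = ≡.subst (κ i <_) (≡.sym (∣bar-fundamental∣ i)) (go i)
    where
    in-block : ∀ i j → inBlock i j ≡ true → does (toℕ (blk j) ℕ.≤? toℕ i) ≡ true
    in-block i j on = dec-true (toℕ (blk j) ℕ.≤? toℕ i) (ℕP.≤-reflexive (≡.cong toℕ (⇒ (does-true (blk j FinP.≟ i)) on)))
    go : ∀ i → κ i < count (λ j → does (toℕ (blk j) ℕ.≤? toℕ i))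
    go zero    = ≡.subst (_≤ count (λ j → does (toℕ (blk j) ℕ.≤? 0))) (≡.sym (ℕP.m+[n∸m]≡n 0<block₀)) (count-mono (in-block zero))
    go (suc i) = count-strict j₀ (in-block (suc i))
      (dec-false (blk j₀ FinP.≟ suc i) (λ q → contradiction (≡.trans (≡.sym (proj₂ block₀)) q) λ ()))
      (dec-true (toℕ (blk j₀) ℕ.≤? suc (toℕ i)) (≡.subst (λ b → toℕ b ≤ suc (toℕ i)) (≡.sym (proj₂ block₀)) z≤n))

  open Independence t r blk K using (BoxMon; Kills; θ-kills; multiple-kills; independent)

  -- Whenever `C` ends at `x_i`, the exponent of `x_i` in `mC C` exceeds `κ i`: by
  -- `κ<∣bar-fundamental∣` if `C` is fundamental, and otherwise because `bar C` contains `x_i` and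
  -- its block, all sent to `x_i` by `d`.
  BoxMon⇒InL : ∀ {m} → BoxMon m → InL m
  BoxMon⇒InL (u , ≡.refl , box) = by-position
      (λ i inB → contradiction inB (ℕP.<⇒≱ (chordPosition i)))
      (λ j _ → ≡.trans (VecP.lookup-++ʳ u (replicate r 0) j) (VecP.lookup-replicate j 0))
    , circuit-elim indivisible
    where
    m : Mon
    m = u ++ replicate r 0
    lookup-m : ∀ i → lookup m (i ↑ˡ r) ≤ κ i
    lookup-m i = ≡.subst (_≤ κ i) (≡.sym (VecP.lookup-++ˡ u (replicate r 0) i)) (box i)
    indivisible : ∀ a i → a ≤ toℕ i → ¬ Divides (mC (cut a (toℕ i))) m
    indivisible a i a≤i divides = cases (firstPos (isFundamental C)) ≡.refl
      where
      C : Subset N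
      C = cut a (toℕ i)
      too-large : κ i < lookup (mC C) (i ↑ˡ r) → Empty.⊥
      too-large lt = ℕP.<⇒≱ lt (ℕP.≤-trans (divides (i ↑ˡ r)) (lookup-m i))
      non-fundamental : ∀ a → a ≤ toℕ i → firstPos (isFundamental (cut a (toℕ i))) ≡ nothing →
                        κ i < lookup (mC (cut a (toℕ i))) (i ↑ˡ r)
      -- An interval from `0` is always recognised as fundamental, so this case is void and `a ≥ 1`
      -- remains.
      non-fundamental zero a≤i q = contradiction
        (≡.trans (≡.sym (firstPos-nothing⁻ (isFundamental (cut 0 (toℕ i))) q (i ↑ˡ r)))
          (≡.trans (isFundamental-chord (cut 0 (toℕ i)) i) (dec-true (cut 0 (toℕ i) ≟S cut 0 (toℕ i)) ≡.refl))) λ ()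
      non-fundamental (suc a) a<i q = ≡.subst (κ i <_) (≡.sym (≡.trans (mC-nothing D q (i ↑ˡ r)) (count-↑ s g)))
        (ℕP.+-mono-≤ (count-positive {f = λ i → g (i ↑ˡ r)} i g-chord) (ℕP.≤-trans (κ≤block i) (count-mono g-member)))
        where
        D : Subset N
        D = cut (suc a) (toℕ i)
        g : Fin N → Bool
        g w = does (e w ∈? bar D) ∧ does (d w FinP.≟ (i ↑ˡ r))
        g-chord : g (i ↑ˡ r) ≡ true
        g-chord = ≡.cong₂ _∧_ (dec-true (chord i ∈? bar D) (⇐ (chord∈bar (suc a) i a<i i) (≡.refl , s≤s z≤n)))
          (dec-true (d (i ↑ˡ r) FinP.≟ (i ↑ˡ r)) (d-chord i))
        g-member : ∀ j → inBlock i j ≡ true → g (s ↑ʳ j) ≡ true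
        g-member j on = ≡.cong₂ _∧_
            (dec-true (member j ∈? bar D) (⇐ (member∈bar (suc a) i a<i j) (ℕP.≤-trans a<i (ℕP.≤-reflexive (≡.sym q′)) , ℕP.≤-reflexive q′)))
            (dec-true (d (s ↑ʳ j) FinP.≟ (i ↑ˡ r)) (≡.trans (d-member j) (≡.cong (_↑ˡ r) j∈i)))
          where
          j∈i : blk j ≡ i
          j∈i = ⇒ (does-true (blk j FinP.≟ i)) on
          q′ : toℕ (blk j) ≡ toℕ i
          q′ = ≡.cong toℕ j∈i
        κ≤block : ∀ i → κ i ≤ count (inBlock i)
        κ≤block zero    = ℕP.m∸n≤m _ 1
        κ≤block (suc i) = ℕP.≤-refl
      cases : ∀ x → firstPos (isFundamental C) ≡ x → Empty.⊥
      cases nothing  q = too-large (non-fundamental a a≤i q)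
      cases (just v) q = too-large (≡.subst (κ i <_) (≡.sym exponent) (κ<∣bar-fundamental∣ i))
        where
        fundamental : v ≡ i ↑ˡ r × C ≡ cut 0 (toℕ i)
        fundamental = isFundamental-cut a i v (firstPos-just⁻ (isFundamental C) q)
        exponent : lookup (mC C) (i ↑ˡ r) ≡ ∣ bar (cut 0 (toℕ i)) ∣
        exponent = ≡.trans (≡.cong (λ m → lookup m (i ↑ˡ r)) (mC-just C v q))
          (≡.trans (VecP.lookup∘tabulate (λ w → if does (w FinP.≟ v) then ∣ bar C ∣ else 0) (i ↑ˡ r))
            (≡.trans (≡.cong (if_then ∣ bar C ∣ else 0) (dec-true ((i ↑ˡ r) FinP.≟ v) (≡.sym (proj₁ fundamental))))
              (≡.cong (∣_∣ ∘ bar) (proj₂ fundamental))))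

  -- The origin of `κ`: block `0` has `κ zero + 1` non-chords, while a later block has `κ i` of them
  -- and the chord `x_i` adds one.
  ∣brokenSet∣ : ∀ i → count (λ v → does (e v ∈? brokenSet i)) ≡ suc (κ i)
  ∣brokenSet∣ i = ≡.trans (count-↑ s (λ v → does (e v ∈? brokenSet i))) (≡.trans
    (≡.cong (count (λ i′ → does (chord i′ ∈? brokenSet i)) ℕ.+_)
      (count-cong (λ j → does-⇔ (member∈brokenSet i j) (member j ∈? brokenSet i) (blk j FinP.≟ i))))
    (total i))
    where
    total : ∀ i → count (λ i′ → does (chord i′ ∈? brokenSet i)) ℕ.+ count (inBlock i) ≡ suc (κ i)
    total zero = ≡.trans (≡.cong (ℕ._+ count (inBlock zero))
        (count-none (λ i′ → dec-false (chord i′ ∈? brokenSet zero) (λ i′∈ → contradiction (proj₂ (⇒ (chord∈brokenSet zero i′) i′∈)) λ ()))))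
      (≡.sym (ℕP.m+[n∸m]≡n 0<block₀))
    total (suc i) = ≡.cong (ℕ._+ count (inBlock (suc i))) (count-single (λ i′ → does (chord i′ ∈? brokenSet (suc i))) (suc i)
      (λ i′ ne → dec-false (chord i′ ∈? brokenSet (suc i)) (ne ∘ proj₁ ∘ ⇒ (chord∈brokenSet (suc i) i′)))
      (dec-true (chord (suc i) ∈? brokenSet (suc i)) (⇐ (chord∈brokenSet (suc i) (suc i)) (≡.refl , s≤s z≤n))))

  d-brokenSet : ∀ i v → e v ∈ brokenSet i → d v ≡ i ↑ˡ r
  d-brokenSet i = by-position
    (λ i′ i′∈ → ≡.trans (d-chord i′) (≡.cong (_↑ˡ r) (proj₁ (⇒ (chord∈brokenSet i i′) i′∈))))
    (λ j j∈ → ≡.trans (d-member j) (≡.cong (_↑ˡ r) (⇒ (member∈brokenSet i j) j∈)))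

  -- For a single polygon `mC` is `x_i^(κ_i + 1)`: by definition for `E_0`, which is a fundamental
  -- circuit, and for the others because `d` sends the whole broken circuit to `x_i`.
  mC-divides : ∀ i m → κ i < lookup m (i ↑ˡ r) → Divides (mC (cut (toℕ i) (toℕ i))) m
  mC-divides zero m lt v = ≡.subst (_≤ lookup m v)
    (≡.sym (≡.trans (≡.cong (λ m → lookup m v) (mC-just C zero fundamental))
      (VecP.lookup∘tabulate (λ w → if does (w FinP.≟ zero) then ∣ bar C ∣ else 0) v))) (bound v)
    where
    C : Subset N
    C = cut 0 0
    fundamental : firstPos (isFundamental C) ≡ just zero
    fundamental = firstPos-just (isFundamental C) zero
      (≡.trans (isFundamental-chord C zero) (dec-true (C ≟S C) ≡.refl)) λ _ ()
    bound : ∀ v → (if does (v FinP.≟ zero) then ∣ bar C ∣ else 0) ≤ lookup m v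
    bound zero    = ℕP.≤-trans (ℕP.≤-reflexive (≡.trans (∣p∣≡count-permuted π (bar C)) (∣brokenSet∣ zero))) lt
    bound (suc v) = z≤n
  mC-divides (suc i) m lt v = ≡.subst (_≤ lookup m v) (≡.sym (mC-nothing C non-fundamental v)) bound
    where
    C : Subset N
    C = cut (toℕ (suc i)) (toℕ (suc i))
    non-fundamental : firstPos (isFundamental C) ≡ nothing
    -- A later polygon contains the preceding chord as well, whereas a fundamental circuit has only
    -- its last chord.
    non-fundamental = firstPos-nothing (isFundamental C) λ v → BoolP.¬-not λ on →
      preceding (≡.subst (chord (inject₁ i) ∈_) (proj₂ (isFundamental-cut (toℕ (suc i)) (suc i) v on))
        (⇐ (chord∈cut _ _ (inject₁ i)) (inj₂ (≡.cong suc (FinP.toℕ-inject₁ i)))))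
      where
      preceding : chord (inject₁ i) ∉ cut 0 (toℕ (suc i))
      preceding i∈ with ⇒ (chord∈cut 0 (toℕ (suc i)) (inject₁ i)) i∈
      ... | inj₁ q = ℕP.1+n≢n (≡.trans (≡.sym q) (FinP.toℕ-inject₁ i))
    both : ∀ w → (does (e w ∈? bar C) ∧ does (d w FinP.≟ v)) ≡ true → e w ∈ bar C × d w ≡ v
    both w = ⇒ (does-true ((e w ∈? bar C) ×-dec (d w FinP.≟ v)))
    bound : count (λ w → does (e w ∈? bar C) ∧ does (d w FinP.≟ v)) ≤ lookup m v
    bound with v FinP.≟ (suc i ↑ˡ r)
    ... | yes ≡.refl = ℕP.≤-trans
      (count-mono {g = λ w → does (e w ∈? bar C)} (λ w on → dec-true (e w ∈? bar C) (proj₁ (both w on))))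
      (ℕP.≤-trans (ℕP.≤-reflexive (∣brokenSet∣ (suc i))) lt)
    ... | no v≢i = ℕP.≤-trans (ℕP.≤-reflexive (count-none (λ w → BoolP.¬-not λ on →
      v≢i (≡.trans (≡.sym (proj₂ (both w on))) (d-brokenSet (suc i) w (proj₁ (both w on))))))) z≤n

  InL⇒BoxMon : ∀ {m} → InL m → BoxMon m
  InL⇒BoxMon {m} (zeros , indivisible) = tabulate (λ i → lookup m (i ↑ˡ r))
    , ≡.trans (≡.sym (VecP.tabulate∘lookup m)) (≡.trans (tabulate-↑ s (lookup m))
        (≡.cong (tabulate (λ i → lookup m (i ↑ˡ r)) ++_)
          (≡.trans (VecP.tabulate-cong (λ j → zeros (s ↑ʳ j) (basisPosition j))) (tabulate-constant r 0))))
    , λ i → ≡.subst (_≤ κ i) (≡.sym (VecP.lookup∘tabulate (λ i → lookup m (i ↑ˡ r)) i))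
        (ℕP.≮⇒≥ (λ lt → indivisible _ (circuit (toℕ i) i ℕP.≤-refl) (mC-divides i m lt)))

  -- The first chord of cut (i₀ + 1) i, which is x_{i₀}, has sign opposite to all other elements.
  later? : ∀ C (i : Fin s) → Dec (∃ λ i′ → toℕ i < toℕ i′ × chord i′ ∈ C)
  later? C i = FinP.any? (λ i′ → (toℕ i ℕ.<? toℕ i′) ×-dec (chord i′ ∈? C))

  signIn : Subset N → Fin s ⊎ Fin r → Sign
  signIn C (inj₁ i) = if does (later? C i) then neg else pos
  signIn C (inj₂ j) = pos

  orientation : Subset N → Fin N → Sign
  orientation C v = if does (e v ∈? C) then signIn C (splitAt s v) else zer

  signIn-nonzero : ∀ C x → signIn C x ≢ zer
  signIn-nonzero C (inj₁ i) with does (later? C i)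
  ... | true  = λ ()
  ... | false = λ ()
  signIn-nonzero C (inj₂ j) = λ ()

  orientation-nonzero : ∀ C v → orientation C v ≢ zer ⇔ e v ∈ C
  orientation-nonzero C v with e v ∈? C
  ... | yes v∈C = mk⇔ (λ _ → v∈C) (λ _ → signIn-nonzero C (splitAt s v))
  ... | no  v∉C = mk⇔ (λ ne → contradiction ≡.refl ne) (λ v∈C → contradiction v∈C v∉C)

  open Field K hiding (zero; refl)
  open Sums +-commutativeMonoid
  open RingProperties ring using (-0#≈0#; -‿distribʳ-*; -‿involutive)

  bit : Bool → Carrier
  bit b = if b then 1# else 0#

  -- As a difference of two indicators, the sign makes the sum over chords split into two sums with
  -- at most one nonzero term each, at the end and at the start of the interval.
  orientation-chord : ∀ a i → a ≤ toℕ i → ∀ i′ →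
    ⟦ orientation (cut a (toℕ i)) (i′ ↑ˡ r) ⟧ ≈ bit (does (i′ FinP.≟ i)) + - bit (does (suc (toℕ i′) ℕ.≟ a))
  orientation-chord a i a≤i i′ = cases (chord i′ ∈? C)
    where
    C : Subset N
    C = cut a (toℕ i)
    value : Bool → Sign
    value b = if b then signIn C (splitAt s (i′ ↑ˡ r)) else zer
    difference : ∀ {b b′} → does (i′ FinP.≟ i) ≡ b → does (suc (toℕ i′) ℕ.≟ a) ≡ b′ →
                 bit (does (i′ FinP.≟ i)) + - bit (does (suc (toℕ i′) ℕ.≟ a)) ≈ bit b + - bit b′
    difference q q′ = reflexive (≡.cong₂ (λ b b′ → bit b + - bit b′) q q′)
    inside-value : chord i′ ∈ C → orientation C (i′ ↑ˡ r) ≡ (if does (later? C i′) then neg else pos)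
    inside-value i′∈ = ≡.trans (≡.cong value (dec-true (chord i′ ∈? C) i′∈)) (≡.cong (signIn C) (FinP.splitAt-↑ˡ s i′ r))
    cases : Dec (chord i′ ∈ C) → ⟦ orientation C (i′ ↑ˡ r) ⟧ ≈ bit (does (i′ FinP.≟ i)) + - bit (does (suc (toℕ i′) ℕ.≟ a))
    cases (no i′∉) = trans (reflexive (≡.cong (⟦_⟧ ∘ value) (dec-false (chord i′ ∈? C) i′∉)))
      (sym (trans (difference (dec-false (i′ FinP.≟ i) (λ q → i′∉ (⇐ (chord∈cut a _ i′) (inj₁ (≡.cong toℕ q)))))
                              (dec-false (suc (toℕ i′) ℕ.≟ a) (λ q → i′∉ (⇐ (chord∈cut a _ i′) (inj₂ q)))))
        (-‿inverseʳ 0#)))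
    cases (yes i′∈) with ⇒ (chord∈cut a (toℕ i) i′) i′∈
    ... | inj₁ q = trans (reflexive (≡.cong ⟦_⟧ (≡.trans (inside-value i′∈) (≡.cong (if_then neg else pos) (dec-false (later? C i′) none)))))
        (sym (trans (difference (dec-true (i′ FinP.≟ i) (FinP.toℕ-injective q)) (dec-false (suc (toℕ i′) ℕ.≟ a) ≢a))
          (trans (+-congˡ -0#≈0#) (+-identityʳ 1#))))
      where
      ≢a : suc (toℕ i′) ≢ a
      ≢a q′ = ℕP.1+n≰n (≡.subst₂ _≤_ (≡.trans (≡.sym q′) (≡.cong suc q)) ≡.refl a≤i)
      none : ¬ ∃ λ i″ → toℕ i′ < toℕ i″ × chord i″ ∈ C
      none (i″ , lt , i″∈) with ⇒ (chord∈cut a (toℕ i) i″) i″∈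
      ... | inj₁ q″ = ℕP.<⇒≢ lt (≡.trans q (≡.sym q″))
      ... | inj₂ q″ = ℕP.<⇒≱ lt (ℕP.≤-trans (ℕP.n≤1+n _) (ℕP.≤-trans (ℕP.≤-reflexive q″) (ℕP.≤-trans a≤i (ℕP.≤-reflexive (≡.sym q)))))
    ... | inj₂ q = trans (reflexive (≡.cong ⟦_⟧ (≡.trans (inside-value i′∈) (≡.cong (if_then neg else pos)
            (dec-true (later? C i′) (i , i′<i , last∈cut a i))))))
        (sym (trans (difference (dec-false (i′ FinP.≟ i) (λ { ≡.refl → ℕP.<-irrefl ≡.refl i′<i })) (dec-true (suc (toℕ i′) ℕ.≟ a) q))
          (+-identityˡ (- 1#))))
      where
      i′<i : toℕ i′ < toℕ i
      i′<i = ≡.subst (_≤ toℕ i) (≡.sym q) a≤i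

  orientation-member : ∀ C j → ⟦ orientation C (s ↑ʳ j) ⟧ ≡ bit (does (member j ∈? C))
  orientation-member C j rewrite FinP.splitAt-↑ʳ s r j with does (member j ∈? C)
  ... | true  = ≡.refl
  ... | false = ≡.refl

  pathSign-value : ∀ {n} (b i : Fin n) → ⟦ pathSign b i ⟧ ≈ - bit (does (toℕ b ℕ.≤? toℕ i))
  pathSign-value b i = cases (toℕ b ℕ.≤? toℕ i)
    where
    cases : Dec (toℕ b ≤ toℕ i) → ⟦ pathSign b i ⟧ ≈ - bit (does (toℕ b ℕ.≤? toℕ i))
    cases (yes le) = reflexive (≡.trans (≡.cong ⟦_⟧ (pathSign-≤ b i le))
      (≡.cong (-_ ∘ bit) (≡.sym (dec-true (toℕ b ℕ.≤? toℕ i) le))))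
    cases (no ¬le) = trans (reflexive (≡.cong ⟦_⟧ (pathSign-> b i (ℕP.≰⇒> ¬le))))
      (trans (sym -0#≈0#) (reflexive (≡.cong (-_ ∘ bit) (≡.sym (dec-false (toℕ b ℕ.≤? toℕ i) ¬le)))))

  sumK-tabulate : ∀ {n} (f : Fin n → Carrier) → sumK (map f (allFin n)) ≡ sum f
  sumK-tabulate {n} f = go (λ i → i)
    where
    go : ∀ {m} (g : Fin m → Fin n) → sumK (map f (List.tabulate g)) ≡ sum (f ∘ g)
    go {zero}  g = ≡.refl
    go {suc m} g = ≡.cong (f (g zero) +_) (go (g ∘ suc))

  *-bit-false : ∀ {x b} → b ≡ false → x * bit b ≈ 0#
  *-bit-false ≡.refl = zeroʳ _

  *-bit-true : ∀ {x b} → b ≡ true → x * bit b ≈ x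
  *-bit-true ≡.refl = *-identityʳ _

  -- The path b, b + 1, …, t leaves the interval [a, i] at the chord x_i and enters it at x_{a-1}.
  path-crossings : ∀ a i → a ≤ toℕ i → ∀ b →
    sum (λ i′ → ⟦ pathSign b i′ ⟧ * ⟦ orientation (cut a (toℕ i)) (i′ ↑ˡ r) ⟧)
      ≈ - bit (does (toℕ b ℕ.≤? toℕ i)) + bit (does (suc (toℕ b) ℕ.≤? a))
  path-crossings a i a≤i b = begin
    sum (λ i′ → P i′ * ⟦ orientation (cut a (toℕ i)) (i′ ↑ˡ r) ⟧)
      ≈⟨ sum-cong-≋ (λ i′ → trans (*-congˡ (orientation-chord a i a≤i i′)) (distribˡ (P i′) _ _)) ⟩
    sum (λ i′ → P i′ * bit (does (i′ FinP.≟ i)) + P i′ * - bit (does (suc (toℕ i′) ℕ.≟ a)))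
      ≈⟨ ∑-distrib-+ (λ i′ → P i′ * bit (does (i′ FinP.≟ i))) (λ i′ → P i′ * - bit (does (suc (toℕ i′) ℕ.≟ a))) ⟩
    sum (λ i′ → P i′ * bit (does (i′ FinP.≟ i))) + sum (λ i′ → P i′ * - bit (does (suc (toℕ i′) ℕ.≟ a)))
      ≈⟨ +-cong exit (entry a a≤i) ⟩
    - bit (does (toℕ b ℕ.≤? toℕ i)) + bit (does (suc (toℕ b) ℕ.≤? a)) ∎
    where
    open import Relation.Binary.Reasoning.Setoid setoid
    P : Fin s → Carrier
    P i′ = ⟦ pathSign b i′ ⟧
    exit : sum (λ i′ → P i′ * bit (does (i′ FinP.≟ i))) ≈ - bit (does (toℕ b ℕ.≤? toℕ i))
    exit = trans (sum-single i (λ i′ ne → *-bit-false {P i′} (dec-false (i′ FinP.≟ i) ne)))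
      (trans (*-bit-true (dec-true (i FinP.≟ i) ≡.refl)) (pathSign-value b i))
    vanish : ∀ {x b} → b ≡ false → x * - bit b ≈ 0#
    vanish ≡.refl = trans (*-congˡ -0#≈0#) (zeroʳ _)
    entry : ∀ a → a ≤ toℕ i → sum (λ i′ → P i′ * - bit (does (suc (toℕ i′) ℕ.≟ a))) ≈ bit (does (suc (toℕ b) ℕ.≤? a))
    entry zero    a≤i = sum-zero (λ i′ → vanish {P i′} (dec-false (suc (toℕ i′) ℕ.≟ 0) λ ()))
    entry (suc a) a<i with lastChord (ℕP.≤-trans (ℕP.<⇒≤ a<i) (ℕP.≤-pred (FinP.toℕ<n i)))
    ... | i₀ , ≡.refl = trans
      (sum-single i₀ (λ i′ ne → vanish {P i′} (dec-false (suc (toℕ i′) ℕ.≟ suc (toℕ i₀)) (ne ∘ FinP.toℕ-injective ∘ ℕP.suc-injective))))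
      (trans (sym (-‿distribʳ-* (P i₀) _)) (trans
        (-‿cong (trans (*-bit-true (dec-true (suc (toℕ i₀) ℕ.≟ suc (toℕ i₀)) ≡.refl)) (pathSign-value b i₀)))
        (trans (-‿involutive _) (reflexive (≡.cong bit (does-⇔ (mk⇔ s≤s ℕP.≤-pred)
          (toℕ b ℕ.≤? toℕ i₀) (suc (toℕ b) ℕ.≤? suc (toℕ i₀))))))))

  admissible : Admissible
  admissible = orientation , (λ C _ v → orientation-nonzero C v)
    , λ C circ → by-position
        (λ i inB → contradiction inB (ℕP.<⇒≱ (chordPosition i)))
        (λ j _ → circuit-elim {P = λ C → sumK (map (λ w → ⟦ signs (s ↑ʳ j) w ⟧ * ⟦ orientation C w ⟧) (allFin N)) ≈ 0#}
          (orthogonal j) C circ)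
    where
    open import Relation.Binary.Reasoning.Setoid setoid
    orthogonal : ∀ j a i → a ≤ toℕ i →
      sumK (map (λ w → ⟦ signs (s ↑ʳ j) w ⟧ * ⟦ orientation (cut a (toℕ i)) w ⟧) (allFin N)) ≈ 0#
    orthogonal j a i a≤i = begin
      sumK (map term (allFin N))
        ≡⟨ sumK-tabulate term ⟩
      sum term
        ≈⟨ sum-↑ s term ⟩
      sum (λ i′ → term (i′ ↑ˡ r)) + sum (λ j′ → term (s ↑ʳ j′))
        ≈⟨ +-cong (trans (sum-cong-≋ chord-term) (path-crossings a i a≤i (blk j)))
                  (trans (sum-single j off-diagonal) diagonal) ⟩
      (- bit (does (toℕ (blk j) ℕ.≤? toℕ i)) + bit (does (suc (toℕ (blk j)) ℕ.≤? a))) + bit (does (member j ∈? C))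
        ≈⟨ cancel (toℕ (blk j) ℕ.≤? toℕ i) (suc (toℕ (blk j)) ℕ.≤? a) (member j ∈? C) ⟩
      0# ∎
      where
      C : Subset N
      C = cut a (toℕ i)
      term : Fin N → Carrier
      term w = ⟦ signs (s ↑ʳ j) w ⟧ * ⟦ orientation C w ⟧
      τ : Fin N → Carrier
      τ w = ⟦ orientation C w ⟧
      chord-term : ∀ i′ → term (i′ ↑ˡ r) ≈ ⟦ pathSign (blk j) i′ ⟧ * τ (i′ ↑ˡ r)
      chord-term i′ = reflexive (≡.cong (λ σ → ⟦ σ ⟧ * τ (i′ ↑ˡ r)) (signs-chord j i′))
      member-term : ∀ j′ {b} → does (j′ FinP.≟ j) ≡ b → term (s ↑ʳ j′) ≈ ⟦ if b then pos else zer ⟧ * τ (s ↑ʳ j′)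
      member-term j′ q = reflexive (≡.cong (λ σ → ⟦ σ ⟧ * τ (s ↑ʳ j′))
        (≡.trans (signs-member j j′) (≡.cong (if_then pos else zer) q)))
      off-diagonal : ∀ j′ → j′ ≢ j → term (s ↑ʳ j′) ≈ 0#
      off-diagonal j′ ne = trans (member-term j′ (dec-false (j′ FinP.≟ j) ne)) (zeroˡ _)
      diagonal : term (s ↑ʳ j) ≈ bit (does (member j ∈? C))
      diagonal = trans (member-term j (dec-true (j FinP.≟ j) ≡.refl))
        (trans (*-identityˡ _) (reflexive (orientation-member C j)))
      -- Since `a ≤ i`, the indicator of `a ≤ blk j ≤ i` is that of `blk j ≤ i` minus that of
      -- `blk j < a`; the remaining combinations of decisions are contradictory.
      cancel : (x : Dec (toℕ (blk j) ≤ toℕ i)) (y : Dec (suc (toℕ (blk j)) ≤ a)) (z : Dec (member j ∈ C)) →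
               (- bit (does x) + bit (does y)) + bit (does z) ≈ 0#
      cancel (yes x) (yes y) (yes z) = contradiction (ℕP.≤-trans y (proj₁ (⇒ (member∈cut a _ j) z))) ℕP.1+n≰n
      cancel (yes x) (yes y) (no ¬z) = trans (+-identityʳ _) (-‿inverseˡ 1#)
      cancel (yes x) (no ¬y) (yes z) = trans (+-congʳ (+-identityʳ _)) (-‿inverseˡ 1#)
      cancel (yes x) (no ¬y) (no ¬z) = contradiction (⇐ (member∈cut a _ j) (ℕP.≤-pred (ℕP.≰⇒> ¬y) , x)) ¬z
      cancel (no ¬x) (yes y) z       = contradiction (ℕP.≤-trans (ℕP.<⇒≤ y) a≤i) ¬x
      cancel (no ¬x) (no ¬y) (yes z) = contradiction (proj₂ (⇒ (member∈cut a _ j) z)) ¬x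
      cancel (no ¬x) (no ¬y) (no ¬z) = trans (+-identityʳ _) (trans (+-identityʳ _) -0#≈0#)

  open Theta K using (θ-form-≡)
  open SpanningProof t r blk K Gen using (spanning)

  generator-kills : ∀ {g} → Gen g → Kills g
  generator-kills (inj₁ (F , nonface , g≡)) = let (i , w , F≡) = nonface⇒brokenMon F nonface in
    ≡.subst Kills (≡.sym (≡.trans g≡ (≡.cong (λ m → (1# , m) ∷ []) F≡))) (multiple-kills 0<block₀ w i)
  generator-kills (inj₂ (v , inB , g≡)) = by-position {P = λ v → InB v → ∀ {g} → g ≡ θ v → Kills g}
    (λ i inB → contradiction inB (ℕP.<⇒≱ (chordPosition i)))
    (λ j _ g≡ → ≡.subst Kills (≡.trans (θ-form-≡ (s ↑ʳ j)) (≡.sym g≡)) (θ-kills j))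
    v inB g≡

  hasNBCBasis : HasNBCBasis K Circ
  hasNBCBasis = π , r , ℕP.m≤n+m r s , basis-isBasis , coc , ci , signs
    , by-position (λ i inB → contradiction inB (ℕP.<⇒≱ (chordPosition i)))
                  (λ j _ → coc-isCocircuit j , coc⊆ j)
    , by-position (λ i _ → ≡.subst (λ C → Circ C × C ⊆ (basis ∪ ⁅ chord i ⁆)) (≡.sym (ci-chord i)) (circuit 0 i z≤n , ci⊆ i))
                  (λ j outB → contradiction (basisPosition j) outB)
    , (λ v _ w → mk⇔ (⇐ (∈coc v w)) (⇒ (∈coc v w)))
    , admissible
    , spans
    , λ q inL unique ideal → independent generator-kills q (All.map InL⇒BoxMon inL) unique ideal
    where
    spans : Spanning
    spans p = let (q , boxed , p~q) = spanning
                    (λ j → inj₂ (s ↑ʳ j , basisPosition j , θ-form-≡ (s ↑ʳ j)))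
                    (λ i → inj₁ (brokenSet i , brokenSet-nonface i , ≡.cong (λ m → (1# , m) ∷ []) (≡.sym (monoOf-brokenSet i))))
                    0<block₀ p
              in q , All.map BoxMon⇒InL boxed , p~q

-- The parallel connection

open import Data.Nat using (_+_)
open import Data.Fin using () renaming (suc to fsuc)
open import Data.Fin.Subset using (⊥)

module Polygons {N t : ℕ} (E : Fin (suc t) → Subset N) (n : Fin (suc t) → ℕ) (p : Fin t → Fin N)
  (2≤n : ∀ i → 2 ≤ n i) (∣E∣ : ∀ i → ∣ E i ∣ ≡ n i)
  (adjacent : ∀ k → E (inject₁ k) ∩ E (fsuc k) ≡ ⁅ p k ⁆) (p-injective : Injective _≡_ _≡_ p)
  (distant : ∀ i j → toℕ i + 2 ≤ toℕ j → E i ∩ E j ≡ ⊥)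
  (cover : ∀ x → ∃ λ i → x ∈ E i) where

  2≤∣E∣ : ∀ i → 2 ≤ ∣ E i ∣
  2≤∣E∣ i = ≡.subst (2 ≤_) (≡.sym (∣E∣ i)) (2≤n i)

  p∈ : ∀ k → p k ∈ E (inject₁ k) × p k ∈ E (fsuc k)
  p∈ k = SubsetP.x∈p∩q⁻ (E (inject₁ k)) (E (fsuc k)) (≡.subst (p k ∈_) (≡.sym (adjacent k)) (SubsetP.x∈⁅x⁆ (p k)))

  -- Polygons at distance two or more are disjoint, so the two are consecutive and meet in `p k`
  -- alone.
  shared : ∀ {x} i j → x ∈ E i → x ∈ E j → toℕ i < toℕ j → ∃ λ k → i ≡ inject₁ k × j ≡ fsuc k × x ≡ p k
  shared {x} i (fsuc k) x∈i x∈j (s≤s i≤k) with ℕP.m≤n⇒m<n∨m≡n i≤k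
  ... | inj₁ i<k = contradiction
    (≡.subst (x ∈_) (distant i (fsuc k) (≡.subst (_≤ suc (toℕ k)) (ℕP.+-comm 2 (toℕ i)) (s≤s i<k))) (SubsetP.x∈p∩q⁺ (x∈i , x∈j)))
    SubsetP.∉⊥
  ... | inj₂ i≡k with FinP.toℕ-injective (≡.trans i≡k (≡.sym (FinP.toℕ-inject₁ k)))
  ...   | ≡.refl = k , ≡.refl , ≡.refl , SubsetP.x∈⁅y⁆⇒x≡y (p k) (≡.subst (x ∈_) (adjacent k) (SubsetP.x∈p∩q⁺ (x∈i , x∈j)))

  -- The last chord `x_t` is not a gluing element and has to be chosen. At most the last `p k` lies
  -- in the last polygon, which has at least two elements.
  lastElement : ∃ λ z → z ∈ E (fromℕ t) × ∀ k → z ≢ p k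
  lastElement = go t E p (2≤∣E∣ (fromℕ t)) shared p∈
    where
    go : ∀ t (E : Fin (suc t) → Subset N) (p : Fin t → Fin N) → 2 ≤ ∣ E (fromℕ t) ∣ →
         (∀ {x} i j → x ∈ E i → x ∈ E j → toℕ i < toℕ j → ∃ λ k → i ≡ inject₁ k × j ≡ fsuc k × x ≡ p k) →
         (∀ k → p k ∈ E (inject₁ k) × p k ∈ E (fsuc k)) →
         ∃ λ z → z ∈ E (fromℕ t) × ∀ k → z ≢ p k
    go zero    E p 2≤E shared p∈ with 0<∣p∣⇒Nonempty (E zero) (ℕP.<⇒≤ 2≤E)
    ... | z , z∈ = z , z∈ , λ ()
    go (suc t) E p 2≤E shared p∈ with another-element (E (fromℕ (suc t))) 2≤E (p (fromℕ t))
    ... | z , z∈ , z≢ = z , z∈ , λ { k ≡.refl → z≢ (last k (shared (inject₁ k) (fromℕ (suc t)) (proj₁ (p∈ k)) z∈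
            (≡.subst₂ _<_ (≡.sym (FinP.toℕ-inject₁ k)) (≡.sym (FinP.toℕ-fromℕ (suc t))) (FinP.toℕ<n k)))) }
      where
      last : ∀ {x} k → (∃ λ k′ → inject₁ k ≡ inject₁ k′ × fromℕ (suc t) ≡ fsuc k′ × x ≡ p k′) → x ≡ p (fromℕ t)
      last k (k′ , _ , q , x≡) = ≡.trans x≡ (≡.cong p (≡.sym (FinP.suc-injective q)))

  z : Fin N
  z = proj₁ lastElement

  chordElement : Fin (suc t) → Fin N
  chordElement i with view i
  ... | ‵fromℕ     = z
  ... | ‵inject₁ k = p k

  chordElement-inject₁ : ∀ k → chordElement (inject₁ k) ≡ p k
  chordElement-inject₁ k rewrite view-inject₁ k = ≡.refl

  chordElement-injective : Injective _≡_ _≡_ chordElement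
  chordElement-injective {i} {j} q with view i | view j
  ... | ‵fromℕ     | ‵fromℕ     = ≡.refl
  ... | ‵fromℕ     | ‵inject₁ k = contradiction q (proj₂ (proj₂ lastElement) k)
  ... | ‵inject₁ k | ‵fromℕ     = contradiction (≡.sym q) (proj₂ (proj₂ lastElement) k)
  ... | ‵inject₁ k | ‵inject₁ l = ≡.cong inject₁ (p-injective q)

  chordElement∈ : ∀ l i → chordElement l ∈ E i ⇔ (toℕ i ≡ toℕ l ⊎ toℕ i ≡ suc (toℕ l))
  chordElement∈ l i with view l
  ... | ‵fromℕ = mk⇔ forward backward
    where
    forward : z ∈ E i → toℕ i ≡ toℕ (fromℕ t) ⊎ toℕ i ≡ suc (toℕ (fromℕ t))
    forward z∈ with ℕP.m≤n⇒m<n∨m≡n (ℕP.≤-trans (ℕP.≤-pred (FinP.toℕ<n i)) (ℕP.≤-reflexive (≡.sym (FinP.toℕ-fromℕ t))))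
    ... | inj₂ q = inj₁ q
    ... | inj₁ i<t with shared i (fromℕ t) z∈ (proj₁ (proj₂ lastElement)) i<t
    ...   | k , _ , _ , z≡ = contradiction z≡ (proj₂ (proj₂ lastElement) k)
    backward : toℕ i ≡ toℕ (fromℕ t) ⊎ toℕ i ≡ suc (toℕ (fromℕ t)) → z ∈ E i
    backward (inj₁ q) = ≡.subst (λ i → z ∈ E i) (≡.sym (FinP.toℕ-injective q)) (proj₁ (proj₂ lastElement))
    backward (inj₂ q) = contradiction (≡.trans q (≡.cong suc (FinP.toℕ-fromℕ t))) (ℕP.<⇒≢ (FinP.toℕ<n i))
  ... | ‵inject₁ k = mk⇔ forward backward
    where
    forward : p k ∈ E i → toℕ i ≡ toℕ (inject₁ k) ⊎ toℕ i ≡ suc (toℕ (inject₁ k))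
    forward k∈ with ℕP.<-cmp (toℕ i) (toℕ (inject₁ k))
    ... | tri≈ _ q _ = inj₁ q
    ... | tri< i<k _ _ with shared i (fsuc k) k∈ (proj₂ (p∈ k)) (ℕP.m≤n⇒m≤1+n (≡.subst (toℕ i <_) (FinP.toℕ-inject₁ k) i<k))
    ...   | _ , i≡ , ≡.refl , _ = inj₁ (≡.cong toℕ i≡)
    forward k∈ | tri> _ _ k<i with shared (inject₁ k) i (proj₁ (p∈ k)) k∈ k<i
    ...   | _ , k≡ , i≡ , _ = inj₂ (≡.trans (≡.cong toℕ i≡) (≡.cong suc
              (≡.trans (≡.sym (FinP.toℕ-inject₁ _)) (≡.cong toℕ (≡.sym k≡)))))
    backward : toℕ i ≡ toℕ (inject₁ k) ⊎ toℕ i ≡ suc (toℕ (inject₁ k)) → p k ∈ E i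
    backward (inj₁ q) = ≡.subst (λ i → p k ∈ E i) (≡.sym (FinP.toℕ-injective q)) (proj₁ (p∈ k))
    backward (inj₂ q) = ≡.subst (λ i → p k ∈ E i)
      (≡.sym (FinP.toℕ-injective (≡.trans q (≡.cong suc (FinP.toℕ-inject₁ k))))) (proj₂ (p∈ k))

module _ {t r : ℕ} (E : Fin (suc t) → Subset (suc t + r)) (n : Fin (suc t) → ℕ) (p : Fin t → Fin (suc t + r))
  (2≤n : ∀ i → 2 ≤ n i) (∣E∣ : ∀ i → ∣ E i ∣ ≡ n i)
  (adjacent : ∀ k → E (inject₁ k) ∩ E (fsuc k) ≡ ⁅ p k ⁆) (p-injective : Injective _≡_ _≡_ p)
  (distant : ∀ i j → toℕ i + 2 ≤ toℕ j → E i ∩ E j ≡ ⊥)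
  (cover : ∀ x → ∃ λ i → x ∈ E i) where

  open Polygons E n p 2≤n ∣E∣ adjacent p-injective distant cover

  private
    ordering : ∃ λ (π : Fin (suc t + r) ↔ Fin (suc t + r)) → ∀ i → Inverse.to π (i ↑ˡ r) ≡ chordElement i
    ordering = extend-injection (suc t) chordElement chordElement-injective

    π : Fin (suc t + r) ↔ Fin (suc t + r)
    π = proj₁ ordering

    block : Fin r → Fin (suc t)
    block j = proj₁ (cover (Inverse.to π (suc t ↑ʳ j)))

  open Broken t r block π

  chord≡ : ∀ i → chord i ≡ chordElement i
  chord≡ = proj₂ ordering

  chord≡p : ∀ k → chord (inject₁ k) ≡ p k
  chord≡p k = ≡.trans (chord≡ (inject₁ k)) (chordElement-inject₁ k)

  -- An element of two polygons is some `p k` and hence a chord, so the polygon picked by `cover` is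
  -- the only one containing a given non-chord.
  member∈E : ∀ j i → member j ∈ E i ⇔ toℕ i ≡ toℕ (block j)
  member∈E j i = mk⇔ forward λ q → ≡.subst (λ i → member j ∈ E i) (≡.sym (FinP.toℕ-injective q)) j∈
    where
    j∈ : member j ∈ E (block j)
    j∈ = proj₂ (cover (member j))
    not-chord : (∃ λ k → member j ≡ p k) → member j ∈ E i → toℕ i ≡ toℕ (block j)
    not-chord (k , q) _ = contradiction (≡.trans (chord≡p k) (≡.sym q)) (chord≢member {inject₁ k} {j})
    forward : member j ∈ E i → toℕ i ≡ toℕ (block j)
    forward j∈i with ℕP.<-cmp (toℕ i) (toℕ (block j))
    ... | tri≈ _ q _ = q
    ... | tri< lt _ _ = let (k , _ , _ , q) = shared i (block j) j∈i j∈ lt in not-chord (k , q) j∈i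
    ... | tri> _ _ gt = let (k , _ , _ , q) = shared (block j) i j∈ j∈i gt in not-chord (k , q) j∈i

  ∈E : ∀ i x → x ∈ E i ⇔ LiesIn (toℕ i) (kind x)
  ∈E i = by-element
    (λ l → ≡.subst₂ (λ x k → x ∈ E i ⇔ LiesIn (toℕ i) k) (≡.sym (chord≡ l)) (≡.sym (kind-chord l)) (chordElement∈ l i))
    (λ j → ≡.subst (λ k → member j ∈ E i ⇔ LiesIn (toℕ i) k) (≡.sym (kind-member j)) (member∈E j i))

  kind-p : ∀ k x → x ≡ p k ⇔ kind x ≡ inj₁ (toℕ k)
  kind-p k x = mk⇔
    (λ { ≡.refl → ≡.trans (≡.cong kind (≡.sym (chord≡p k))) (≡.trans (kind-chord (inject₁ k)) (≡.cong inj₁ (FinP.toℕ-inject₁ k))) })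
    (by-element {P = λ x → kind x ≡ inj₁ (toℕ k) → x ≡ p k}
      (λ i q → ≡.trans (≡.cong chord (FinP.toℕ-injective (≡.trans
          (inj₁-injective (≡.trans (≡.sym (kind-chord i)) q)) (≡.sym (FinP.toℕ-inject₁ k))))) (chord≡p k))
      (λ j q → contradiction (≡.trans (≡.sym (kind-member j)) q) λ ()) x)

  -- `E_0` has at least two elements, and `x_0` is the only chord among them. That the block is
  -- nonempty makes the subtraction in `κ zero` exact.
  block-zero : ∃ λ j → block j ≡ zero
  block-zero with another-element (E zero) (2≤∣E∣ zero) (chord zero)
  ... | y , y∈ , y≢ = by-element {P = λ y → y ∈ E zero → y ≢ chord zero → ∃ λ j → block j ≡ zero}
    (λ i i∈ i≢ → contradiction (≡.cong chord (only-zero i (⇒ (chordElement∈ i zero) (≡.subst (_∈ E zero) (chord≡ i) i∈)))) i≢)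
    (λ j j∈ _ → j , FinP.toℕ-injective (≡.sym (⇒ (member∈E j zero) j∈))) y y∈ y≢
    where
    only-zero : ∀ i → 0 ≡ toℕ i ⊎ 0 ≡ suc (toℕ i) → i ≡ zero
    only-zero i (inj₁ q) = FinP.toℕ-injective (≡.sym q)

  parChain-hasNBCBasis : ∀ {c ℓ} (K : Field c ℓ) → HasNBCBasis K (parChain (λ i → UCirc (E i) (n i ∸ 1)) p)
  parChain-hasNBCBasis = NBCBasis.hasNBCBasis t r block π _
    (parChain-circuits kind E n p ∣E∣ (λ i → ℕP.<⇒≤ (2≤n i)) ∈E kind-p) block-zero

theorem5p8 : ∀ {c ℓ} (K : Field c ℓ) (N t : ℕ)
    (E : Fin (suc t) → Subset N) (n : Fin (suc t) → ℕ) (p : Fin t → Fin N) →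
    (∀ i → 2 ≤ n i) →
    (∀ i → ∣ E i ∣ ≡ n i) →
    (∀ k → E (inject₁ k) ∩ E (fsuc k) ≡ ⁅ p k ⁆) →
    Injective _≡_ _≡_ p →
    (∀ i j → toℕ i + 2 ≤ toℕ j → E i ∩ E j ≡ ⊥) →
    (∀ x → ∃ λ i → x ∈ E i) →
    HasNBCBasis K (parChain (λ i → UCirc (E i) (n i ∸ 1)) p)
theorem5p8 K N t E n p 2≤n ∣E∣ adjacent p-injective distant cover =
  -- The `t + 1` chords are distinct, so `N` splits as `suc t + r`; the number `r` of remaining
  -- elements is the rank.
  at-size (N ∸ suc t , ℕP.m+[n∸m]≡n (FinP.injective⇒≤ chordElement-injective))
    E p 2≤n ∣E∣ adjacent p-injective distant cover
  where
  open Polygons E n p 2≤n ∣E∣ adjacent p-injective distant cover using (chordElement-injective)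
  at-size : ∀ {N} → (∃ λ r → suc t + r ≡ N) → (E : Fin (suc t) → Subset N) (p : Fin t → Fin N) →
    (∀ i → 2 ≤ n i) → (∀ i → ∣ E i ∣ ≡ n i) → (∀ k → E (inject₁ k) ∩ E (fsuc k) ≡ ⁅ p k ⁆) →
    Injective _≡_ _≡_ p → (∀ i j → toℕ i + 2 ≤ toℕ j → E i ∩ E j ≡ ⊥) → (∀ x → ∃ λ i → x ∈ E i) →
    HasNBCBasis K (parChain (λ i → UCirc (E i) (n i ∸ 1)) p)
  at-size (r , ≡.refl) E p a b c d e f = parChain-hasNBCBasis E n p a b c d e f K
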